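{- Let $q\ge1$ be a fixed integer. The number of closed lambda-terms with exactly $q$ unary nodes and size $n$ is $0$ if $n\equiv q\pmod 2$; otherwise it is asymptotically equivalent to $$\frac{\sqrt2}{2^q\sqrt{(q-1)!}\,\sqrt{\pi n^3}}\,(2\sqrt q)^n,$$ as $n\to\infty$ (with $n\not\equiv q\pmod 2$).
   Context: A Motzkin tree is a finite plane rooted tree in which every node has 0, 1 or 2 children (leaf, unary node, binary node). A closed lambda-term (up to $\alpha$-equivalence) is a Motzkin tree together with a map assigning to every leaf one unary node on the path from the root to that leaf (the abstraction binding it). The size of a term is the total number of nodes of the tree. -}

module Defs where

open import Data.Empty using (⊥-elim)
open import Data.Fin using (Fin)
open import Data.Integer using (+_; +[1+_]; -[1+_])
import Data.Integer as ℤ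
import Data.Integer.Properties as ℤ
open import Data.Nat using (ℕ; zero; suc; NonZero)
import Data.Nat as ℕ
import Data.Nat.Properties as ℕ
open import Data.Nat.Solver using (module +-*-Solver)
open import Data.Product using (Σ; ∃-syntax; _×_; _,_; proj₁; proj₂)
open import Data.Rational using (ℚ; mkℚ; 0ℚ; 1ℚ; ½)
import Data.Rational as ℚ
import Data.Rational.Properties as ℚ
import Data.Rational.Solver as ℚ
import Data.Rational.Unnormalised as ℚᵘ
import Data.Rational.Unnormalised.Properties as ℚᵘ
open import Data.Sum using (_⊎_; inj₁; inj₂)
open import Function.Bundles using (Inverse)
open import Level using (0ℓ)
open import Relation.Binary.Bundles using (Setoid)
open import Relation.Binary.PropositionalEquality
open import Relation.Nullary using (yes; no)

data Motzkin : Set where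
  leaf   : Motzkin
  unary  : Motzkin → Motzkin
  binary : Motzkin → Motzkin → Motzkin

size : Motzkin → ℕ
size leaf         = 1
size (unary t)    = suc (size t)
size (binary l r) = suc (size l ℕ.+ size r)

unaryNodes : Motzkin → ℕ
unaryNodes leaf         = 0
unaryNodes (unary t)    = suc (unaryNodes t)
unaryNodes (binary l r) = unaryNodes l ℕ.+ unaryNodes r

data Leaf : Motzkin → Set where
  here  : Leaf leaf
  down  : ∀ {t} → Leaf t → Leaf (unary t)
  left  : ∀ {l r} → Leaf l → Leaf (binary l r)
  right : ∀ {l r} → Leaf r → Leaf (binary l r)

-- UnaryAbove v consists of the unary nodes on the path from the root to v.

data UnaryAbove : ∀ {t} → Leaf t → Set where
  here  : ∀ {t} {v : Leaf t} → UnaryAbove (down v)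
  down  : ∀ {t} {v : Leaf t} → UnaryAbove v → UnaryAbove (down v)
  left  : ∀ {l r} {v : Leaf l} → UnaryAbove v → UnaryAbove (left {l} {r} v)
  right : ∀ {l r} {v : Leaf r} → UnaryAbove v → UnaryAbove (right {l} {r} v)

record ClosedTerm : Set where
  constructor term
  field
    tree   : Motzkin
    binder : (v : Leaf tree) → UnaryAbove v

open ClosedTerm public

-- Without function extensionality, _≡_ would distinguish terms whose
-- binding maps agree at every leaf.

data _≈ₜ_ : ClosedTerm → ClosedTerm → Set where
  same : ∀ {t} {b b′ : (v : Leaf t) → UnaryAbove v} →
         (∀ v → b v ≡ b′ v) → term t b ≈ₜ term t b′

≈ₜ-sym : ∀ {s t} → s ≈ₜ t → t ≈ₜ s
≈ₜ-sym (same e) = same (λ v → sym (e v))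

≈ₜ-trans : ∀ {s t u} → s ≈ₜ t → t ≈ₜ u → s ≈ₜ u
≈ₜ-trans (same e) (same e′) = same (λ v → trans (e v) (e′ v))

ClosedTerms : (q n : ℕ) → Setoid 0ℓ 0ℓ
ClosedTerms q n = record
  { Carrier = Σ ClosedTerm λ t → unaryNodes (tree t) ≡ q × size (tree t) ≡ n
  ; _≈_ = λ s t → proj₁ s ≈ₜ proj₁ t
  ; isEquivalence = record
    { refl = same (λ _ → refl) ; sym = ≈ₜ-sym ; trans = ≈ₜ-trans }
  }

HasCardinality : Setoid 0ℓ 0ℓ → ℕ → Set
HasCardinality S k = Inverse S (setoid (Fin k))

Cauchy : (ℕ → ℚ) → Set
Cauchy f = ∀ ε → 0ℚ ℚ.< ε → ∃[ N ] ∀ m n → N ℕ.≤ m → N ℕ.≤ n →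
           ℚ.∣ f m ℚ.- f n ∣ ℚ.≤ ε

Positiveℚ : (ℕ → ℚ) → Set
Positiveℚ f = ∃[ δ ] (0ℚ ℚ.< δ × ∃[ N ] ∀ n → N ℕ.≤ n → δ ℚ.≤ f n)

-- Totalised by recip 0 = 0, so that reciprocals of reals can be taken
-- pointwise.

recip : ℚ → ℚ
recip   (mkℚ (+ zero)  _ _) = 0ℚ
recip p@(mkℚ +[1+ _ ]  _ _) = ℚ.1/ p
recip p@(mkℚ -[1+ _ ]  _ _) = ℚ.1/ p

isqrt : ℕ → ℕ
isqrt zero    = 0
isqrt (suc n) with suc (isqrt n) ℕ.* suc (isqrt n) ℕ.≤? suc n
... | yes _ = suc (isqrt n)
... | no  _ = isqrt n

-- For p = a / d ≥ 0 and k = n + 1 this is ⌊√ (a d k²)⌋ / (d k), the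
-- largest multiple of 1 / (d k) whose square is at most p; it is 0 for
-- p < 0.

sqrtApprox : ℕ → ℚ → ℚ
sqrtApprox n (mkℚ (+ a) d-1 _) =
  + isqrt (a ℕ.* suc d-1 ℕ.* (suc n ℕ.* suc n)) ℚ./ (suc d-1 ℕ.* suc n)
sqrtApprox n (mkℚ -[1+ _ ] _ _) = 0ℚ

1/1+_ : ℕ → ℚ
1/1+ n = + 1 ℚ./ suc n

-- The n-term sum 1/(2k+1) - 1/(2k+3) + 1/(2k+5) - ...

leibniz : (k n : ℕ) → ℚ
leibniz k zero    = 0ℚ
leibniz k (suc n) = (1/1+ (2 ℕ.* k)) ℚ.- leibniz (suc k) n

open import Algebra.Definitions.RawSemiring ℚ.+-*-rawSemiring using () renaming (_^_ to _^ℚ_)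

module Lemmas where

  open import Data.Rational using (_+_; _*_; _-_; -_; ∣_∣; _≤_; _<_; _⊓_)
  open ℚ.+-*-Solver using (solve; _:=_; _:+_; _:*_; _:-_; :-_; con)

  0≤-⇒≤ : ∀ {p q} → 0ℚ ≤ q - p → p ≤ q
  0≤-⇒≤ {p} {q} h = subst₂ _≤_ (ℚ.+-identityʳ p)
    (solve 2 (λ p q → p :+ (q :- p) := q) refl p q) (ℚ.+-monoʳ-≤ p h)

  ≤⇒0≤- : ∀ {p q} → p ≤ q → 0ℚ ≤ q - p
  ≤⇒0≤- {p} {q} h = subst₂ _≤_ (ℚ.+-inverseʳ p) refl (ℚ.+-monoˡ-≤ (- p) h)

  *-mono : ∀ {p q r s} → 0ℚ ≤ p → 0ℚ ≤ r → p ≤ q → r ≤ s → p * r ≤ q * s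
  *-mono {p} {q} {r} {s} 0≤p 0≤r p≤q r≤s = ℚ.≤-trans
    (ℚ.*-monoʳ-≤-nonNeg r {{ℚ.nonNegative 0≤r}} p≤q)
    (ℚ.*-monoˡ-≤-nonNeg q {{ℚ.nonNegative (ℚ.≤-trans 0≤p p≤q)}} r≤s)

  *-pos : ∀ {p q} → 0ℚ < p → 0ℚ < q → 0ℚ < p * q
  *-pos {p} {q} h k = ℚ.positive⁻¹ (p * q)
    {{ℚ.pos*pos⇒pos p {{ℚ.positive h}} q {{ℚ.positive k}}}}

  0<½ : 0ℚ < ½
  0<½ = ℚ.positive⁻¹ ½

  0<1 : 0ℚ < 1ℚ
  0<1 = ℚ.positive⁻¹ 1ℚ

  ∣∣≤ : ∀ {p ε} → p ≤ ε → - p ≤ ε → ∣ p ∣ ≤ ε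
  ∣∣≤ {p} h k with ℚ.∣p∣≡p∨∣p∣≡-p p
  ... | inj₁ e = subst (_≤ _) (sym e) h
  ... | inj₂ e = subst (_≤ _) (sym e) k

  ≤∣∣ : ∀ p → p ≤ ∣ p ∣
  ≤∣∣ p with ℚ.≤-total 0ℚ p
  ... | inj₁ h = ℚ.≤-reflexive (sym (ℚ.0≤p⇒∣p∣≡p h))
  ... | inj₂ h = ℚ.≤-trans h (ℚ.0≤∣p∣ p)

  neg-diff : ∀ p q → - (p - q) ≡ q - p
  neg-diff = solve 2 (λ p q → :- (p :- q) := q :- p) refl

  ∣-∣-sym : ∀ p q → ∣ p - q ∣ ≡ ∣ q - p ∣
  ∣-∣-sym p q = trans (sym (ℚ.∣-p∣≡∣p∣ (p - q))) (cong ∣_∣ (neg-diff p q))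

  ½+½ : ∀ ε → ½ * ε + ½ * ε ≡ ε
  ½+½ = solve 1 (λ ε → con ½ :* ε :+ con ½ :* ε := ε) refl

  const-cauchy : ∀ p → Cauchy (λ _ → p)
  const-cauchy p ε 0<ε = 0 , λ _ _ _ _ → subst (λ z → ∣ z ∣ ≤ ε) (sym (ℚ.+-inverseʳ p)) (ℚ.<⇒≤ 0<ε)

  -‿cauchy : ∀ {f g} → Cauchy f → Cauchy g → Cauchy (λ n → f n - g n)
  -‿cauchy {f} {g} cf cg ε 0<ε =
    let N , hf = cf (½ * ε) (*-pos 0<½ 0<ε) ; M , hg = cg (½ * ε) (*-pos 0<½ 0<ε) in
    N ℕ.⊔ M , λ m n lm ln → begin
    ∣ (f m - g m) - (f n - g n) ∣
      ≡⟨ cong ∣_∣ (solve 4 (λ a b c d → (a :- b) :- (c :- d) := (a :- c) :- (b :- d)) refl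
           (f m) (g m) (f n) (g n)) ⟩
    ∣ (f m - f n) - (g m - g n) ∣
      ≤⟨ ℚ.∣p-q∣≤∣p∣+∣q∣ (f m - f n) (g m - g n) ⟩
    ∣ f m - f n ∣ + ∣ g m - g n ∣
      ≤⟨ ℚ.+-mono-≤ (hf m n (ℕ.m⊔n≤o⇒m≤o N M lm) (ℕ.m⊔n≤o⇒m≤o N M ln))
                    (hg m n (ℕ.m⊔n≤o⇒n≤o N M lm) (ℕ.m⊔n≤o⇒n≤o N M ln)) ⟩
    ½ * ε + ½ * ε ≡⟨ ½+½ ε ⟩
    ε ∎
    where open ℚ.≤-Reasoning

  ∣∣-cauchy : ∀ {f} → Cauchy f → Cauchy (λ n → ∣ f n ∣)
  ∣∣-cauchy {f} cf ε 0<ε =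
    let N , h = cf ε 0<ε in
    N , λ m n lm ln → ∣∣≤ (half m n (h m n lm ln))
        (subst (_≤ ε) (sym (neg-diff ∣ f m ∣ ∣ f n ∣)) (half n m (h n m ln lm)))
    where
    open ℚ.≤-Reasoning
    half : ∀ m n → ∣ f m - f n ∣ ≤ ε → ∣ f m ∣ - ∣ f n ∣ ≤ ε
    half m n h = begin
      ∣ f m ∣ - ∣ f n ∣
        ≡⟨ cong (λ z → ∣ z ∣ - ∣ f n ∣) (solve 2 (λ a b → a := (a :- b) :+ b) refl (f m) (f n)) ⟩
      ∣ (f m - f n) + f n ∣ - ∣ f n ∣
        ≤⟨ ℚ.+-monoˡ-≤ (- ∣ f n ∣) (ℚ.∣p+q∣≤∣p∣+∣q∣ (f m - f n) (f n)) ⟩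
      (∣ f m - f n ∣ + ∣ f n ∣) - ∣ f n ∣
        ≡⟨ solve 2 (λ a b → (a :+ b) :- b := a) refl ∣ f m - f n ∣ ∣ f n ∣ ⟩
      ∣ f m - f n ∣ ≤⟨ h ⟩
      ε ∎

  recip-inverse : ∀ {p} → 0ℚ < p → p * recip p ≡ 1ℚ
  recip-inverse {mkℚ (+ zero) _ _} h with () ← ℚ.positive h
  recip-inverse {p@(mkℚ +[1+ _ ] _ _)} h = ℚ.*-inverseʳ p
  recip-inverse {p@(mkℚ -[1+ _ ] _ _)} h = ℚ.*-inverseʳ p

  recip-pos : ∀ {p} → 0ℚ < p → 0ℚ < recip p
  recip-pos {p} h = ℚ.*-cancelˡ-<-nonNeg p {{ℚ.nonNegative (ℚ.<⇒≤ h)}}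
    (subst₂ _<_ (sym (ℚ.*-zeroʳ p)) (sym (recip-inverse h)) 0<1)

  recip-antimono : ∀ {p q} → 0ℚ < p → p ≤ q → recip q ≤ recip p
  recip-antimono {p} {q} 0<p p≤q = begin
    recip q                 ≡⟨ sym (ℚ.*-identityˡ (recip q)) ⟩
    1ℚ * recip q            ≡⟨ cong (_* recip q) (sym (recip-inverse 0<p)) ⟩
    (p * recip p) * recip q ≤⟨ *-mono 0≤pp (ℚ.<⇒≤ (recip-pos 0<q))
                                 (ℚ.*-monoʳ-≤-nonNeg (recip p) {{ℚ.nonNegative (ℚ.<⇒≤ (recip-pos 0<p))}} p≤q)
                                 ℚ.≤-refl ⟩
    (q * recip p) * recip q ≡⟨ solve 3 (λ a b c → (a :* b) :* c := b :* (a :* c)) refl q (recip p) (recip q) ⟩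
    recip p * (q * recip q) ≡⟨ cong (recip p *_) (recip-inverse 0<q) ⟩
    recip p * 1ℚ            ≡⟨ ℚ.*-identityʳ (recip p) ⟩
    recip p ∎
    where
    open ℚ.≤-Reasoning
    0<q : 0ℚ < q
    0<q = ℚ.<-≤-trans 0<p p≤q
    0≤pp : 0ℚ ≤ p * recip p
    0≤pp = ℚ.<⇒≤ (*-pos 0<p (recip-pos 0<p))

  bounded : ∀ {f} → Cauchy f → ∃[ B ] (0ℚ < B × ∃[ N ] ∀ n → N ℕ.≤ n → ∣ f n ∣ ≤ B)
  bounded {f} cf =
    let N , h = cf 1ℚ 0<1 in
    ∣ f N ∣ + 1ℚ , ℚ.+-mono-≤-< (ℚ.0≤∣p∣ (f N)) 0<1 , N , λ n le → begin
    ∣ f n ∣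
      ≡⟨ cong ∣_∣ (solve 2 (λ a b → a := b :+ (a :- b)) refl (f n) (f N)) ⟩
    ∣ f N + (f n - f N) ∣ ≤⟨ ℚ.∣p+q∣≤∣p∣+∣q∣ (f N) (f n - f N) ⟩
    ∣ f N ∣ + ∣ f n - f N ∣ ≤⟨ ℚ.+-monoʳ-≤ ∣ f N ∣ (h n N le ℕ.≤-refl) ⟩
    ∣ f N ∣ + 1ℚ ∎
    where open ℚ.≤-Reasoning

  *-close : ∀ {A B η} a b c d → ∣ a ∣ ≤ A → ∣ d ∣ ≤ B → ∣ a - c ∣ ≤ η → ∣ b - d ∣ ≤ η →
            ∣ a * b - c * d ∣ ≤ (A + B) * η
  *-close {A} {B} {η} a b c d ha hd hac hbd = begin
    ∣ a * b - c * d ∣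
      ≡⟨ cong ∣_∣ (solve 4 (λ a b c d → a :* b :- c :* d := a :* (b :- d) :+ d :* (a :- c)) refl a b c d) ⟩
    ∣ a * (b - d) + d * (a - c) ∣
      ≤⟨ ℚ.∣p+q∣≤∣p∣+∣q∣ (a * (b - d)) (d * (a - c)) ⟩
    ∣ a * (b - d) ∣ + ∣ d * (a - c) ∣
      ≡⟨ cong₂ _+_ (ℚ.∣p*q∣≡∣p∣*∣q∣ a (b - d)) (ℚ.∣p*q∣≡∣p∣*∣q∣ d (a - c)) ⟩
    ∣ a ∣ * ∣ b - d ∣ + ∣ d ∣ * ∣ a - c ∣
      ≤⟨ ℚ.+-mono-≤ (*-mono (ℚ.0≤∣p∣ a) (ℚ.0≤∣p∣ (b - d)) ha hbd)
                    (*-mono (ℚ.0≤∣p∣ d) (ℚ.0≤∣p∣ (a - c)) hd hac) ⟩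
    A * η + B * η ≡⟨ sym (ℚ.*-distribʳ-+ η A B) ⟩
    (A + B) * η ∎
    where open ℚ.≤-Reasoning

  cancel-recip : ∀ {p} → 0ℚ < p → ∀ ε → p * (ε * recip p) ≡ ε
  cancel-recip {p} h ε = begin
    p * (ε * recip p) ≡⟨ solve 3 (λ p e r → p :* (e :* r) := e :* (p :* r)) refl p ε (recip p) ⟩
    ε * (p * recip p) ≡⟨ cong (ε *_) (recip-inverse h) ⟩
    ε * 1ℚ            ≡⟨ ℚ.*-identityʳ ε ⟩
    ε ∎
    where open ≡-Reasoning

  *-cauchy : ∀ {f g} → Cauchy f → Cauchy g → Cauchy (λ n → f n * g n)
  *-cauchy {f} {g} cf cg ε 0<ε = combine (bounded {f} cf) (bounded {g} cg)
    where
    Goal = ∃[ N ] ∀ m n → N ℕ.≤ m → N ℕ.≤ n → ∣ f m * g m - f n * g n ∣ ≤ ε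
    combine : ∃[ A ] (0ℚ < A × ∃[ N ] ∀ n → N ℕ.≤ n → ∣ f n ∣ ≤ A) →
              ∃[ B ] (0ℚ < B × ∃[ N ] ∀ n → N ℕ.≤ n → ∣ g n ∣ ≤ B) → Goal
    combine (A , 0<A , N₁ , hA) (B , 0<B , N₂ , hB) = finish (cf η 0<η) (cg η 0<η)
      where
      0<A+B : 0ℚ < A + B
      0<A+B = ℚ.+-mono-< 0<A 0<B
      η = ε * recip (A + B)
      0<η : 0ℚ < η
      0<η = *-pos 0<ε (recip-pos 0<A+B)
      finish : ∃[ N ] (∀ m n → N ℕ.≤ m → N ℕ.≤ n → ∣ f m - f n ∣ ≤ η) →
               ∃[ N ] (∀ m n → N ℕ.≤ m → N ℕ.≤ n → ∣ g m - g n ∣ ≤ η) → Goal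
      finish (N₃ , hf) (N₄ , hg) = (N₁ ℕ.⊔ N₂) ℕ.⊔ (N₃ ℕ.⊔ N₄) , λ m n lm ln →
        let lm₁ = ℕ.m⊔n≤o⇒m≤o (N₁ ℕ.⊔ N₂) _ lm ; lm₂ = ℕ.m⊔n≤o⇒n≤o (N₁ ℕ.⊔ N₂) _ lm
            ln₁ = ℕ.m⊔n≤o⇒m≤o (N₁ ℕ.⊔ N₂) _ ln ; ln₂ = ℕ.m⊔n≤o⇒n≤o (N₁ ℕ.⊔ N₂) _ ln
        in subst (∣ f m * g m - f n * g n ∣ ≤_) (cancel-recip 0<A+B ε)
             (*-close (f m) (g m) (f n) (g n)
               (hA m (ℕ.m⊔n≤o⇒m≤o N₁ N₂ lm₁)) (hB n (ℕ.m⊔n≤o⇒n≤o N₁ N₂ ln₁))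
               (hf m n (ℕ.m⊔n≤o⇒m≤o N₃ N₄ lm₂) (ℕ.m⊔n≤o⇒m≤o N₃ N₄ ln₂))
               (hg m n (ℕ.m⊔n≤o⇒n≤o N₃ N₄ lm₂) (ℕ.m⊔n≤o⇒n≤o N₃ N₄ ln₂)))

  *-positive : ∀ {f g} → Positiveℚ f → Positiveℚ g → Positiveℚ (λ n → f n * g n)
  *-positive (δ , 0<δ , N , h) (γ , 0<γ , M , k) =
    δ * γ , *-pos 0<δ 0<γ , N ℕ.⊔ M , λ n le →
      *-mono (ℚ.<⇒≤ 0<δ) (ℚ.<⇒≤ 0<γ) (h n (ℕ.m⊔n≤o⇒m≤o N M le)) (k n (ℕ.m⊔n≤o⇒n≤o N M le))

  ^-cauchy : ∀ {f} n → Cauchy f → Cauchy (λ m → f m ^ℚ n)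
  ^-cauchy         zero    cf = const-cauchy 1ℚ
  ^-cauchy {f = f} (suc n) cf = *-cauchy {f} {λ m → f m ^ℚ n} cf (^-cauchy {f} n cf)

  ^-positive : ∀ {f} n → Positiveℚ f → Positiveℚ (λ m → f m ^ℚ n)
  ^-positive         zero    pf = 1ℚ , 0<1 , 0 , λ _ _ → ℚ.≤-refl
  ^-positive {f = f} (suc n) pf = *-positive {f} {λ m → f m ^ℚ n} pf (^-positive {f} n pf)

  recip-cauchy : ∀ {f} → Cauchy f → Positiveℚ f → Cauchy (λ n → recip (f n))
  recip-cauchy {f} cf (δ , 0<δ , N , δ≤f) ε 0<ε =
    let M , h = cf (ε * (δ * δ)) (*-pos 0<ε (*-pos 0<δ 0<δ)) in
    N ℕ.⊔ M , λ m n lm ln →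
      let a = f m ; b = f n
          δ≤a = δ≤f m (ℕ.m⊔n≤o⇒m≤o N M lm) ; δ≤b = δ≤f n (ℕ.m⊔n≤o⇒m≤o N M ln)
          0<a = ℚ.<-≤-trans 0<δ δ≤a ; 0<b = ℚ.<-≤-trans 0<δ δ≤b
          0≤ra = ℚ.<⇒≤ (recip-pos 0<a) ; 0≤rb = ℚ.<⇒≤ (recip-pos 0<b)
          0≤rarb = ℚ.<⇒≤ (*-pos (recip-pos 0<a) (recip-pos 0<b))
      in begin
    ∣ recip a - recip b ∣
      ≡⟨ cong ∣_∣ (cong₂ _-_ (sym (ℚ.*-identityʳ (recip a))) (sym (ℚ.*-identityʳ (recip b)))) ⟩
    ∣ recip a * 1ℚ - recip b * 1ℚ ∣
      ≡⟨ cong ∣_∣ (cong₂ _-_ (cong (recip a *_) (sym (recip-inverse 0<b)))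
                             (cong (recip b *_) (sym (recip-inverse 0<a)))) ⟩
    ∣ recip a * (b * recip b) - recip b * (a * recip a) ∣
      ≡⟨ cong ∣_∣ (solve 4 (λ a b r s → r :* (b :* s) :- s :* (a :* r) := (r :* s) :* (b :- a)) refl
           a b (recip a) (recip b)) ⟩
    ∣ (recip a * recip b) * (b - a) ∣
      ≡⟨ ℚ.∣p*q∣≡∣p∣*∣q∣ (recip a * recip b) (b - a) ⟩
    ∣ recip a * recip b ∣ * ∣ b - a ∣
      ≡⟨ cong (_* ∣ b - a ∣) (ℚ.0≤p⇒∣p∣≡p 0≤rarb) ⟩
    (recip a * recip b) * ∣ b - a ∣
      ≤⟨ *-mono 0≤rarb (ℚ.0≤∣p∣ (b - a))
           (*-mono 0≤ra 0≤rb (recip-antimono 0<δ δ≤a) (recip-antimono 0<δ δ≤b))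
           (h n m (ℕ.m⊔n≤o⇒n≤o N M ln) (ℕ.m⊔n≤o⇒n≤o N M lm)) ⟩
    (recip δ * recip δ) * (ε * (δ * δ))
      ≡⟨ solve 3 (λ e d r → (r :* r) :* (e :* (d :* d)) := e :* ((d :* r) :* (d :* r))) refl ε δ (recip δ) ⟩
    ε * ((δ * recip δ) * (δ * recip δ))
      ≡⟨ cong (λ z → ε * (z * z)) (recip-inverse 0<δ) ⟩
    ε * (1ℚ * 1ℚ) ≡⟨ ℚ.*-identityʳ ε ⟩
    ε ∎
    where open ℚ.≤-Reasoning

  recip-positive : ∀ {f} → Cauchy f → Positiveℚ f → Positiveℚ (λ n → recip (f n))
  recip-positive {f} cf (δ , 0<δ , N , h) =
    let B , 0<B , M , k = bounded {f} cf in
    recip B , recip-pos 0<B , N ℕ.⊔ M , λ n le →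
    recip-antimono (ℚ.<-≤-trans 0<δ (h n (ℕ.m⊔n≤o⇒m≤o N M le)))
      (ℚ.≤-trans (≤∣∣ (f n)) (k n (ℕ.m⊔n≤o⇒n≤o N M le)))

  1/1+-antimono : ∀ {m n} → m ℕ.≤ n → 1/1+ n ≤ 1/1+ m
  1/1+-antimono {m} {n} h = ℚ.toℚᵘ-cancel-≤ (begin
    ℚ.toℚᵘ (1/1+ n) ≃⟨ ℚ.toℚᵘ-fromℚᵘ (ℚᵘ.mkℚᵘ (+ 1) n) ⟩
    ℚᵘ.mkℚᵘ (+ 1) n ≤⟨ ℚᵘ.*≤* (ℤ.*-monoˡ-≤-nonNeg (+ 1) (ℤ.+≤+ (ℕ.s≤s h))) ⟩
    ℚᵘ.mkℚᵘ (+ 1) m ≃⟨ ℚᵘ.≃-sym (ℚ.toℚᵘ-fromℚᵘ (ℚᵘ.mkℚᵘ (+ 1) m)) ⟩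
    ℚ.toℚᵘ (1/1+ m) ∎)
    where open ℚᵘ.≤-Reasoning

  0≤1/1+ : ∀ n → 0ℚ ≤ 1/1+ n
  0≤1/1+ n = ℚ.nonNegative⁻¹ (1/1+ n) {{ℚ.normalize-nonNeg 1 (suc n)}}

  archimedes : ∀ {ε} → 0ℚ < ε → ∃[ N ] ∀ n → N ℕ.≤ n → 1/1+ n ≤ ε
  archimedes {mkℚ (+ zero) _ _} h with () ← ℚ.positive h
  archimedes {mkℚ -[1+ _ ] _ _} h with () ← ℚ.positive h
  archimedes {ε@(mkℚ +[1+ k ] d _)} h = d , λ n d≤n → ℚ.toℚᵘ-cancel-≤ (begin
    ℚ.toℚᵘ (1/1+ n) ≃⟨ ℚ.toℚᵘ-fromℚᵘ (ℚᵘ.mkℚᵘ (+ 1) n) ⟩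
    ℚᵘ.mkℚᵘ (+ 1) n ≤⟨ ℚᵘ.*≤* (ℤ.+≤+ (ℕ.*-mono-≤ {1} {suc k} (ℕ.s≤s ℕ.z≤n) (ℕ.s≤s d≤n))) ⟩
    ℚ.toℚᵘ ε ∎)
    where open ℚᵘ.≤-Reasoning

  isqrt-lower : ∀ n → isqrt n ℕ.* isqrt n ℕ.≤ n
  isqrt-lower zero    = ℕ.z≤n
  isqrt-lower (suc n) with suc (isqrt n) ℕ.* suc (isqrt n) ℕ.≤? suc n
  ... | yes h = h
  ... | no  _ = ℕ.m≤n⇒m≤1+n (isqrt-lower n)

  isqrt-upper : ∀ n → n ℕ.< suc (isqrt n) ℕ.* suc (isqrt n)
  isqrt-upper zero    = ℕ.s≤s ℕ.z≤n
  isqrt-upper (suc n) with suc (isqrt n) ℕ.* suc (isqrt n) ℕ.≤? suc n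
  ... | yes _ = ℕ.≤-<-trans (isqrt-upper n)
                  (ℕ.*-mono-< (ℕ.n<1+n (suc (isqrt n))) (ℕ.n<1+n (suc (isqrt n))))
  ... | no  h = ℕ.≰⇒> h

  0≤sqrtApprox : ∀ n p → 0ℚ ≤ sqrtApprox n p
  0≤sqrtApprox n (mkℚ (+ a) d _) =
    ℚ.nonNegative⁻¹ (+ r ℚ./ D) {{ℚ.normalize-nonNeg r D}}
    where
    r = isqrt (a ℕ.* suc d ℕ.* (suc n ℕ.* suc n))
    D = suc d ℕ.* suc n
  0≤sqrtApprox n (mkℚ -[1+ _ ] _ _) = ℚ.≤-refl

  sqrtApprox-lower : ∀ n p → 0ℚ < sqrtApprox n p → sqrtApprox n p * sqrtApprox n p ≤ p
  sqrtApprox-lower n (mkℚ -[1+ _ ] _ _) h = ⊥-elim (ℚ.<-irrefl refl h)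
  sqrtApprox-lower n p@(mkℚ (+ a) d _) _ = ℚ.toℚᵘ-cancel-≤ (begin
    ℚ.toℚᵘ (s * s)           ≃⟨ ℚ.toℚᵘ-homo-* s s ⟩
    ℚ.toℚᵘ s ℚᵘ.* ℚ.toℚᵘ s   ≃⟨ ℚᵘ.*-cong (ℚ.toℚᵘ-fromℚᵘ r/D) (ℚ.toℚᵘ-fromℚᵘ r/D) ⟩
    r/D ℚᵘ.* r/D             ≤⟨ ℚᵘ.*≤* (subst₂ ℤ._≤_ lhs (ℤ.pos-* a (D ℕ.* D)) (ℤ.+≤+ rrd≤aDD)) ⟩
    ℚ.toℚᵘ p ∎)
    where
    open ℚᵘ.≤-Reasoning
    open +-*-Solver using () renaming (solve to solveℕ; _:=_ to _:=′_; _:*_ to _:*′_)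
    k = suc n
    r = isqrt (a ℕ.* suc d ℕ.* (k ℕ.* k))
    D = suc d ℕ.* k
    s = sqrtApprox n p
    r/D = ℚᵘ.mkℚᵘ (+ r) (ℕ.pred D)
    lhs : + (r ℕ.* r ℕ.* suc d) ≡ (+ r ℤ.* + r) ℤ.* + suc d
    lhs = trans (ℤ.pos-* (r ℕ.* r) (suc d)) (cong (ℤ._* + suc d) (ℤ.pos-* r r))
    rrd≤aDD : r ℕ.* r ℕ.* suc d ℕ.≤ a ℕ.* (D ℕ.* D)
    rrd≤aDD = ℕ.≤-trans (ℕ.*-monoˡ-≤ (suc d) (isqrt-lower (a ℕ.* suc d ℕ.* (k ℕ.* k))))
      (ℕ.≤-reflexive (solveℕ 3 (λ a d k → a :*′ d :*′ (k :*′ k) :*′ d :=′ a :*′ ((d :*′ k) :*′ (d :*′ k)))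
        refl a (suc d) k))

  sqrtApprox-upper : ∀ n p → p < (sqrtApprox n p + 1/1+ n) * (sqrtApprox n p + 1/1+ n)
  sqrtApprox-upper n p@(mkℚ -[1+ _ ] _ _) = ℚ.<-≤-trans (ℚ.negative⁻¹ p)
    (*-mono ℚ.≤-refl ℚ.≤-refl 0≤s 0≤s)
    where
    0≤s : 0ℚ ≤ 0ℚ + 1/1+ n
    0≤s = subst (0ℚ ≤_) (sym (ℚ.+-identityˡ (1/1+ n))) (0≤1/1+ n)
  sqrtApprox-upper n p@(mkℚ (+ a) d _) = ℚ.<-≤-trans p<tt (*-mono 0≤t 0≤t t≤s+u t≤s+u)
    where
    open +-*-Solver using () renaming (solve to solveℕ; _:=_ to _:=′_; _:*_ to _:*′_; _:+_ to _:+′_; con to con′)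
    k = suc n
    r = isqrt (a ℕ.* suc d ℕ.* (k ℕ.* k))
    D = suc d ℕ.* k
    s = sqrtApprox n p
    u = 1/1+ n
    t = + suc r ℚ./ D
    r/D = ℚᵘ.mkℚᵘ (+ r) (ℕ.pred D)
    t/D = ℚᵘ.mkℚᵘ (+ suc r) (ℕ.pred D)
    u/1 = ℚᵘ.mkℚᵘ (+ 1) n
    0≤t : 0ℚ ≤ t
    0≤t = ℚ.nonNegative⁻¹ t {{ℚ.normalize-nonNeg (suc r) D}}
    aDD<ttd : a ℕ.* (D ℕ.* D) ℕ.< suc r ℕ.* suc r ℕ.* suc d
    aDD<ttd = subst (ℕ._< suc r ℕ.* suc r ℕ.* suc d)
      (solveℕ 3 (λ a d k → a :*′ d :*′ (k :*′ k) :*′ d :=′ a :*′ ((d :*′ k) :*′ (d :*′ k)))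
        refl a (suc d) k)
      (ℕ.*-monoˡ-< (suc d) (isqrt-upper (a ℕ.* suc d ℕ.* (k ℕ.* k))))
    p<tt : p < t * t
    p<tt = ℚ.toℚᵘ-cancel-< (begin-strict
      ℚ.toℚᵘ p                 <⟨ ℚᵘ.*<* (subst₂ ℤ._<_ (ℤ.pos-* a (D ℕ.* D))
                                    (ℤ.pos-* (suc r ℕ.* suc r) (suc d)) (ℤ.+<+ aDD<ttd)) ⟩
      t/D ℚᵘ.* t/D             ≃⟨ ℚᵘ.≃-sym (ℚᵘ.*-cong (ℚ.toℚᵘ-fromℚᵘ t/D) (ℚ.toℚᵘ-fromℚᵘ t/D)) ⟩
      ℚ.toℚᵘ t ℚᵘ.* ℚ.toℚᵘ t   ≃⟨ ℚᵘ.≃-sym (ℚ.toℚᵘ-homo-* t t) ⟩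
      ℚ.toℚᵘ (t * t) ∎)
      where open ℚᵘ.≤-Reasoning
    tDk≤ : suc r ℕ.* (D ℕ.* k) ℕ.≤ (r ℕ.* k ℕ.+ 1 ℕ.* D) ℕ.* D
    tDk≤ = ℕ.≤-trans
      (ℕ.≤-reflexive (solveℕ 3 (λ r D k → (con′ 1 :+′ r) :*′ (D :*′ k) :=′ r :*′ k :*′ D :+′ k :*′ D) refl r D k))
      (ℕ.≤-trans
        (ℕ.+-monoʳ-≤ (r ℕ.* k ℕ.* D) (ℕ.*-monoˡ-≤ D (ℕ.m≤n*m k (suc d))))
        (ℕ.≤-reflexive (solveℕ 3 (λ r D k → r :*′ k :*′ D :+′ D :*′ D :=′ (r :*′ k :+′ con′ 1 :*′ D) :*′ D) refl r D k)))
    rhs : + ((r ℕ.* k ℕ.+ 1 ℕ.* D) ℕ.* D) ≡ ((+ r) ℤ.* (+ k) ℤ.+ (+ 1) ℤ.* (+ D)) ℤ.* (+ D)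
    rhs = trans (ℤ.pos-* (r ℕ.* k ℕ.+ 1 ℕ.* D) D)
      (cong (ℤ._* + D) (cong₂ ℤ._+_ (ℤ.pos-* r k) (ℤ.pos-* 1 D)))
    t≤s+u : t ≤ s + u
    t≤s+u = ℚ.toℚᵘ-cancel-≤ (begin
      ℚ.toℚᵘ t                 ≃⟨ ℚ.toℚᵘ-fromℚᵘ t/D ⟩
      t/D                      ≤⟨ ℚᵘ.*≤* (subst₂ ℤ._≤_ (ℤ.pos-* (suc r) (D ℕ.* k)) rhs (ℤ.+≤+ tDk≤)) ⟩
      r/D ℚᵘ.+ u/1             ≃⟨ ℚᵘ.≃-sym (ℚᵘ.+-cong (ℚ.toℚᵘ-fromℚᵘ r/D) (ℚ.toℚᵘ-fromℚᵘ u/1)) ⟩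
      ℚ.toℚᵘ s ℚᵘ.+ ℚ.toℚᵘ u   ≃⟨ ℚᵘ.≃-sym (ℚ.toℚᵘ-homo-+ s u) ⟩
      ℚ.toℚᵘ (s + u) ∎)
      where open ℚᵘ.≤-Reasoning

  sqrt-close : ∀ {ε} m n p q → 0ℚ < ε → p - q ≤ (½ * ε) * (½ * ε) → 1/1+ n ≤ ½ * ε →
               sqrtApprox m p - sqrtApprox n q ≤ ε
  sqrt-close {ε} m n p q 0<ε p-q≤ u≤ = subst (s - t ≤_) (solve 2 (λ t e → (t :+ e) :- t := e) refl t ε)
    (ℚ.+-monoˡ-≤ (- t) (ℚ.≮⇒≥ λ t+ε<s → ℚ.<-irrefl refl (contra t+ε<s)))
    where
    open ℚ.≤-Reasoning
    s = sqrtApprox m p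
    t = sqrtApprox n q
    u = 1/1+ n
    h = ½ * ε
    0≤t = 0≤sqrtApprox n q
    0≤ε = ℚ.<⇒≤ 0<ε
    0≤½ = ℚ.<⇒≤ 0<½
    0≤t+ε : 0ℚ ≤ t + ε
    0≤t+ε = ℚ.+-mono-≤ 0≤t 0≤ε
    0≤t+u : 0ℚ ≤ t + u
    0≤t+u = ℚ.+-mono-≤ 0≤t (0≤1/1+ n)
    t+u≤t+h : t + u ≤ t + h
    t+u≤t+h = ℚ.+-monoʳ-≤ t u≤
    slack : 0ℚ ≤ t * ε + h * ε
    slack = ℚ.+-mono-≤ (*-mono ℚ.≤-refl ℚ.≤-refl 0≤t 0≤ε)
                       (*-mono ℚ.≤-refl ℚ.≤-refl (*-mono ℚ.≤-refl ℚ.≤-refl 0≤½ 0≤ε) 0≤ε)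
    contra : t + ε < s → p < p
    contra t+ε<s = begin-strict
      p                         ≡⟨ solve 2 (λ p q → p := q :+ (p :- q)) refl p q ⟩
      q + (p - q)               ≤⟨ ℚ.+-monoʳ-≤ q p-q≤ ⟩
      q + h * h                 <⟨ ℚ.+-monoˡ-< (h * h) (sqrtApprox-upper n q) ⟩
      (t + u) * (t + u) + h * h ≤⟨ ℚ.+-monoˡ-≤ (h * h) (*-mono 0≤t+u 0≤t+u t+u≤t+h t+u≤t+h) ⟩
      (t + h) * (t + h) + h * h ≤⟨ 0≤-⇒≤ (subst (0ℚ ≤_) (solve 2 (λ t e →
                                     t :* e :+ con ½ :* e :* e :=
                                     (t :+ e) :* (t :+ e) :- ((t :+ con ½ :* e) :* (t :+ con ½ :* e)
                                       :+ con ½ :* e :* (con ½ :* e))) refl t ε) slack) ⟩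
      (t + ε) * (t + ε)         ≤⟨ *-mono 0≤t+ε 0≤t+ε (ℚ.<⇒≤ t+ε<s) (ℚ.<⇒≤ t+ε<s) ⟩
      s * s                     ≤⟨ sqrtApprox-lower m p (ℚ.≤-<-trans 0≤t+ε t+ε<s) ⟩
      p ∎

  sqrt-cauchy : ∀ {f} → Cauchy f → Cauchy (λ n → sqrtApprox n (f n))
  sqrt-cauchy {f} cf ε 0<ε =
    let 0<h = *-pos 0<½ 0<ε
        N , hf = cf ((½ * ε) * (½ * ε)) (*-pos 0<h 0<h)
        M , hM = archimedes 0<h
        close : ∀ m n → N ℕ.⊔ M ℕ.≤ m → N ℕ.⊔ M ℕ.≤ n → sqrtApprox m (f m) - sqrtApprox n (f n) ≤ ε
        close m n lm ln = sqrt-close m n (f m) (f n) 0<ε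
          (ℚ.≤-trans (≤∣∣ (f m - f n)) (hf m n (ℕ.m⊔n≤o⇒m≤o N M lm) (ℕ.m⊔n≤o⇒m≤o N M ln)))
          (hM n (ℕ.m⊔n≤o⇒n≤o N M ln))
    in N ℕ.⊔ M , λ m n lm ln → ∣∣≤ (close m n lm ln)
         (subst (_≤ ε) (sym (neg-diff (sqrtApprox m (f m)) (sqrtApprox n (f n)))) (close n m ln lm))

  sqrt-bound : ∀ {γ} n p → 0ℚ < γ → γ * γ ≤ p → 1/1+ n ≤ ½ * γ → ½ * γ ≤ sqrtApprox n p
  sqrt-bound {γ} n p 0<γ γγ≤p u≤ = ℚ.≮⇒≥ λ s<h →
    let s+u≤γ = subst (s + u ≤_) (½+½ γ) (ℚ.+-mono-≤ (ℚ.<⇒≤ s<h) u≤)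
    in ℚ.<-irrefl refl (ℚ.<-≤-trans (sqrtApprox-upper n p)
         (ℚ.≤-trans (*-mono 0≤s+u 0≤s+u s+u≤γ s+u≤γ) γγ≤p))
    where
    s = sqrtApprox n p
    u = 1/1+ n
    0≤s+u : 0ℚ ≤ s + u
    0≤s+u = ℚ.+-mono-≤ (0≤sqrtApprox n p) (0≤1/1+ n)

  ⊓-pos : ∀ {p q} → 0ℚ < p → 0ℚ < q → 0ℚ < p ⊓ q
  ⊓-pos {p} {q} h k with ℚ.⊓-sel p q
  ... | inj₁ e = subst (0ℚ <_) (sym e) h
  ... | inj₂ e = subst (0ℚ <_) (sym e) k

  sqrt-positive : ∀ {f} → Positiveℚ f → Positiveℚ (λ n → sqrtApprox n (f n))
  sqrt-positive {f} (δ , 0<δ , N , h) =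
    let γ = δ ⊓ 1ℚ
        0<γ = ⊓-pos 0<δ 0<1
        0≤γ = ℚ.<⇒≤ 0<γ
        γγ≤δ = subst (γ * γ ≤_) (ℚ.*-identityʳ δ) (*-mono 0≤γ 0≤γ (ℚ.p⊓q≤p δ 1ℚ) (ℚ.p⊓q≤q δ 1ℚ))
        M , hM = archimedes (*-pos 0<½ 0<γ)
    in ½ * γ , *-pos 0<½ 0<γ , N ℕ.⊔ M , λ n le →
         sqrt-bound n (f n) 0<γ (ℚ.≤-trans γγ≤δ (h n (ℕ.m⊔n≤o⇒m≤o N M le))) (hM n (ℕ.m⊔n≤o⇒n≤o N M le))

  leibniz-bounds : ∀ k n → 0ℚ ≤ leibniz k n × leibniz k n ≤ 1/1+ (2 ℕ.* k)
  leibniz-bounds k zero    = ℚ.≤-refl , 0≤1/1+ (2 ℕ.* k)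
  leibniz-bounds k (suc n) =
    let a = 1/1+ (2 ℕ.* k)
        0≤l , l≤ = leibniz-bounds (suc k) n
    in ≤⇒0≤- (ℚ.≤-trans l≤ (1/1+-antimono (ℕ.*-monoʳ-≤ 2 (ℕ.n≤1+n k))))
     , subst (a - leibniz (suc k) n ≤_) (ℚ.+-identityʳ a) (ℚ.+-monoʳ-≤ a (ℚ.neg-antimono-≤ 0≤l))

  leibniz-close : ∀ k n j → ∣ leibniz k (n ℕ.+ j) - leibniz k n ∣ ≤ 1/1+ (2 ℕ.* (k ℕ.+ n))
  leibniz-close k zero j =
    let 0≤l , l≤ = leibniz-bounds k j
    in subst₂ _≤_
         (sym (trans (cong ∣_∣ (ℚ.+-identityʳ (leibniz k j))) (ℚ.0≤p⇒∣p∣≡p 0≤l)))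
         (cong (λ i → 1/1+ (2 ℕ.* i)) (sym (ℕ.+-identityʳ k))) l≤
  leibniz-close k (suc n) j = subst₂ _≤_
    (trans (∣-∣-sym L L′) (cong ∣_∣ (solve 3 (λ a x y → y :- x := (a :- x) :- (a :- y)) refl a L L′)))
    (cong (λ i → 1/1+ (2 ℕ.* i)) (sym (ℕ.+-suc k n)))
    (leibniz-close (suc k) n j)
    where
    a = 1/1+ (2 ℕ.* k)
    L = leibniz (suc k) (n ℕ.+ j)
    L′ = leibniz (suc k) n

  leibniz-cauchy : Cauchy (leibniz 0)
  leibniz-cauchy ε 0<ε = let N , h = archimedes 0<ε in N , λ m n lm ln → wlog N h m n lm ln (ℕ.≤-total n m)
    where
    close : ∀ N → (∀ n → N ℕ.≤ n → 1/1+ n ≤ ε) → ∀ m n → N ℕ.≤ n → n ℕ.≤ m →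
            ∣ leibniz 0 m - leibniz 0 n ∣ ≤ ε
    close N h m n ln n≤m = subst (λ i → ∣ leibniz 0 i - leibniz 0 n ∣ ≤ ε) (ℕ.m+[n∸m]≡n n≤m)
      (ℚ.≤-trans (leibniz-close 0 n (m ℕ.∸ n)) (h (2 ℕ.* n) (ℕ.≤-trans ln (ℕ.m≤n*m n 2))))
    wlog : ∀ N → (∀ n → N ℕ.≤ n → 1/1+ n ≤ ε) → ∀ m n → N ℕ.≤ m → N ℕ.≤ n →
           n ℕ.≤ m ⊎ m ℕ.≤ n → ∣ leibniz 0 m - leibniz 0 n ∣ ≤ ε
    wlog N h m n lm ln (inj₁ n≤m) = close N h m n ln n≤m
    wlog N h m n lm ln (inj₂ m≤n) =
      subst (_≤ ε) (∣-∣-sym (leibniz 0 n) (leibniz 0 m)) (close N h n m lm m≤n)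

  leibniz-positive : Positiveℚ (leibniz 0)
  leibniz-positive = 1/1+ 0 - 1/1+ 2 , ℚ.positive⁻¹ (1/1+ 0 - 1/1+ 2) , 1 , bound
    where
    bound : ∀ n → 1 ℕ.≤ n → 1/1+ 0 - 1/1+ 2 ≤ leibniz 0 n
    bound (suc n) _ = ℚ.+-monoʳ-≤ (1/1+ 0) (ℚ.neg-antimono-≤ (proj₂ (leibniz-bounds 1 n)))

record ℝ : Set where
  no-eta-equality
  constructor mkℝ
  field
    approx : ℕ → ℚ
    cauchy : Cauchy approx

open ℝ public

record Positive (x : ℝ) : Set where
  constructor mkPositive
  field
    positive : Positiveℚ (approx x)

open Positive public

infix  4 _≤_
infixl 6 _-_
infixl 7 _*_ _/_
infixr 8 _^_
infix  9 √_

-- Approximations of x ≤ y need only be ordered up to an error that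
-- vanishes in the limit.

_≤_ : ℝ → ℝ → Set
x ≤ y = ∀ ε → 0ℚ ℚ.< ε → ∃[ N ] ∀ n → N ℕ.≤ n → approx x n ℚ.≤ approx y n ℚ.+ ε

fromℚ : ℚ → ℝ
fromℚ p .approx _ = p
fromℚ p .cauchy   = Lemmas.const-cauchy p

fromℕ : ℕ → ℝ
fromℕ n .approx _ = + n ℚ./ 1
fromℕ n .cauchy   = Lemmas.const-cauchy (+ n ℚ./ 1)

∣_∣ : ℝ → ℝ
∣ x ∣ .approx n = ℚ.∣ approx x n ∣
∣ x ∣ .cauchy   = Lemmas.∣∣-cauchy {approx x} (cauchy x)

_-_ : ℝ → ℝ → ℝ
(x - y) .approx n = approx x n ℚ.- approx y n
(x - y) .cauchy   = Lemmas.-‿cauchy {approx x} {approx y} (cauchy x) (cauchy y)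

_*_ : ℝ → ℝ → ℝ
(x * y) .approx n = approx x n ℚ.* approx y n
(x * y) .cauchy   = Lemmas.*-cauchy {approx x} {approx y} (cauchy x) (cauchy y)

1/_ : (x : ℝ) → {{Positive x}} → ℝ
(1/ x) .approx n = recip (approx x n)
(1/_ x {{p}}) .cauchy = Lemmas.recip-cauchy {approx x} (cauchy x) (positive p)

_/_ : (x y : ℝ) → {{Positive y}} → ℝ
x / y = x * 1/ y

_^_ : ℝ → ℕ → ℝ
(x ^ n) .approx m = approx x m ^ℚ n
(x ^ n) .cauchy   = Lemmas.^-cauchy {approx x} n (cauchy x)

-- Totalised by √ x = 0 for x < 0.

√_ : ℝ → ℝ
(√ x) .approx n = sqrtApprox n (approx x n)
(√ x) .cauchy   = Lemmas.sqrt-cauchy {approx x} (cauchy x)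

-- By the Leibniz series 1 - 1/3 + 1/5 - ...

π/4 : ℝ
π/4 .approx = leibniz 0
π/4 .cauchy = Lemmas.leibniz-cauchy

π : ℝ
π = fromℕ 4 * π/4

instance
  fromℕ-positive : ∀ {n} .{{_ : NonZero n}} → Positive (fromℕ n)
  fromℕ-positive {n} .positive = + n ℚ./ 1 , ℚ.positive⁻¹ (+ n ℚ./ 1) {{ℚ.normalize-pos n 1}} ,
    0 , λ _ _ → ℚ.≤-refl

  *-positive : ∀ {x y} {{_ : Positive x}} {{_ : Positive y}} → Positive (x * y)
  *-positive {x} {y} {{p}} {{q}} .positive =
    Lemmas.*-positive {approx x} {approx y} (positive p) (positive q)

  √-positive : ∀ {x} {{_ : Positive x}} → Positive (√ x)
  √-positive {x} {{p}} .positive = Lemmas.sqrt-positive {approx x} (positive p)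

  π/4-positive : Positive π/4
  π/4-positive .positive = Lemmas.leibniz-positive

  ^-positive : ∀ {x n} {{_ : Positive x}} → Positive (x ^ n)
  ^-positive {x} {n} {{p}} .positive = Lemmas.^-positive {approx x} n (positive p)

-- f ∼[ P ] g: f n / g n → 1 as n → ∞ through the n satisfying P.  Only
-- positive n matter, so that g n may divide by n.

infix 4 _∼[_]_

_∼[_]_ : ((n : ℕ) → .{{NonZero n}} → ℝ) → (ℕ → Set) → ((n : ℕ) → .{{NonZero n}} → ℝ) → Set
f ∼[ P ] g = ∀ ε → 0ℚ ℚ.< ε → ∃[ N ] ∀ n → .{{_ : NonZero n}} → N ℕ.≤ n → P n →
             ∣ f n - g n ∣ ≤ fromℚ ε * ∣ g n ∣

{-# OPTIONS --safe #-}

-- Let T k j be the generating function, by number of binary nodes, of the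
-- terms with k free variables and j abstractions.  T k 0 is a rescaled
-- Catalan series, and splitting off the root gives
--   T k (j+1) = B k · (T (k+1) j + z Σ T k i · T k i′),  B k = (1 - 4kz)^(-1/2),
-- the sum ranging over i, i′ ≥ 1 with i + i′ = j + 1.  Only T q 0 is singular
-- at z = 1/(4q) among the series that contribute to T 0 q, all others having
-- a larger radius of convergence.  So the growth of the coefficients passes
-- along the chain T q 0, T (q-1) 1, …, T 0 q, each step contributing the
-- factor B k (1/(4q)) = (1 - k/q)^(-1/2); the squares of these factors
-- multiply to q^q / q!.  As the factors are irrational, only the squares of
-- the constants are tracked.
--
-- To bring in π, compare two solutions of the recurrence
-- 4 x(n+1,k) = x(n,k-1) + 2 x(n,k) + x(n,k+1): the binomials C(2n,n+k)/4ⁿ,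
-- of sum 1 over all integers k, and a solution that starts from the terms
-- (-1)^k/(2k+1) of the Leibniz series, of sum π/4 over k ≥ 0 for every n.
-- The ratios of consecutive terms interlace, which confines
-- 2(2n+1) (C(2n,n)/4ⁿ)² π/4 to within C(2n,n)/4ⁿ of 1.

module Submission where

import Algebra.Solver.Ring as RingSolver
open import Data.Empty using (⊥; ⊥-elim)
import Data.Integer as ℤ
import Data.Integer.Properties as ℤ
open import Data.Nat using (ℕ; zero; suc)
import Data.Nat as ℕ
import Data.Nat.Properties as ℕ
open import Data.Product using (Σ; Σ-syntax; ∃; ∃-syntax; _×_; _,_; proj₁; proj₂)
import Data.Rational as ℚ
import Data.Rational.Properties as ℚ
import Data.Rational.Solver as ℚ
import Data.Rational.Unnormalised as ℚᵘ
import Data.Rational.Unnormalised.Properties as ℚᵘ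
open import Relation.Binary.PropositionalEquality hiding (J)
import Defs as D

-- Complex-analytic transfer is replaced by inequalities between coefficients. They are measured
-- against the rational sequence `catalan n` = C(2n,n)/((n+1)4ⁿ) and not against n^(-3/2). After
-- scaling, T q 0 is exactly q times this sequence. Consecutive terms have a ratio tending to 1, so
-- a shift keeps the asymptotic constant. Moreover catalan n ≤ (i+1)² catalan (n+i), so a
-- convolution with a nonnegative series that is summable against (i+1)³ multiplies the constant by
-- the sum of that series. For the kernel B k this sum is squeezed between truncations by means of
-- (B k)² = 1/(1 - 4kz). The constant arises as follows. The start of the chain contributes q² to
-- the square, which makes r = q · q^q/(q-1)! in all. For n = q+1+2b, n³ is about 8b³ and
-- `catalan b`² is about 1/(π b³), so the square of the count is about 8 r (4q)^(2b)/(π n³). This is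
-- the square of the stated expression, because (4q)^n = 4^q q^q · 4q · (4q)^(2b).

module RationalLemmas where

  -- Arithmetic and inequalities of rational numbers

  open import Data.Rational using (ℚ; 0ℚ; 1ℚ; _+_; _*_; _-_; -_; ∣_∣; _≤_; _<_)
  open import Defs using (1/1+_; recip)
  open Defs.Lemmas using (0≤-⇒≤; *-mono; *-pos; 0<1; ≤∣∣; recip-pos; cancel-recip)
  open ℚ.+-*-Solver using (solve; _:=_; _:+_; _:*_; _:-_; :-_; con)

  -- Recursive, so that `fromNat (suc n)` is `1ℚ + fromNat n` by definition and the ring solver can
  -- treat `fromNat n` as a variable. The quotient `+ n / 1` is normalised by a gcd and is stuck
  -- when `n` is a variable.
  fromNat : ℕ → ℚ
  fromNat zero    = 0ℚ
  fromNat (suc n) = 1ℚ + fromNat n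

  fromNat≡/1 : ∀ n → fromNat n ≡ ℤ.+ n ℚ./ 1
  fromNat≡/1 zero    = refl
  fromNat≡/1 (suc n) = trans (cong (1ℚ +_) (fromNat≡/1 n)) (ℚ.toℚᵘ-injective (begin
    ℚ.toℚᵘ (1ℚ + ℤ.+ n ℚ./ 1)
      ≈⟨ ℚ.toℚᵘ-homo-+ 1ℚ (ℤ.+ n ℚ./ 1) ⟩
    ℚ.toℚᵘ 1ℚ ℚᵘ.+ ℚ.toℚᵘ (ℤ.+ n ℚ./ 1)
      ≈⟨ ℚᵘ.+-congʳ (ℚ.toℚᵘ 1ℚ) (ℚ.toℚᵘ-fromℚᵘ (ℚᵘ.mkℚᵘ (ℤ.+ n) 0)) ⟩
    ℚ.toℚᵘ 1ℚ ℚᵘ.+ ℚᵘ.mkℚᵘ (ℤ.+ n) 0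
      ≈⟨ ℚᵘ.*≡* (cong (λ m → (ℤ.+ 1 ℤ.+ m) ℤ.* ℤ.+ 1) (ℤ.*-identityʳ (ℤ.+ n))) ⟩
    ℚᵘ.mkℚᵘ (ℤ.+ suc n) 0
      ≈⟨ ℚᵘ.≃-sym (ℚ.toℚᵘ-fromℚᵘ (ℚᵘ.mkℚᵘ (ℤ.+ suc n) 0)) ⟩
    ℚ.toℚᵘ (ℤ.+ suc n ℚ./ 1)                   ∎))
    where open ℚᵘ.≃-Reasoning

  fromNat-+ : ∀ m n → fromNat (m ℕ.+ n) ≡ fromNat m + fromNat n
  fromNat-+ zero    n = sym (ℚ.+-identityˡ (fromNat n))
  fromNat-+ (suc m) n = trans (cong (1ℚ +_) (fromNat-+ m n)) (sym (ℚ.+-assoc 1ℚ (fromNat m) (fromNat n)))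

  fromNat-* : ∀ m n → fromNat (m ℕ.* n) ≡ fromNat m * fromNat n
  fromNat-* zero    n = sym (ℚ.*-zeroˡ (fromNat n))
  fromNat-* (suc m) n = trans (fromNat-+ n (m ℕ.* n)) (trans (cong (_+_ (fromNat n)) (fromNat-* m n))
    (solve 2 (λ a b → b :+ a :* b := (con 1ℚ :+ a) :* b) refl (fromNat m) (fromNat n)))

  0≤1 : 0ℚ ≤ 1ℚ
  0≤1 = ℚ.<⇒≤ 0<1

  0≤fromNat : ∀ n → 0ℚ ≤ fromNat n
  0≤fromNat zero    = ℚ.≤-refl
  0≤fromNat (suc n) = ℚ.+-mono-≤ 0≤1 (0≤fromNat n)

  0<fromNat : ∀ n → 0ℚ < fromNat (suc n)
  0<fromNat n = ℚ.+-mono-<-≤ 0<1 (0≤fromNat n)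

  fromNat-mono : ∀ {m n} → m ℕ.≤ n → fromNat m ≤ fromNat n
  fromNat-mono {n = n} ℕ.z≤n = 0≤fromNat n
  fromNat-mono (ℕ.s≤s h) = ℚ.+-monoʳ-≤ 1ℚ (fromNat-mono h)

  fromNat*1/1+ : ∀ n → fromNat (suc n) * 1/1+ n ≡ 1ℚ
  fromNat*1/1+ n = trans (cong (_* 1/1+ n) (fromNat≡/1 (suc n))) (ℚ.toℚᵘ-injective (begin
    ℚ.toℚᵘ (ℤ.+ suc n ℚ./ 1 * 1/1+ n)
      ≈⟨ ℚ.toℚᵘ-homo-* (ℤ.+ suc n ℚ./ 1) (1/1+ n) ⟩
    ℚ.toℚᵘ (ℤ.+ suc n ℚ./ 1) ℚᵘ.* ℚ.toℚᵘ (1/1+ n)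
      ≈⟨ ℚᵘ.*-cong (ℚ.toℚᵘ-fromℚᵘ (ℚᵘ.mkℚᵘ (ℤ.+ suc n) 0))
                 (ℚ.toℚᵘ-fromℚᵘ (ℚᵘ.mkℚᵘ (ℤ.+ 1) n)) ⟩
    ℚᵘ.mkℚᵘ (ℤ.+ suc n) 0 ℚᵘ.* ℚᵘ.mkℚᵘ (ℤ.+ 1) n
      ≈⟨ ℚᵘ.*≡* (cong (λ m → ℤ.+ suc m)
         (trans (ℕ.*-identityʳ (n ℕ.* 1)) (trans (ℕ.*-identityʳ n)
           (sym (trans (ℕ.+-identityʳ (n ℕ.+ 0)) (ℕ.+-identityʳ n)))))) ⟩
    ℚ.toℚᵘ 1ℚ                                     ∎))
    where open ℚᵘ.≃-Reasoning

  0≤* : ∀ {p q} → 0ℚ ≤ p → 0ℚ ≤ q → 0ℚ ≤ p * q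
  0≤* h k = *-mono ℚ.≤-refl ℚ.≤-refl h k

  0≤+ : ∀ {p q} → 0ℚ ≤ p → 0ℚ ≤ q → 0ℚ ≤ p + q
  0≤+ = ℚ.+-mono-≤

  *-monoˡ : ∀ {r p q} → 0ℚ ≤ r → p ≤ q → r * p ≤ r * q
  *-monoˡ {r} h = ℚ.*-monoˡ-≤-nonNeg r {{ℚ.nonNegative h}}

  *-monoʳ : ∀ {r p q} → 0ℚ ≤ r → p ≤ q → p * r ≤ q * r
  *-monoʳ {r} h = ℚ.*-monoʳ-≤-nonNeg r {{ℚ.nonNegative h}}

  *-cancelˡ-≤ : ∀ {r p q} → 0ℚ < r → r * p ≤ r * q → p ≤ q
  *-cancelˡ-≤ {r} h = ℚ.*-cancelˡ-≤-pos r {{ℚ.positive h}}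

  *-cancelˡ : ∀ {r p q} → 0ℚ < r → r * p ≡ r * q → p ≡ q
  *-cancelˡ h e = ℚ.≤-antisym (*-cancelˡ-≤ h (ℚ.≤-reflexive e)) (*-cancelˡ-≤ h (ℚ.≤-reflexive (sym e)))

  -- The form in which polynomial inequalities are proved below: `d` is a visibly nonnegative
  -- certificate, and the equation is left to the ring solver.
  ≤-by : ∀ {p q} d → 0ℚ ≤ d → q - p ≡ d → p ≤ q
  ≤-by d 0≤d e = 0≤-⇒≤ (subst (0ℚ ≤_) (sym e) 0≤d)

  0⇒≡ : ∀ {x y} → x - y ≡ 0ℚ → x ≡ y
  0⇒≡ {x} {y} e = trans (solve 2 (λ x y → x := (x :- y) :+ y) refl x y) (trans (cong (_+ y) e) (ℚ.+-identityˡ y))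

  -- Equations modulo hypotheses: the ring solver checks that x - y is a combination, with explicit
  -- coefficients, of the differences of the two sides of the given equations.
  linear₁ : ∀ {x y p q} a → p ≡ q → x - y ≡ a * (p - q) → x ≡ y
  linear₁ {p = p} a refl e = 0⇒≡ (trans e (solve 2 (λ a p → a :* (p :- p) := con 0ℚ) refl a p))

  linear₂ : ∀ {x y p q p′ q′} a a′ → p ≡ q → p′ ≡ q′ → x - y ≡ a * (p - q) + a′ * (p′ - q′) → x ≡ y
  linear₂ {p = p} {p′ = p′} a a′ refl refl e = 0⇒≡ (trans e
    (solve 4 (λ a p a′ p′ → a :* (p :- p) :+ a′ :* (p′ :- p′) := con 0ℚ) refl a p a′ p′))

  linear₃ : ∀ {x y p q p′ q′ p″ q″} a a′ a″ → p ≡ q → p′ ≡ q′ → p″ ≡ q″ →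
            x - y ≡ a * (p - q) + a′ * (p′ - q′) + a″ * (p″ - q″) → x ≡ y
  linear₃ {p = p} {p′ = p′} {p″ = p″} a a′ a″ refl refl refl e = 0⇒≡ (trans e
    (solve 6 (λ a p a′ p′ a″ p″ → a :* (p :- p) :+ a′ :* (p′ :- p′) :+ a″ :* (p″ :- p″) := con 0ℚ) refl
       a p a′ p′ a″ p″))

  ∣∣-≥ : ∀ {p ε} → ∣ p ∣ ≤ ε → - ε ≤ p
  ∣∣-≥ {p} {ε} h = subst (- ε ≤_) (solve 1 (λ p → :- (:- p) := p) refl p)
    (ℚ.neg-antimono-≤ (ℚ.≤-trans (≤∣∣ (- p)) (ℚ.≤-trans (ℚ.≤-reflexive (ℚ.∣-p∣≡∣p∣ p)) h)))

  ∣∣-≤ : ∀ {p ε} → ∣ p ∣ ≤ ε → p ≤ ε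
  ∣∣-≤ {p} h = ℚ.≤-trans (≤∣∣ p) h

  ∣*∣ˡ : ∀ {p} q → 0ℚ ≤ p → ∣ p * q ∣ ≡ p * ∣ q ∣
  ∣*∣ˡ {p} q h = trans (ℚ.∣p*q∣≡∣p∣*∣q∣ p q) (cong (_* ∣ q ∣) (ℚ.0≤p⇒∣p∣≡p h))

  ∣+∣≤ : ∀ {p q a b} → ∣ p ∣ ≤ a → ∣ q ∣ ≤ b → ∣ p + q ∣ ≤ a + b
  ∣+∣≤ {p} {q} h k = ℚ.≤-trans (ℚ.∣p+q∣≤∣p∣+∣q∣ p q) (ℚ.+-mono-≤ h k)

  p≤p+q : ∀ {p q} → 0ℚ ≤ q → p ≤ p + q
  p≤p+q {p} {q} h = subst (_≤ p + q) (ℚ.+-identityʳ p) (ℚ.+-monoʳ-≤ p h)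

  archimedes-* : ∀ {c ε} → 0ℚ ≤ c → 0ℚ < ε → ∃[ N ] ∀ n → N ℕ.≤ n → c ≤ ε * fromNat n
  archimedes-* {c} {ε} 0≤c 0<ε = suc N , λ n le → bound n le
    where
    0<c+1 : 0ℚ < c + 1ℚ
    0<c+1 = ℚ.+-mono-≤-< 0≤c 0<1
    -- As `c` may be 0, the reciprocal is taken of c + 1.
    δ = ε * recip (c + 1ℚ)
    arch = Defs.Lemmas.archimedes (*-pos 0<ε (recip-pos 0<c+1))
    N = proj₁ arch
    open ℚ.≤-Reasoning
    bound : ∀ n → suc N ℕ.≤ n → c ≤ ε * fromNat n
    bound (suc m) (ℕ.s≤s le) = begin
      c                                         ≡⟨ sym (ℚ.*-identityʳ c) ⟩
      c * 1ℚ
        ≡⟨ cong (c *_) (sym (fromNat*1/1+ m)) ⟩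
      c * (fromNat (suc m) * 1/1+ m)
        ≤⟨ *-monoˡ 0≤c (*-monoˡ (0≤fromNat (suc m)) (proj₂ arch m le)) ⟩
      c * (fromNat (suc m) * δ)
        ≤⟨ *-monoʳ {p = c} (0≤* (0≤fromNat (suc m)) (ℚ.<⇒≤ (*-pos 0<ε (recip-pos 0<c+1))))
             (p≤p+q 0≤1) ⟩
      (c + 1ℚ) * (fromNat (suc m) * δ)
        ≡⟨ solve 4 (λ c e r n → c :* (n :* (e :* r)) := (c :* (e :* r)) :* n) refl
             (c + 1ℚ) ε (recip (c + 1ℚ)) (fromNat (suc m)) ⟩
      ((c + 1ℚ) * δ) * fromNat (suc m)
        ≡⟨ cong (_* fromNat (suc m)) (cancel-recip 0<c+1 ε) ⟩
      ε * fromNat (suc m)                       ∎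

  -- Finite sums

  Σ< : ℕ → (ℕ → ℚ) → ℚ
  Σ< zero    f = 0ℚ
  Σ< (suc n) f = f 0 + Σ< n (λ i → f (suc i))

  Σ<-cong : ∀ n {f g : ℕ → ℚ} → (∀ i → i ℕ.< n → f i ≡ g i) → Σ< n f ≡ Σ< n g
  Σ<-cong zero    h = refl
  Σ<-cong (suc n) h = cong₂ _+_ (h 0 (ℕ.s≤s ℕ.z≤n)) (Σ<-cong n (λ i l → h (suc i) (ℕ.s≤s l)))

  Σ<-mono : ∀ n {f g : ℕ → ℚ} → (∀ i → i ℕ.< n → f i ≤ g i) → Σ< n f ≤ Σ< n g
  Σ<-mono zero    h = ℚ.≤-refl
  Σ<-mono (suc n) h = ℚ.+-mono-≤ (h 0 (ℕ.s≤s ℕ.z≤n)) (Σ<-mono n (λ i l → h (suc i) (ℕ.s≤s l)))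

  0≤Σ< : ∀ n {f : ℕ → ℚ} → (∀ i → 0ℚ ≤ f i) → 0ℚ ≤ Σ< n f
  0≤Σ< zero    h = ℚ.≤-refl
  0≤Σ< (suc n) h = 0≤+ (h 0) (0≤Σ< n (λ i → h (suc i)))

  Σ<-+ : ∀ n (f g : ℕ → ℚ) → Σ< n (λ i → f i + g i) ≡ Σ< n f + Σ< n g
  Σ<-+ zero    f g = refl
  Σ<-+ (suc n) f g = trans (cong (_+_ (f 0 + g 0)) (Σ<-+ n (λ i → f (suc i)) (λ i → g (suc i))))
    (solve 4 (λ a b c d → (a :+ b) :+ (c :+ d) := (a :+ c) :+ (b :+ d)) refl
       (f 0) (g 0) (Σ< n (λ i → f (suc i))) (Σ< n (λ i → g (suc i))))

  Σ<-*ˡ : ∀ n a (f : ℕ → ℚ) → Σ< n (λ i → a * f i) ≡ a * Σ< n f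
  Σ<-*ˡ zero    a f = sym (ℚ.*-zeroʳ a)
  Σ<-*ˡ (suc n) a f = trans (cong (_+_ (a * f 0)) (Σ<-*ˡ n a (λ i → f (suc i)))) (sym (ℚ.*-distribˡ-+ a _ _))

  Σ<-last : ∀ n (f : ℕ → ℚ) → Σ< (suc n) f ≡ Σ< n f + f n
  Σ<-last zero    f = ℚ.+-comm (f 0) 0ℚ
  Σ<-last (suc n) f = trans (cong (_+_ (f 0)) (Σ<-last n (λ i → f (suc i)))) (sym (ℚ.+-assoc (f 0) _ _))

  Σ<-++ : ∀ m n (f : ℕ → ℚ) → Σ< (m ℕ.+ n) f ≡ Σ< m f + Σ< n (λ i → f (m ℕ.+ i))
  Σ<-++ zero    n f = sym (ℚ.+-identityˡ _)
  Σ<-++ (suc m) n f = trans (cong (_+_ (f 0)) (Σ<-++ m n (λ i → f (suc i)))) (sym (ℚ.+-assoc (f 0) _ _))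

-- Lambda-terms as an inductive family indexed by node counts

module Counting where

  open import Data.Fin using (Fin; zero; suc)
  open import Data.Fin.Permutation using (↔⇒≡)
  open import Data.Fin.Properties using (+↔⊎; *↔×)
  open import Data.Nat
  open import Data.Nat.Properties
  open import Data.Nat.DivMod using ([m+kn]%n≡m%n)
  open import Data.Nat.Solver using (module +-*-Solver)
  open import Data.Product.Function.NonDependent.Propositional using (_×-↔_)
  open import Data.Sum using (_⊎_; inj₁; inj₂)
  open import Data.Sum.Function.Propositional using (_⊎-↔_)
  open import Function using (_∘_)
  open import Function.Bundles using (_↔_; Inverse; mk↔ₛ′)
  open import Function.Construct.Composition using (inverse)
  open import Function.Properties.Inverse using (↔-sym; ↔-trans)
  open import Relation.Binary.Bundles using (Setoid)
  open import Relation.Nullary using (yes; no)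
  open import Defs using (Motzkin; leaf; unary; binary; size; unaryNodes; Leaf; here; down; left; right;
    UnaryAbove; ClosedTerm; term; tree; binder; _≈ₜ_; same; ClosedTerms; HasCardinality)

  -- Tm k q b: terms with k free variables, q abstractions and b applications.

  data Tm (k : ℕ) : ℕ → ℕ → Set where
    var : Fin k → Tm k 0 0
    lam : ∀ {q b} → Tm (suc k) q b → Tm k (suc q) b
    app : ∀ {q b q₁ q₂ b₁ b₂} → q₁ + q₂ ≡ q → b₁ + b₂ ≡ b →
          Tm k q₁ b₁ → Tm k q₂ b₂ → Tm k q (suc b)

  binaryNodes : Motzkin → ℕ
  binaryNodes leaf         = 0
  binaryNodes (unary t)    = binaryNodes t
  binaryNodes (binary l r) = suc (binaryNodes l + binaryNodes r)

  -- A tree has one leaf more than binary nodes, whatever its unary nodes. So q unary and b binary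
  -- nodes give size q + 2b + 1, which is the source of the parity condition.
  size-nodes : ∀ t → size t ≡ unaryNodes t + suc (2 * binaryNodes t)
  size-nodes leaf         = refl
  size-nodes (unary t)    = cong suc (size-nodes t)
  size-nodes (binary l r) = trans (cong suc (cong₂ _+_ (size-nodes l) (size-nodes r)))
    (solve 4 (λ u b u′ b′ → con 1 :+ ((u :+ (con 1 :+ con 2 :* b)) :+ (u′ :+ (con 1 :+ con 2 :* b′)))
       := (u :+ u′) :+ (con 1 :+ con 2 :* (con 1 :+ (b :+ b′)))) refl
       (unaryNodes l) (binaryNodes l) (unaryNodes r) (binaryNodes r))
    where open +-*-Solver

  -- Below an abstraction, a leaf may refer to a binder outside the subtree. Allowing k outside
  -- binders makes recursion on trees possible; k = 0 gives the closed terms.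
  Binding : ℕ → Motzkin → Set
  Binding k t = (v : Leaf t) → Fin k ⊎ UnaryAbove v

  -- Entering the body of an abstraction turns its root into the free variable `zero` and shifts the
  -- others, as with de Bruijn indices.
  push : ∀ {k t} {v : Leaf t} → Fin k ⊎ UnaryAbove (down v) → Fin (suc k) ⊎ UnaryAbove v
  push (inj₁ i)        = inj₁ (suc i)
  push (inj₂ here)     = inj₁ zero
  push (inj₂ (down u)) = inj₂ u

  pull : ∀ {k t} {v : Leaf t} → Fin (suc k) ⊎ UnaryAbove v → Fin k ⊎ UnaryAbove (down v)
  pull (inj₁ zero)    = inj₂ here
  pull (inj₁ (suc i)) = inj₁ i
  pull (inj₂ u)       = inj₂ (down u)

  pull-push : ∀ {k t} {v : Leaf t} (x : Fin k ⊎ UnaryAbove (down v)) → pull (push x) ≡ x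
  pull-push (inj₁ i)        = refl
  pull-push (inj₂ here)     = refl
  pull-push (inj₂ (down u)) = refl

  push-pull : ∀ {k t} {v : Leaf t} (x : Fin (suc k) ⊎ UnaryAbove v) → push (pull x) ≡ x
  push-pull (inj₁ zero)    = refl
  push-pull (inj₁ (suc i)) = refl
  push-pull (inj₂ u)       = refl

  unleft : ∀ {k l r} {v : Leaf l} → Fin k ⊎ UnaryAbove (left {l} {r} v) → Fin k ⊎ UnaryAbove v
  unleft (inj₁ i)        = inj₁ i
  unleft (inj₂ (left u)) = inj₂ u

  unright : ∀ {k l r} {v : Leaf r} → Fin k ⊎ UnaryAbove (right {l} {r} v) → Fin k ⊎ UnaryAbove v
  unright (inj₁ i)         = inj₁ i
  unright (inj₂ (right u)) = inj₂ u

  toleft : ∀ {k l r} {v : Leaf l} → Fin k ⊎ UnaryAbove v → Fin k ⊎ UnaryAbove (left {l} {r} v)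
  toleft (inj₁ i) = inj₁ i
  toleft (inj₂ u) = inj₂ (left u)

  toright : ∀ {k l r} {v : Leaf r} → Fin k ⊎ UnaryAbove v → Fin k ⊎ UnaryAbove (right {l} {r} v)
  toright (inj₁ i) = inj₁ i
  toright (inj₂ u) = inj₂ (right u)

  toleft-unleft : ∀ {k l r} {v : Leaf l} (x : Fin k ⊎ UnaryAbove (left {l} {r} v)) → toleft (unleft x) ≡ x
  toleft-unleft (inj₁ i)        = refl
  toleft-unleft (inj₂ (left u)) = refl

  toright-unright : ∀ {k l r} {v : Leaf r} (x : Fin k ⊎ UnaryAbove (right {l} {r} v)) → toright (unright x) ≡ x
  toright-unright (inj₁ i)         = refl
  toright-unright (inj₂ (right u)) = refl

  unleft-toleft : ∀ {k l r} {v : Leaf l} (x : Fin k ⊎ UnaryAbove v) → unleft {k} {l} {r} (toleft x) ≡ x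
  unleft-toleft (inj₁ i) = refl
  unleft-toleft (inj₂ u) = refl

  unright-toright : ∀ {k l r} {v : Leaf r} (x : Fin k ⊎ UnaryAbove v) → unright {k} {l} {r} (toright x) ≡ x
  unright-toright (inj₁ i) = refl
  unright-toright (inj₂ u) = refl

  variableOf : ∀ {k} → Fin k ⊎ UnaryAbove here → Fin k
  variableOf (inj₁ i) = i

  encode : ∀ {k q b} t → Binding k t → unaryNodes t ≡ q → binaryNodes t ≡ b → Tm k q b
  encode leaf         β refl refl = var (variableOf (β here))
  encode (unary t)    β refl eb   = lam (encode t (λ v → push (β (down v))) refl eb)
  encode (binary l r) β eq   refl = app eq refl (encode l (λ v → unleft (β (left v))) refl refl)
                                                (encode r (λ v → unright (β (right v))) refl refl)

  -- In the round trips the same tree occurs with different proofs of its node counts. Equality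
  -- proofs in ℕ are unique, so matching both with `refl` disposes of them.
  encode-cong : ∀ {k q b} t {β β′ : Binding k t} → (∀ v → β v ≡ β′ v) →
                (eq eq′ : unaryNodes t ≡ q) (eb eb′ : binaryNodes t ≡ b) →
                encode t β eq eb ≡ encode t β′ eq′ eb′
  encode-cong leaf e refl refl refl refl = cong (var ∘ variableOf) (e here)
  encode-cong (unary t) e refl refl eb eb′ =
    cong lam (encode-cong t (λ v → cong push (e (down v))) refl refl eb eb′)
  encode-cong (binary l r) e refl refl refl refl = cong₂ (app refl refl)
    (encode-cong l (λ v → cong unleft (e (left v))) refl refl refl refl)
    (encode-cong r (λ v → cong unright (e (right v))) refl refl refl refl)

  binding-unary : ∀ {k t} → Binding (suc k) t → Binding k (unary t)
  binding-unary β (down v) = pull (β v)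

  binding-binary : ∀ {k l r} → Binding k l → Binding k r → Binding k (binary l r)
  binding-binary β β′ (left v)  = toleft (β v)
  binding-binary β β′ (right v) = toright (β′ v)

  treeOf : ∀ {k q b} → Tm k q b → Motzkin
  treeOf (var i)       = leaf
  treeOf (lam s)       = unary (treeOf s)
  treeOf (app _ _ s r) = binary (treeOf s) (treeOf r)

  bindingOf : ∀ {k q b} (s : Tm k q b) → Binding k (treeOf s)
  bindingOf (var i) here    = inj₁ i
  bindingOf (lam s)         = binding-unary (bindingOf s)
  bindingOf (app _ _ s r)   = binding-binary (bindingOf s) (bindingOf r)

  unary-treeOf : ∀ {k q b} (s : Tm k q b) → unaryNodes (treeOf s) ≡ q
  unary-treeOf (var i)        = refl
  unary-treeOf (lam s)        = cong suc (unary-treeOf s)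
  unary-treeOf (app eq _ s r) = trans (cong₂ _+_ (unary-treeOf s) (unary-treeOf r)) eq

  binary-treeOf : ∀ {k q b} (s : Tm k q b) → binaryNodes (treeOf s) ≡ b
  binary-treeOf (var i)        = refl
  binary-treeOf (lam s)        = binary-treeOf s
  binary-treeOf (app _ eb s r) = cong suc (trans (cong₂ _+_ (binary-treeOf s) (binary-treeOf r)) eb)

  encode-unary : ∀ {k q b} t (β : Binding (suc k) t) (eq : unaryNodes t ≡ q) (eb : binaryNodes t ≡ b) →
                 encode (unary t) (binding-unary β) (cong suc eq) eb ≡ lam (encode t β eq eb)
  encode-unary t β refl eb = cong lam (encode-cong t (λ v → push-pull (β v)) refl refl eb eb)

  encode-binary : ∀ {k q b q₁ q₂ b₁ b₂} l r (β : Binding k l) (β′ : Binding k r)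
                  (u : unaryNodes l ≡ q₁) (u′ : unaryNodes r ≡ q₂)
                  (c : binaryNodes l ≡ b₁) (c′ : binaryNodes r ≡ b₂)
                  (eq : q₁ + q₂ ≡ q) (eb : b₁ + b₂ ≡ b) →
                  encode (binary l r) (binding-binary β β′)
                    (trans (cong₂ _+_ u u′) eq) (cong suc (trans (cong₂ _+_ c c′) eb)) ≡
                  app eq eb (encode l β u c) (encode r β′ u′ c′)
  encode-binary l r β β′ refl refl refl refl refl refl = cong₂ (app refl refl)
    (encode-cong l (λ v → unleft-toleft (β v)) refl refl refl refl)
    (encode-cong r (λ v → unright-toright (β′ v)) refl refl refl refl)

  encode-decode : ∀ {k q b} (s : Tm k q b) →
                  encode (treeOf s) (bindingOf s) (unary-treeOf s) (binary-treeOf s) ≡ s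
  encode-decode (var i)         = refl
  encode-decode (lam s)         = trans
    (encode-unary (treeOf s) (bindingOf s) (unary-treeOf s) (binary-treeOf s)) (cong lam (encode-decode s))
  encode-decode (app eq eb s r) = trans
    (encode-binary (treeOf s) (treeOf r) (bindingOf s) (bindingOf r)
      (unary-treeOf s) (unary-treeOf r) (binary-treeOf s) (binary-treeOf r) eq eb)
    (cong₂ (app eq eb) (encode-decode s) (encode-decode r))

  -- `treeOf (encode t β eq eb)` is `t` only propositionally, so the bindings before and after a
  -- round trip have different types. Relating pairs, with bindings equal pointwise, avoids
  -- transport and mirrors `_≈ₜ_`.
  data _≈ₒ_ {k : ℕ} : Σ Motzkin (Binding k) → Σ Motzkin (Binding k) → Set where
    same : ∀ {t} {β β′ : Binding k t} → (∀ v → β v ≡ β′ v) → (t , β) ≈ₒ (t , β′)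

  unary-≈ : ∀ {k t t′} {β : Binding (suc k) t} {β′ : Binding (suc k) t′} {γ : Binding k (unary t′)} →
            (t , β) ≈ₒ (t′ , β′) → (∀ v → binding-unary β′ v ≡ γ v) →
            (unary t , binding-unary β) ≈ₒ (unary t′ , γ)
  unary-≈ (same e) h = same λ { (down v) → trans (cong pull (e v)) (h (down v)) }

  binary-≈ : ∀ {k l l′ r r′} {β : Binding k l} {β′ : Binding k l′} {γ : Binding k r} {γ′ : Binding k r′}
             {δ : Binding k (binary l′ r′)} →
             (l , β) ≈ₒ (l′ , β′) → (r , γ) ≈ₒ (r′ , γ′) → (∀ v → binding-binary β′ γ′ v ≡ δ v) →
             (binary l r , binding-binary β γ) ≈ₒ (binary l′ r′ , δ)
  binary-≈ (same e) (same e′) h = same λ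
    { (left v)  → trans (cong toleft (e v)) (h (left v))
    ; (right v) → trans (cong toright (e′ v)) (h (right v)) }

  decode-encode : ∀ {k q b} t (β : Binding k t) (eq : unaryNodes t ≡ q) (eb : binaryNodes t ≡ b) →
                  (treeOf (encode t β eq eb) , bindingOf (encode t β eq eb)) ≈ₒ (t , β)
  decode-encode leaf β refl refl = same λ { here → reflect (β here) }
    where
    reflect : ∀ {k} (x : Fin k ⊎ UnaryAbove here) → inj₁ (variableOf x) ≡ x
    reflect (inj₁ i) = refl
  decode-encode (unary t) β refl eb = unary-≈ (decode-encode t _ refl eb) λ { (down v) → pull-push (β (down v)) }
  decode-encode (binary l r) β refl refl = binary-≈ (decode-encode l _ refl refl) (decode-encode r _ refl refl)
    λ { (left v) → toleft-unleft (β (left v)) ; (right v) → toright-unright (β (right v)) }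

  bound : ∀ {t} {v : Leaf t} → Fin 0 ⊎ UnaryAbove v → UnaryAbove v
  bound (inj₂ u) = u

  bound-injective : ∀ {t} {v : Leaf t} (x : Fin 0 ⊎ UnaryAbove v) → inj₂ (bound x) ≡ x
  bound-injective (inj₂ u) = refl

  closed-≈ : ∀ {t} {β : Binding 0 t} {s : ClosedTerm} → (t , β) ≈ₒ (tree s , λ v → inj₂ (binder s v)) →
             term t (λ v → bound (β v)) ≈ₜ s
  closed-≈ (same e) = same (λ v → cong bound (e v))

  closedTerms : ∀ q b → Inverse (ClosedTerms q (q + suc (2 * b))) (setoid (Tm 0 q b))
  closedTerms q b = record
    { to        = to
    ; from      = from
    ; to-cong   = to-cong
    ; from-cong = λ { refl → same (λ _ → refl) }
    ; inverse   = (λ {s} {t} h → trans (to-cong {t} {from s} h) (to-from s))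
                , (λ { {t} {s} refl → from-to t })
    }
    where
    C = Setoid.Carrier (ClosedTerms q (q + suc (2 * b)))
    binary≡ : ∀ {t} → unaryNodes t ≡ q → size t ≡ q + suc (2 * b) → binaryNodes t ≡ b
    binary≡ {t} eq es = *-cancelˡ-≡ _ _ 2 (suc-injective (+-cancelˡ-≡ q _ _
      (trans (cong (_+ suc (2 * binaryNodes t)) (sym eq)) (trans (sym (size-nodes t)) es))))
    to : C → Tm 0 q b
    to (term t β , eq , es) = encode t (λ v → inj₂ (β v)) eq (binary≡ {t} eq es)
    from : Tm 0 q b → C
    from s = term (treeOf s) (λ v → bound (bindingOf s v)) , unary-treeOf s ,
      trans (size-nodes (treeOf s)) (cong₂ (λ u c → u + suc (2 * c)) (unary-treeOf s) (binary-treeOf s))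
    to-cong : ∀ {s t : C} → proj₁ s ≈ₜ proj₁ t → to s ≡ to t
    to-cong {_ , eq , es} {_ , eq′ , es′} (same {t} e) =
      encode-cong t (λ v → cong inj₂ (e v)) eq eq′ (binary≡ {t} eq es) (binary≡ {t} eq′ es′)
    to-from : ∀ s → to (from s) ≡ s
    to-from s = trans (encode-cong (treeOf s) (λ v → bound-injective (bindingOf s v)) _ _ _ _) (encode-decode s)
    from-to : ∀ t → proj₁ (from (to t)) ≈ₜ proj₁ t
    from-to (term t β , eq , es) = closed-≈ (decode-encode t (λ v → inj₂ (β v)) eq (binary≡ {t} eq es))

  -- Finiteness and the recurrences for the counts

  split : (ℕ → ℕ → ℕ) → ℕ → ℕ
  split p zero    = p 0 0
  split p (suc n) = p 0 (suc n) + split (λ i → p (suc i)) n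

  Pairs : (ℕ → ℕ → Set) → ℕ → Set
  Pairs P n = Σ[ i ∈ ℕ ] Σ[ j ∈ ℕ ] (i + j ≡ n × P i j)

  pairs-zero : ∀ {P} → Pairs P 0 ↔ P 0 0
  pairs-zero {P} = mk↔ₛ′ (λ { (zero , zero , refl , x) → x }) (λ x → 0 , 0 , refl , x)
    (λ _ → refl) (λ { (zero , zero , refl , x) → refl })

  pairs-suc : ∀ {P n} → Pairs P (suc n) ↔ (P 0 (suc n) ⊎ Pairs (λ i → P (suc i)) n)
  pairs-suc {P} {n} = mk↔ₛ′
    (λ { (zero , _ , refl , x) → inj₁ x ; (suc i , j , refl , x) → inj₂ (i , j , refl , x) })
    (λ { (inj₁ x) → 0 , suc n , refl , x ; (inj₂ (i , j , e , x)) → suc i , j , cong suc e , x })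
    (λ { (inj₁ x) → refl ; (inj₂ (i , j , refl , x)) → refl })
    (λ { (zero , _ , refl , x) → refl ; (suc i , j , refl , x) → refl })

  pairs-finite : ∀ n {P p} → (∀ i j → i + j ≡ n → P i j ↔ Fin (p i j)) → Pairs P n ↔ Fin (split p n)
  pairs-finite zero    h = ↔-trans pairs-zero (h 0 0 refl)
  pairs-finite (suc n) h = ↔-trans pairs-suc (↔-trans
    (h 0 (suc n) refl ⊎-↔ pairs-finite n (λ i j e → h (suc i) j (cong suc e))) (↔-sym +↔⊎))

  Apps : ℕ → ℕ → ℕ → Set
  Apps k q b = Pairs (λ i j → Pairs (λ x y → Tm k i x × Tm k j y) b) q

  apps : (ℕ → ℕ → ℕ) → ℕ → ℕ → ℕ
  apps f q b = split (λ i j → split (λ x y → f i x * f j y) b) q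

  apps-finite : ∀ {k q b f} → (∀ i x → x ≤ b → Tm k i x ↔ Fin (f i x)) → Apps k q b ↔ Fin (apps f q b)
  apps-finite {q = q} {b} h = pairs-finite q λ i j _ → pairs-finite b λ x y x+y≡b →
    ↔-trans (h i x (≤-trans (m≤m+n x y) (≤-reflexive x+y≡b)) ×-↔ h j y (≤-trans (m≤n+m y x) (≤-reflexive x+y≡b)))
      (↔-sym *↔×)

  tm-var : ∀ {k} → Tm k 0 0 ↔ Fin k
  tm-var = mk↔ₛ′ (λ { (var i) → i }) var (λ _ → refl) (λ { (var i) → refl })

  tm-lam : ∀ {k q} → Tm k (suc q) 0 ↔ Tm (suc k) q 0
  tm-lam = mk↔ₛ′ (λ { (lam s) → s }) lam (λ _ → refl) (λ { (lam s) → refl })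

  tm-app : ∀ {k b} → Tm k 0 (suc b) ↔ Apps k 0 b
  tm-app = mk↔ₛ′ (λ { (app eq eb s r) → _ , _ , eq , _ , _ , eb , s , r })
    (λ { (_ , _ , eq , _ , _ , eb , s , r) → app eq eb s r }) (λ _ → refl) (λ { (app eq eb s r) → refl })

  tm-lam⊎app : ∀ {k q b} → Tm k (suc q) (suc b) ↔ (Tm (suc k) q (suc b) ⊎ Apps k (suc q) b)
  tm-lam⊎app = mk↔ₛ′
    (λ { (lam s) → inj₁ s ; (app eq eb s r) → inj₂ (_ , _ , eq , _ , _ , eb , s , r) })
    (λ { (inj₁ s) → lam s ; (inj₂ (_ , _ , eq , _ , _ , eb , s , r)) → app eq eb s r })
    (λ { (inj₁ s) → refl ; (inj₂ _) → refl })
    (λ { (lam s) → refl ; (app eq eb s r) → refl })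

  -- The first argument bounds b, to make the recursion through the
  -- applications structural.

  boundedCount : (h k q b : ℕ) → ℕ
  boundedCount h       k zero    zero    = k
  boundedCount h       k (suc q) zero    = boundedCount h (suc k) q zero
  boundedCount zero    k q       (suc b) = 0
  boundedCount (suc h) k zero    (suc b) = apps (boundedCount h k) 0 b
  boundedCount (suc h) k (suc q) (suc b) =
    boundedCount (suc h) (suc k) q (suc b) + apps (boundedCount h k) (suc q) b

  tm-finite : ∀ h k q b → b ≤ h → Tm k q b ↔ Fin (boundedCount h k q b)
  tm-finite h       k zero    zero    _       = tm-var
  tm-finite h       k (suc q) zero    _       = ↔-trans tm-lam (tm-finite h (suc k) q zero z≤n)
  tm-finite (suc h) k zero    (suc b) (s≤s l) = ↔-trans tm-app
    (apps-finite (λ i x x≤b → tm-finite h k i x (≤-trans x≤b l)))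
  tm-finite (suc h) k (suc q) (suc b) (s≤s l) = ↔-trans tm-lam⊎app (↔-trans
    (tm-finite (suc h) (suc k) q (suc b) (s≤s l) ⊎-↔
     apps-finite (λ i x x≤b → tm-finite h k i x (≤-trans x≤b l))) (↔-sym +↔⊎))

  count : (k q b : ℕ) → ℕ
  count k q b = boundedCount b k q b

  tm-count : ∀ k q b → Tm k q b ↔ Fin (count k q b)
  tm-count k q b = tm-finite b k q b ≤-refl

  unique-card : ∀ {A : Set} {m n} → A ↔ Fin m → A ↔ Fin n → m ≡ n
  unique-card f g = ↔⇒≡ (↔-trans (↔-sym f) g)

  -- Not definitional: unfolding the left side leaves the bound `b` in every factor, whereas `count`
  -- bounds each factor by its own number of applications. Both sides are cardinalities of the same
  -- type, and a finite type has only one.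
  count-app : ∀ k b → count k 0 (suc b) ≡ apps (count k) 0 b
  count-app k b = unique-card (tm-count k 0 (suc b)) (↔-trans tm-app (apps-finite (λ i x _ → tm-count k i x)))

  count-lam⊎app : ∀ k q b → count k (suc q) (suc b) ≡ count (suc k) q (suc b) + apps (count k) (suc q) b
  count-lam⊎app k q b = unique-card (tm-count k (suc q) (suc b)) (↔-trans tm-lam⊎app
    (↔-trans (tm-count (suc k) q (suc b) ⊎-↔ apps-finite (λ i x _ → tm-count k i x)) (↔-sym +↔⊎)))

  -- If n = q + 1 + 2b for some b, halving recovers this b and the test succeeds. Otherwise no
  -- candidate can pass, including the value 0 that truncated subtraction yields for n ≤ q.
  closedCount : ℕ → ℕ → ℕ
  closedCount q n with n ≟ q + suc (2 * ⌊ n ∸ suc q /2⌋)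
  ... | yes _ = count 0 q ⌊ n ∸ suc q /2⌋
  ... | no  _ = 0

  shift-half : ∀ q b → ⌊ q + suc (2 * b) ∸ suc q /2⌋ ≡ b
  shift-half q b = begin
    ⌊ q + suc (2 * b) ∸ suc q /2⌋ ≡⟨ cong (λ m → ⌊ m ∸ suc q /2⌋) (+-suc q (2 * b)) ⟩
    ⌊ suc q + 2 * b ∸ suc q /2⌋
      ≡⟨ cong ⌊_/2⌋ (m+n∸m≡n (suc q) (2 * b)) ⟩
    ⌊ b + (b + 0) /2⌋
      ≡⟨ cong (λ c → ⌊ b + c /2⌋) (+-identityʳ b) ⟩
    ⌊ b + b /2⌋
      ≡⟨ sym (n≡⌊n+n/2⌋ b) ⟩
    b ∎
    where open ≡-Reasoning

  closedCount-odd : ∀ q b → closedCount q (q + suc (2 * b)) ≡ count 0 q b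
  closedCount-odd q b with q + suc (2 * b) ≟ q + suc (2 * ⌊ q + suc (2 * b) ∸ suc q /2⌋)
  ... | yes _ = cong (count 0 q) (shift-half q b)
  ... | no ¬e = ⊥-elim (¬e (cong (λ c → q + suc (2 * c)) (sym (shift-half q b))))

  closedTerms-card : ∀ q n → HasCardinality (ClosedTerms q n) (closedCount q n)
  closedTerms-card q n with n ≟ q + suc (2 * ⌊ n ∸ suc q /2⌋)
  ... | yes e = subst (λ m → HasCardinality (ClosedTerms q m) (count 0 q ⌊ n ∸ suc q /2⌋)) (sym e)
    (inverse (closedTerms q _) (tm-count 0 q _))
  ... | no ¬e = record
    { to = λ s → ⊥-elim (empty s)
    ; from = λ ()
    ; to-cong = λ {s} _ → ⊥-elim (empty s)
    ; from-cong = λ { {()} }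
    ; inverse = (λ { {()} }) , (λ {s} _ → ⊥-elim (empty s))
    }
    where
    empty : Setoid.Carrier (ClosedTerms q n) → ⊥
    empty (term t _ , eq , es) = ¬e (trans n≡ (cong (λ c → q + suc (2 * c)) (sym
      (trans (cong (λ m → ⌊ m ∸ suc q /2⌋) n≡) (shift-half q (binaryNodes t))))))
      where
      n≡ : n ≡ q + suc (2 * binaryNodes t)
      n≡ = trans (sym es) (trans (size-nodes t) (cong (_+ suc (2 * binaryNodes t)) eq))

  n%2≡[n+2m]%2 : ∀ n m → (n + 2 * m) % 2 ≡ n % 2
  n%2≡[n+2m]%2 n m = trans (cong (λ c → (n + c) % 2) (*-comm 2 m)) ([m+kn]%n≡m%n n m 2)

  suc-%2 : ∀ n → suc n % 2 ≢ n % 2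
  suc-%2 zero          ()
  suc-%2 (suc zero)    ()
  suc-%2 (suc (suc n)) e = suc-%2 n (trans (sym (drop (suc n))) (trans e (drop n)))
    where
    drop : ∀ n → suc (suc n) % 2 ≡ n % 2
    drop n = trans (cong (_% 2) (+-comm 2 n)) (n%2≡[n+2m]%2 n 1)

  closedCount-zero : ∀ q n → n % 2 ≡ q % 2 → closedCount q n ≡ 0
  closedCount-zero q n e with n ≟ q + suc (2 * ⌊ n ∸ suc q /2⌋)
  ... | no  _  = refl
  ... | yes n≡ = ⊥-elim (suc-%2 q (trans (sym (n%2≡[n+2m]%2 (suc q) ⌊ n ∸ suc q /2⌋))
    (trans (cong (_% 2) (trans (sym (+-suc q (2 * ⌊ n ∸ suc q /2⌋))) (sym n≡))) e)))

  even∨odd : ∀ m → ∃ λ b → (m ≡ 2 * b) ⊎ (m ≡ suc (2 * b))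
  even∨odd zero = 0 , inj₁ refl
  even∨odd (suc m) with even∨odd m
  ... | b , inj₁ e = b , inj₂ (cong suc e)
  ... | b , inj₂ e = suc b , inj₁ (trans (cong suc e) (sym (*-suc 2 b)))

  odd-offset : ∀ q n → q ≤ n → n % 2 ≢ q % 2 → ∃ λ b → n ≡ q + suc (2 * b)
  odd-offset q n q≤n ne with even∨odd (n ∸ q)
  ... | b , inj₂ e = b , trans (sym (m+[n∸m]≡n q≤n)) (cong (q +_) e)
  ... | b , inj₁ e = ⊥-elim (ne (trans (cong (_% 2) (trans (sym (m+[n∸m]≡n q≤n)) (cong (q +_) e)))
    (n%2≡[n+2m]%2 q b)))

-- Central binomial coefficients and the Leibniz series

module Wallis where

  open import Data.Rational using (ℚ; 0ℚ; 1ℚ; ½; _+_; _*_; _-_; -_; ∣_∣; _≤_; _<_)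
  open import Defs using (1/1+_; recip; leibniz)
  open Defs.Lemmas using (≤⇒0≤-; *-mono; *-pos; 0<1; ∣∣≤; recip-inverse; recip-pos; 0≤1/1+; 1/1+-antimono)
  open ℚ.+-*-Solver using (solve; _:=_; _:+_; _:*_; _:-_; :-_; con)
  open RationalLemmas

  ¼ : ℚ
  ¼ = ½ * ½

  2ℚ : ℚ
  2ℚ = 1ℚ + 1ℚ

  average : ℚ → ℚ → ℚ → ℚ
  average a b c = ¼ * (a + (b + b) + c)

  -- The rows of a random walk on the nonnegative integers with steps
  -- -1, 0, 1 of probabilities ¼, ½, ¼.  Reflection at 0 makes binomial n k the
  -- value of C(2n, n+k) / 4ⁿ; reflection at -½ makes half n k the multiple
  -- π/2 · C(2n, n+k+½) / 4ⁿ of a generalised binomial coefficient.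

  binomial : ℕ → ℕ → ℚ
  binomial zero    zero    = 1ℚ
  binomial zero    (suc k) = 0ℚ
  binomial (suc n) zero    = average (binomial n 1) (binomial n 0) (binomial n 1)
  binomial (suc n) (suc k) = average (binomial n k) (binomial n (suc k)) (binomial n (suc (suc k)))

  sign : ℕ → ℚ
  sign zero    = 1ℚ
  sign (suc k) = - sign k

  half : ℕ → ℕ → ℚ
  half zero    k       = sign k * 1/1+ (2 ℕ.* k)
  half (suc n) zero    = average (half n 0) (half n 0) (half n 1)
  half (suc n) (suc k) = average (half n k) (half n (suc k)) (half n (suc (suc k)))

  -- The ratio (n-k)/(n+k+1) of neighbouring binomial coefficients, cleared of denominators. A
  -- relation in row n+1 is a combination of relations in row n, in the interior with the weights ¼,
  -- ½, ¼ of the walk.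
  binomial-ratio : ∀ n k →
    (fromNat n + (1ℚ + fromNat k)) * binomial n (suc k) ≡ (fromNat n - fromNat k) * binomial n k
  binomial-ratio zero    zero    = refl
  binomial-ratio zero    (suc k) = trans (ℚ.*-zeroʳ (0ℚ + (1ℚ + fromNat (suc k)))) (sym
    (ℚ.*-zeroʳ (0ℚ - fromNat (suc k))))
  binomial-ratio (suc n) zero    = linear₂ ¼ ¼ (binomial-ratio n 0) (binomial-ratio n 1)
    (solve 4 (λ m a b c →
       ((con 1ℚ :+ m) :+ (con 1ℚ :+ con 0ℚ)) :* (con ¼ :* (a :+ (b :+ b) :+ c))
         :- ((con 1ℚ :+ m) :- con 0ℚ) :* (con ¼ :* (b :+ (a :+ a) :+ b)) :=
       con ¼ :* ((m :+ (con 1ℚ :+ con 0ℚ)) :* b :- (m :- con 0ℚ) :* a) :+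
       con ¼ :* ((m :+ (con 1ℚ :+ (con 1ℚ :+ con 0ℚ))) :* c :- (m :- (con 1ℚ :+ con 0ℚ)) :* b)) refl
       (fromNat n) (binomial n 0) (binomial n 1) (binomial n 2))
  binomial-ratio (suc n) (suc k) = linear₃ ¼ ½ ¼ (binomial-ratio n k) (binomial-ratio n (suc k)) (binomial-ratio n (suc (suc k)))
    (solve 6 (λ m κ a b c d →
       ((con 1ℚ :+ m) :+ (con 1ℚ :+ (con 1ℚ :+ κ))) :* (con ¼ :* (b :+ (c :+ c) :+ d))
         :- ((con 1ℚ :+ m) :- (con 1ℚ :+ κ)) :* (con ¼ :* (a :+ (b :+ b) :+ c)) :=
       con ¼ :* ((m :+ (con 1ℚ :+ κ)) :* b :- (m :- κ) :* a) :+
       con ½ :* ((m :+ (con 1ℚ :+ (con 1ℚ :+ κ))) :* c :- (m :- (con 1ℚ :+ κ)) :* b) :+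
       con ¼ :* ((m :+ (con 1ℚ :+ (con 1ℚ :+ (con 1ℚ :+ κ)))) :* d :- (m :- (con 1ℚ :+ (con 1ℚ :+ κ))) :* c)) refl
       (fromNat n) (fromNat k) (binomial n k) (binomial n (suc k)) (binomial n (suc (suc k))) (binomial n (suc (suc (suc k)))))

  odd*1/1+ : ∀ k → (1ℚ + 2ℚ * fromNat k) * 1/1+ (2 ℕ.* k) ≡ 1ℚ
  odd*1/1+ k = trans (cong (λ z → (1ℚ + z) * 1/1+ (2 ℕ.* k)) (sym (fromNat-* 2 k))) (fromNat*1/1+ (2 ℕ.* k))

  -- `binomial-ratio` with k replaced by k + ½ and both factors doubled. In row 0 it is the ratio
  -- -(2k+1)/(2k+3) of consecutive Leibniz terms.
  half-ratio : ∀ n k → (2ℚ * fromNat n + (2ℚ * fromNat k + (1ℚ + 2ℚ))) * half n (suc k) ≡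
                       (2ℚ * fromNat n - (2ℚ * fromNat k + 1ℚ)) * half n k
  half-ratio zero k = linear₂ (- sign k) (sign k) (odd*1/1+ (suc k)) (odd*1/1+ k)
    (solve 4 (λ s κ u v →
       (con 0ℚ :+ (con 2ℚ :* κ :+ (con 1ℚ :+ con 2ℚ))) :* (:- s :* u)
         :- (con 0ℚ :- (con 2ℚ :* κ :+ con 1ℚ)) :* (s :* v) :=
       :- s :* ((con 1ℚ :+ con 2ℚ :* (con 1ℚ :+ κ)) :* u :- con 1ℚ) :+
       s :* ((con 1ℚ :+ con 2ℚ :* κ) :* v :- con 1ℚ)) refl
       (sign k) (fromNat k) (1/1+ (2 ℕ.* suc k)) (1/1+ (2 ℕ.* k)))
  half-ratio (suc n) zero = linear₂ ½ ¼ (half-ratio n 0) (half-ratio n 1)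
    (solve 4 (λ m a b c →
       (con 2ℚ :* (con 1ℚ :+ m) :+ (con 0ℚ :+ (con 1ℚ :+ con 2ℚ))) :* (con ¼ :* (a :+ (b :+ b) :+ c))
         :- (con 2ℚ :* (con 1ℚ :+ m) :- (con 0ℚ :+ con 1ℚ)) :* (con ¼ :* (a :+ (a :+ a) :+ b)) :=
       con ½ :* ((con 2ℚ :* m :+ (con 0ℚ :+ (con 1ℚ :+ con 2ℚ))) :* b
         :- (con 2ℚ :* m :- (con 0ℚ :+ con 1ℚ)) :* a) :+
       con ¼ :* ((con 2ℚ :* m :+ (con 2ℚ :* (con 1ℚ :+ con 0ℚ) :+ (con 1ℚ :+ con 2ℚ))) :* c
         :- (con 2ℚ :* m :- (con 2ℚ :* (con 1ℚ :+ con 0ℚ) :+ con 1ℚ)) :* b)) refl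
       (fromNat n) (half n 0) (half n 1) (half n 2))
  half-ratio (suc n) (suc k) = linear₃ ¼ ½ ¼ (half-ratio n k) (half-ratio n (suc k)) (half-ratio n (suc (suc k)))
    (solve 6 (λ m κ a b c d →
       (con 2ℚ :* (con 1ℚ :+ m) :+ (con 2ℚ :* (con 1ℚ :+ κ) :+ (con 1ℚ :+ con 2ℚ))) :* (con ¼ :* (b :+ (c :+ c)
         :+ d))
         :- (con 2ℚ :* (con 1ℚ :+ m) :- (con 2ℚ :* (con 1ℚ :+ κ) :+ con 1ℚ)) :* (con ¼ :* (a :+ (b :+ b) :+ c)) :=
       con ¼ :* ((con 2ℚ :* m :+ (con 2ℚ :* κ :+ (con 1ℚ :+ con 2ℚ))) :* b
         :- (con 2ℚ :* m :- (con 2ℚ :* κ :+ con 1ℚ)) :* a) :+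
       con ½ :* ((con 2ℚ :* m :+ (con 2ℚ :* (con 1ℚ :+ κ) :+ (con 1ℚ :+ con 2ℚ))) :* c
         :- (con 2ℚ :* m :- (con 2ℚ :* (con 1ℚ :+ κ) :+ con 1ℚ)) :* b) :+
       con ¼ :* ((con 2ℚ :* m :+ (con 2ℚ :* (con 1ℚ :+ (con 1ℚ :+ κ)) :+ (con 1ℚ :+ con 2ℚ))) :* d
         :- (con 2ℚ :* m :- (con 2ℚ :* (con 1ℚ :+ (con 1ℚ :+ κ)) :+ con 1ℚ)) :* c)) refl
       (fromNat n) (fromNat k) (half n k) (half n (suc k)) (half n (suc (suc k))) (half n (suc (suc (suc k)))))

  wallis : ℕ → ℚ
  wallis n = binomial n 0

  wallis-suc : ∀ n → 2ℚ * (1ℚ + fromNat n) * wallis (suc n) ≡ (1ℚ + 2ℚ * fromNat n) * wallis n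
  wallis-suc n = linear₁ 1ℚ (binomial-ratio n 0)
    (solve 3 (λ m a b →
       con 2ℚ :* (con 1ℚ :+ m) :* (con ¼ :* (b :+ (a :+ a) :+ b)) :- (con 1ℚ :+ con 2ℚ :* m) :* a :=
       con 1ℚ :* ((m :+ (con 1ℚ :+ con 0ℚ)) :* b :- (m :- con 0ℚ) :* a)) refl
       (fromNat n) (binomial n 0) (binomial n 1))

  half-suc : ∀ n → (1ℚ + 2ℚ * (1ℚ + fromNat n)) * half (suc n) 0 ≡ 2ℚ * (1ℚ + fromNat n) * half n 0
  half-suc n = linear₁ ¼ (half-ratio n 0)
    (solve 3 (λ m a b →
       (con 1ℚ :+ con 2ℚ :* (con 1ℚ :+ m)) :* (con ¼ :* (a :+ (a :+ a) :+ b)) :- con 2ℚ :* (con 1ℚ :+ m) :* a :=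
       con ¼ :* ((con 2ℚ :* m :+ (con 0ℚ :+ (con 1ℚ :+ con 2ℚ))) :* b
         :- (con 2ℚ :* m :- (con 0ℚ :+ con 1ℚ)) :* a)) refl
       (fromNat n) (half n 0) (half n 1))

  0<2ℚ : 0ℚ < 2ℚ
  0<2ℚ = ℚ.+-mono-< 0<1 0<1

  0≤2ℚ : 0ℚ ≤ 2ℚ
  0≤2ℚ = ℚ.<⇒≤ 0<2ℚ

  0≤2ℚ* : ∀ n → 0ℚ ≤ 2ℚ * fromNat n
  0≤2ℚ* n = 0≤* 0≤2ℚ (0≤fromNat n)

  0<odd : ∀ n → 0ℚ < 1ℚ + 2ℚ * fromNat n
  0<odd n = ℚ.+-mono-<-≤ 0<1 (0≤2ℚ* n)

  0<even : ∀ n → 0ℚ < 2ℚ * (1ℚ + fromNat n)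
  0<even n = *-pos 0<2ℚ (0<fromNat n)

  -- From n to n+1, `wallis` gains the factor (2n+1)/(2n+2) and `half _ 0` the factor (2n+2)/(2n+3),
  -- so the product with 2n+1 is constant.
  half*wallis : ∀ n → (1ℚ + 2ℚ * fromNat n) * half n 0 * wallis n ≡ 1ℚ
  half*wallis zero    = refl
  half*wallis (suc n) = *-cancelˡ (0<even n) (trans
    (solve 4 (λ e o a w → e :* (o :* a :* w) := (o :* a) :* (e :* w)) refl
       (2ℚ * (1ℚ + fromNat n)) (1ℚ + 2ℚ * fromNat (suc n)) (half (suc n) 0) (wallis (suc n)))
    (trans (cong₂ _*_ (half-suc n) (wallis-suc n)) (trans
    (solve 4 (λ e o a w → (e :* a) :* (o :* w) := e :* (o :* a :* w)) refl
       (2ℚ * (1ℚ + fromNat n)) (1ℚ + 2ℚ * fromNat n) (half n 0) (wallis n))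
    (cong (2ℚ * (1ℚ + fromNat n) *_) (half*wallis n)))))

  0≤-cancel : ∀ {p q} → 0ℚ < p → 0ℚ ≤ p * q → 0ℚ ≤ q
  0≤-cancel {p} {q} h k = *-cancelˡ-≤ h (subst (_≤ p * q) (sym (ℚ.*-zeroʳ p)) k)

  0≤average : ∀ {a b c} → 0ℚ ≤ a → 0ℚ ≤ b → 0ℚ ≤ c → 0ℚ ≤ average a b c
  0≤average h k l = 0≤* (ℚ.nonNegative⁻¹ ¼) (0≤+ (0≤+ h (0≤+ k k)) l)

  0≤binomial : ∀ n k → 0ℚ ≤ binomial n k
  0≤binomial zero    zero    = 0≤1
  0≤binomial zero    (suc k) = ℚ.≤-refl
  0≤binomial (suc n) zero    = 0≤average (0≤binomial n 1) (0≤binomial n 0) (0≤binomial n 1)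
  0≤binomial (suc n) (suc k) = 0≤average (0≤binomial n k) (0≤binomial n (suc k)) (0≤binomial n (suc (suc k)))

  0≤wallis : ∀ n → 0ℚ ≤ wallis n
  0≤wallis n = 0≤binomial n 0

  wallis-positive : ∀ n → 0ℚ < wallis n
  wallis-positive zero    = 0<1
  wallis-positive (suc n) = ℚ.*-cancelˡ-<-nonNeg (2ℚ * (1ℚ + fromNat n)) {{ℚ.nonNegative (ℚ.<⇒≤ (0<even n))}}
    (subst₂ _<_ (sym (ℚ.*-zeroʳ (2ℚ * (1ℚ + fromNat n)))) (sym (wallis-suc n))
      (*-pos (0<odd n) (wallis-positive n)))

  -- By `wallis-suc` the left side is multiplied by (2n+1)(2n+3)/(2n+2)² at each step, which is
  -- below 1 because (2n+2)² - (2n+1)(2n+3) = 1.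
  wallis-bound : ∀ n → (1ℚ + 2ℚ * fromNat n) * (wallis n * wallis n) ≤ 1ℚ
  wallis-bound zero    = ℚ.≤-refl
  wallis-bound (suc n) = *-cancelˡ-≤ (*-pos (0<even n) (0<even n)) (begin
    E * E * (O′ * (w′ * w′))
      ≡⟨ solve 3 (λ e o w → e :* e :* (o :* (w :* w)) := o :* ((e :* w) :* (e :* w))) refl E O′ w′ ⟩
    O′ * ((E * w′) * (E * w′))
      ≡⟨ cong (λ z → O′ * (z * z)) (wallis-suc n) ⟩
    O′ * ((O * w) * (O * w))
      ≡⟨ solve 3 (λ o′ o w → o′ :* ((o :* w) :* (o :* w)) := (o′ :* o) :* (o :* (w :* w))) refl O′ O w ⟩
    (O′ * O) * (O * (w * w))
      ≤⟨ *-monoˡ (ℚ.<⇒≤ (*-pos (0<odd (suc n)) (0<odd n))) (wallis-bound n) ⟩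
    (O′ * O) * 1ℚ
      ≤⟨ ≤-by 1ℚ 0≤1 (solve 1 (λ m →
           (con 2ℚ :* (con 1ℚ :+ m)) :* (con 2ℚ :* (con 1ℚ :+ m)) :* con 1ℚ
             :- (con 1ℚ :+ con 2ℚ :* (con 1ℚ :+ m)) :* (con 1ℚ :+ con 2ℚ :* m) :* con 1ℚ
           := con 1ℚ) refl (fromNat n)) ⟩
    E * E * 1ℚ ∎)
    where
    open ℚ.≤-Reasoning
    E = 2ℚ * (1ℚ + fromNat n)
    O = 1ℚ + 2ℚ * fromNat n
    O′ = 1ℚ + 2ℚ * fromNat (suc n)
    w = wallis n
    w′ = wallis (suc n)

  0≤half-zero : ∀ n → 0ℚ ≤ half n 0
  0≤half-zero zero    = ℚ.<⇒≤ (ℚ.positive⁻¹ (half 0 0))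
  0≤half-zero (suc n) = 0≤-cancel (0<odd (suc n)) (subst (0ℚ ≤_) (sym (half-suc n))
    (0≤* (ℚ.<⇒≤ (0<even n)) (0≤half-zero n)))

  -- The ratios for n = k + 1 + j, in which no coefficient is negative.

  half-step : ∀ j k → (2ℚ * fromNat j + (2ℚ * (2ℚ * fromNat k) + (2ℚ * 2ℚ + 1ℚ))) * half (suc k ℕ.+ j) (suc k) ≡
                      (2ℚ * fromNat j + 1ℚ) * half (suc k ℕ.+ j) k
  half-step j k = linear₁ 1ℚ (subst (λ m →
      (2ℚ * m + (2ℚ * fromNat k + (1ℚ + 2ℚ))) * half (suc k ℕ.+ j) (suc k) ≡
      (2ℚ * m - (2ℚ * fromNat k + 1ℚ)) * half (suc k ℕ.+ j) k) (fromNat-+ (suc k) j) (half-ratio (suc k ℕ.+ j) k))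
    (solve 4 (λ ι κ a b →
       (con 2ℚ :* ι :+ (con 2ℚ :* (con 2ℚ :* κ) :+ (con 2ℚ :* con 2ℚ :+ con 1ℚ))) :* b :- (con 2ℚ :* ι
         :+ con 1ℚ) :* a :=
       con 1ℚ :* ((con 2ℚ :* ((con 1ℚ :+ κ) :+ ι) :+ (con 2ℚ :* κ :+ (con 1ℚ :+ con 2ℚ))) :* b
         :- (con 2ℚ :* ((con 1ℚ :+ κ) :+ ι) :- (con 2ℚ :* κ :+ con 1ℚ)) :* a)) refl
       (fromNat j) (fromNat k) (half (suc k ℕ.+ j) k) (half (suc k ℕ.+ j) (suc k)))

  binomial-step : ∀ j k → (2ℚ * fromNat j + (2ℚ * (2ℚ * fromNat k) + 2ℚ * 2ℚ)) * binomial (suc k ℕ.+ j) (suc k) ≡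
                      (2ℚ * fromNat j + 2ℚ) * binomial (suc k ℕ.+ j) k
  binomial-step j k = linear₁ 2ℚ (subst (λ m →
      (m + (1ℚ + fromNat k)) * binomial (suc k ℕ.+ j) (suc k) ≡
      (m - fromNat k) * binomial (suc k ℕ.+ j) k) (fromNat-+ (suc k) j) (binomial-ratio (suc k ℕ.+ j) k))
    (solve 4 (λ ι κ a b →
       (con 2ℚ :* ι :+ (con 2ℚ :* (con 2ℚ :* κ) :+ con 2ℚ :* con 2ℚ)) :* b :- (con 2ℚ :* ι :+ con 2ℚ) :* a :=
       con 2ℚ :* ((((con 1ℚ :+ κ) :+ ι) :+ (con 1ℚ :+ κ)) :* b :- (((con 1ℚ :+ κ) :+ ι) :- κ) :* a)) refl
       (fromNat j) (fromNat k) (binomial (suc k ℕ.+ j) k) (binomial (suc k ℕ.+ j) (suc k)))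

  0<odd′ : ∀ j k → 0ℚ < 2ℚ * fromNat j + (2ℚ * (2ℚ * fromNat k) + (2ℚ * 2ℚ + 1ℚ))
  0<odd′ j k = ℚ.+-mono-≤-< (0≤2ℚ* j) (ℚ.+-mono-≤-< (0≤* 0≤2ℚ (0≤2ℚ* k)) (ℚ.positive⁻¹ (2ℚ * 2ℚ + 1ℚ)))

  0≤2ℚ*+1 : ∀ j → 0ℚ ≤ 2ℚ * fromNat j + 1ℚ
  0≤2ℚ*+1 j = 0≤+ (0≤2ℚ* j) 0≤1

  0≤half : ∀ k j → 0ℚ ≤ half (k ℕ.+ j) k
  0≤half zero    j = 0≤half-zero j
  0≤half (suc k) j = 0≤-cancel (0<odd′ j k) (subst (0ℚ ≤_) (sym (half-step j k))
    (0≤* (0≤2ℚ*+1 j) (subst (λ n → 0ℚ ≤ half n k) (ℕ.+-suc k j) (0≤half k (suc j)))))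

  -- With n = k + 1 + j, passing from k to k+1 multiplies `half` by (2j+1)/(2j+4k+5) and `binomial`
  -- by the larger (2j+2)/(2j+4k+4). Both sides agree at k = 0.
  half≤binomial : ∀ k j → half (k ℕ.+ j) k * wallis (k ℕ.+ j) ≤ binomial (k ℕ.+ j) k * half (k ℕ.+ j) 0
  half≤binomial zero    j = ℚ.≤-reflexive (ℚ.*-comm (half j 0) (wallis j))
  half≤binomial (suc k) j = *-cancelˡ-≤ (0<odd′ j k) (begin
    p * (h′ * w)
      ≡⟨ sym (ℚ.*-assoc p h′ w) ⟩
    (p * h′) * w
      ≡⟨ cong (_* w) (half-step j k) ⟩
    ((2ℚ * fromNat j + 1ℚ) * h) * w ≡⟨ ℚ.*-assoc (2ℚ * fromNat j + 1ℚ) h w ⟩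
    (2ℚ * fromNat j + 1ℚ) * (h * w)
      ≤⟨ *-monoˡ (0≤2ℚ*+1 j) (subst (λ n → half n k * wallis n ≤ binomial n k * half n 0)
         (ℕ.+-suc k j) (half≤binomial k (suc j))) ⟩
    (2ℚ * fromNat j + 1ℚ) * (b * a) ≤⟨ ≤-by (b * a) 0≤ba (solve 2 (λ ι x →
                                       (con 2ℚ :* ι :+ con 2ℚ) :* x :- (con 2ℚ :* ι :+ con 1ℚ) :* x
                                         := x) refl (fromNat j) (b * a)) ⟩
    (2ℚ * fromNat j + 2ℚ) * (b * a) ≡⟨ sym (ℚ.*-assoc (2ℚ * fromNat j + 2ℚ) b a) ⟩
    (2ℚ * fromNat j + 2ℚ) * b * a
      ≡⟨ cong (_* a) (sym (binomial-step j k)) ⟩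
    (2ℚ * fromNat j + (2ℚ * (2ℚ * fromNat k) + 2ℚ * 2ℚ)) * b′ * a
                                  ≤⟨ ≤-by (b′ * a) (0≤* (0≤binomial n (suc k)) (0≤half-zero n))
                                    (solve 4 (λ ι κ b a →
                                       (con 2ℚ :* ι :+ (con 2ℚ :* (con 2ℚ :* κ) :+ (con 2ℚ :* con 2ℚ
                                         :+ con 1ℚ))) :* (b :* a)
                                       :- (con 2ℚ :* ι :+ (con 2ℚ :* (con 2ℚ :* κ) :+ con 2ℚ :* con 2ℚ)) :* b :* a
                                       := b :* a) refl (fromNat j) (fromNat k) b′ a) ⟩
    p * (b′ * a) ∎)
    where
    open ℚ.≤-Reasoning
    n = suc k ℕ.+ j
    p = 2ℚ * fromNat j + (2ℚ * (2ℚ * fromNat k) + (2ℚ * 2ℚ + 1ℚ))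
    h = half n k
    h′ = half n (suc k)
    b = binomial n k
    b′ = binomial n (suc k)
    w = wallis n
    a = half n 0
    0≤ba : 0ℚ ≤ b * a
    0≤ba = 0≤* (0≤binomial n k) (0≤half-zero n)

  -- The other half of the interlacing: one place further on, the binomial factor is 2j/(2j+4k+6),
  -- which is below (2j+1)/(2j+4k+5).
  binomial≤half : ∀ k j → binomial (k ℕ.+ j) (suc k) * half (k ℕ.+ j) 0 ≤ half (k ℕ.+ j) k * wallis (k ℕ.+ j)
  binomial≤half zero j = ℚ.≤-trans (*-monoʳ (0≤half-zero j) b₁≤w) (ℚ.≤-reflexive (ℚ.*-comm (wallis j) (half j 0)))
    where
    b₁≤w : binomial j 1 ≤ wallis j
    b₁≤w = *-cancelˡ-≤ {fromNat j + (1ℚ + 0ℚ)} (ℚ.+-mono-≤-< (0≤fromNat j) 0<1) (ℚ.≤-trans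
      (ℚ.≤-reflexive (binomial-ratio j 0))
      (≤-by (wallis j) (0≤wallis j) (solve 2 (λ m w → (m :+ (con 1ℚ :+ con 0ℚ)) :* w :- (m :- con 0ℚ) :* w
        := w) refl
        (fromNat j) (wallis j))))
  binomial≤half (suc k) j = *-cancelˡ-≤ (0<odd′ j k) (begin
    p * (b″ * a)
      ≤⟨ ≤-by (b″ * a) (0≤* (0≤binomial n (suc (suc k))) (0≤half-zero n)) (solve 4 (λ ι κ b a →
           con 2ℚ :* (((con 1ℚ :+ κ) :+ ι) :+ (con 1ℚ :+ (con 1ℚ :+ κ))) :* b :* a
           :- (con 2ℚ :* ι :+ (con 2ℚ :* (con 2ℚ :* κ) :+ (con 2ℚ :* con 2ℚ :+ con 1ℚ))) :* (b :* a)
           := b :* a) refl (fromNat j) (fromNat k) b″ a) ⟩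
    2ℚ * (fromNat (suc k) + fromNat j + (1ℚ + fromNat (suc k))) * b″ * a
                                  ≡⟨ cong (λ m → 2ℚ * (m + (1ℚ + fromNat (suc k))) * b″ * a)
                                    (sym (fromNat-+ (suc k) j)) ⟩
    2ℚ * (fromNat n + (1ℚ + fromNat (suc k))) * b″ * a
                                  ≡⟨ cong (_* a) (ℚ.*-assoc 2ℚ (fromNat n + (1ℚ + fromNat (suc k))) b″) ⟩
    2ℚ * ((fromNat n + (1ℚ + fromNat (suc k))) * b″) * a
                                  ≡⟨ cong (λ z → 2ℚ * z * a) (binomial-ratio n (suc k)) ⟩
    2ℚ * ((fromNat n - fromNat (suc k)) * b′) * a
                                  ≡⟨ cong (λ m → 2ℚ * ((m - fromNat (suc k)) * b′) * a) (fromNat-+ (suc k) j) ⟩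
    2ℚ * ((fromNat (suc k) + fromNat j - fromNat (suc k)) * b′) * a
                                  ≡⟨ solve 4 (λ ι κ b a → con 2ℚ :* ((κ :+ ι :- κ) :* b) :* a
                                    := con 2ℚ :* ι :* (b :* a)) refl
                                       (fromNat j) (fromNat (suc k)) b′ a ⟩
    2ℚ * fromNat j * (b′ * a)
      ≤⟨ *-monoˡ (0≤2ℚ* j) (subst (λ n → binomial n (suc k) * half n 0 ≤ half n k * wallis n)
           (ℕ.+-suc k j) (binomial≤half k (suc j))) ⟩
    2ℚ * fromNat j * (h * w)
      ≤⟨ ≤-by (h * w) (0≤* 0≤h (0≤wallis n)) (solve 3 (λ ι h w →
           (con 2ℚ :* ι :+ con 1ℚ) :* h :* w :- con 2ℚ :* ι :* (h :* w) := h :* w) refl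
           (fromNat j) h w) ⟩
    (2ℚ * fromNat j + 1ℚ) * h * w ≡⟨ cong (_* w) (sym (half-step j k)) ⟩
    p * h′ * w
      ≡⟨ ℚ.*-assoc p h′ w ⟩
    p * (h′ * w) ∎)
    where
    open ℚ.≤-Reasoning
    n = suc k ℕ.+ j
    p = 2ℚ * fromNat j + (2ℚ * (2ℚ * fromNat k) + (2ℚ * 2ℚ + 1ℚ))
    h = half n k
    h′ = half n (suc k)
    b′ = binomial n (suc k)
    b″ = binomial n (suc (suc k))
    w = wallis n
    a = half n 0
    0≤h : 0ℚ ≤ h
    0≤h = subst (λ n → 0ℚ ≤ half n k) (ℕ.+-suc k j) (0≤half k (suc j))

  -- Row sums and their comparison

  binomial-vanishes : ∀ n k → n ℕ.< k → binomial n k ≡ 0ℚ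
  binomial-vanishes zero    (suc k) _       = refl
  binomial-vanishes (suc n) (suc k) (ℕ.s≤s h) = trans
    (cong₂ (λ a b → ¼ * (a + b)) (cong₂ (λ a b → a + (b + b)) (binomial-vanishes n k h)
      (binomial-vanishes n (suc k) (ℕ.m≤n⇒m≤1+n h)))
      (binomial-vanishes n (suc (suc k)) (ℕ.m≤n⇒m≤1+n (ℕ.m≤n⇒m≤1+n h)))) refl

  -- Twice the sum minus the central term is the sum over all integers from -m to m. A step of the
  -- walk changes it only by the flux through the two ends.
  binomial-sum-suc : ∀ n m → 2ℚ * Σ< (suc m) (binomial (suc n)) - wallis (suc n) ≡
    2ℚ * Σ< (suc m) (binomial n) - wallis n + ½ * (binomial n (suc m) - binomial n m)
  binomial-sum-suc n zero = solve 2 (λ a b →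
    con 2ℚ :* (con ¼ :* (b :+ (a :+ a) :+ b) :+ con 0ℚ) :- con ¼ :* (b :+ (a :+ a) :+ b) :=
    con 2ℚ :* (a :+ con 0ℚ) :- a :+ con ½ :* (b :- a)) refl (binomial n 0) (binomial n 1)
  binomial-sum-suc n (suc m) = begin
    2ℚ * Σ< (suc (suc m)) (binomial (suc n)) - wallis (suc n)
      ≡⟨ cong (λ s → 2ℚ * s - wallis (suc n)) (Σ<-last (suc m) (binomial (suc n))) ⟩
    2ℚ * (Σ< (suc m) (binomial (suc n)) + average a b c) - wallis (suc n)
      ≡⟨ solve 3 (λ s x w → con 2ℚ :* (s :+ x) :- w := (con 2ℚ :* s :- w) :+ con 2ℚ :* x) refl
           (Σ< (suc m) (binomial (suc n))) (average a b c) (wallis (suc n)) ⟩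
    (2ℚ * Σ< (suc m) (binomial (suc n)) - wallis (suc n)) + 2ℚ * average a b c
      ≡⟨ cong (_+ 2ℚ * average a b c) (binomial-sum-suc n m) ⟩
    2ℚ * Σ< (suc m) (binomial n) - wallis n + ½ * (b - a) + 2ℚ * average a b c
      ≡⟨ solve 5 (λ s w a b c → con 2ℚ :* s :- w :+ con ½ :* (b :- a) :+ con 2ℚ :* (con ¼ :* (a :+ (b :+ b) :+ c))
           := con 2ℚ :* (s :+ b) :- w :+ con ½ :* (c :- b)) refl (Σ< (suc m) (binomial n)) (wallis n) a b c ⟩
    2ℚ * (Σ< (suc m) (binomial n) + b) - wallis n + ½ * (c - b)
      ≡⟨ cong (λ s → 2ℚ * s - wallis n + ½ * (c - b)) (sym (Σ<-last (suc m) (binomial n))) ⟩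
    2ℚ * Σ< (suc (suc m)) (binomial n) - wallis n + ½ * (c - b) ∎
    where
    open ≡-Reasoning
    a = binomial n m
    b = binomial n (suc m)
    c = binomial n (suc (suc m))

  binomial-sum : ∀ n m → n ℕ.≤ m → 2ℚ * Σ< (suc m) (binomial n) - wallis n ≡ 1ℚ
  binomial-sum zero    m _ = trans (cong (λ s → 2ℚ * (1ℚ + s) - 1ℚ) (zeros m)) refl
    where
    zeros : ∀ m → Σ< m (λ i → binomial 0 (suc i)) ≡ 0ℚ
    zeros zero    = refl
    zeros (suc m) = trans (ℚ.+-identityˡ _) (zeros m)
  binomial-sum (suc n) m h = trans (binomial-sum-suc n m) (trans
    (cong₂ (λ a b → 2ℚ * Σ< (suc m) (binomial n) - wallis n + ½ * (a - b))
      (binomial-vanishes n (suc m) (ℕ.m≤n⇒m≤1+n h)) (binomial-vanishes n m h))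
    (trans (ℚ.+-identityʳ _) (binomial-sum n m (ℕ.<⇒≤ h))))

  -- The estimate for alternating sums with decreasing terms: if the sum from the second term on is
  -- d times that term, which is -c times the first, the whole is (1 - d c) times the first.
  alternating : ∀ m (x : ℕ → ℚ) → (∀ i → ∃[ c ] (0ℚ ≤ c × c ≤ 1ℚ × x (suc i) ≡ - c * x i)) →
                ∃[ d ] (0ℚ ≤ d × d ≤ 1ℚ × Σ< m x ≡ d * x 0)
  alternating zero    x h = 0ℚ , ℚ.≤-refl , ℚ.<⇒≤ 0<1 , sym (ℚ.*-zeroˡ (x 0))
  alternating (suc m) x h =
    let d , 0≤d , d≤1 , e = alternating m (λ i → x (suc i)) (λ i → h (suc i))
        c , 0≤c , c≤1 , e′ = h 0
    in 1ℚ - d * c , ≤⇒0≤- (*-mono 0≤d 0≤c d≤1 c≤1) ,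
       ≤-by (d * c) (0≤* 0≤d 0≤c) (solve 1 (λ x → con 1ℚ :- (con 1ℚ :- x) := x) refl (d * c)) ,
       trans (cong (_+_ (x 0)) (trans e (cong (d *_) e′)))
         (solve 3 (λ d c x → x :+ d :* (:- c :* x) := (con 1ℚ :- d :* c) :* x) refl d c (x 0))

  -- At k = n + i the numerator 2n - (2k+1) is -(2i+1), so beyond the diagonal the row alternates
  -- with decreasing absolute values, like the Leibniz series itself.
  half-tail-ratio : ∀ n i → ∃[ c ] (0ℚ ≤ c × c ≤ 1ℚ × half n (suc (n ℕ.+ i)) ≡ - c * half n (n ℕ.+ i))
  half-tail-ratio n i = o * recip p , 0≤* 0≤o (ℚ.<⇒≤ (recip-pos 0<p)) ,
    subst (o * recip p ≤_) (recip-inverse 0<p) (*-monoʳ (ℚ.<⇒≤ (recip-pos 0<p)) o≤p) ,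
    *-cancelˡ 0<p (trans step (sym (trans
      (solve 4 (λ p o r h → p :* (:- (o :* r) :* h)
        := (p :* r) :* (:- o :* h)) refl p o (recip p) (half n (n ℕ.+ i)))
      (trans (cong (_* (- o * half n (n ℕ.+ i))) (recip-inverse 0<p)) (ℚ.*-identityˡ _)))))
    where
    o = 2ℚ * fromNat i + 1ℚ
    p = 2ℚ * fromNat n + (2ℚ * fromNat n + (o + 2ℚ))
    0≤o = 0≤2ℚ*+1 i
    0<p : 0ℚ < p
    0<p = ℚ.+-mono-≤-< (0≤2ℚ* n) (ℚ.+-mono-≤-< (0≤2ℚ* n) (ℚ.+-mono-≤-< 0≤o 0<2ℚ))
    o≤p : o ≤ p
    o≤p = ≤-by (2ℚ * fromNat n + (2ℚ * fromNat n + 2ℚ)) (0≤+ (0≤2ℚ* n) (0≤+ (0≤2ℚ* n) 0≤2ℚ))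
      (solve 2 (λ n o → n :+ (n :+ (o :+ con 2ℚ)) :- o := n :+ (n :+ con 2ℚ)) refl (2ℚ * fromNat n) o)
    step : p * half n (suc (n ℕ.+ i)) ≡ - o * half n (n ℕ.+ i)
    step = linear₁ 1ℚ (subst (λ k → (2ℚ * fromNat n + (2ℚ * k + (1ℚ + 2ℚ))) * half n (suc (n ℕ.+ i)) ≡
        (2ℚ * fromNat n - (2ℚ * k + 1ℚ)) * half n (n ℕ.+ i)) (fromNat-+ n i) (half-ratio n (n ℕ.+ i)))
      (solve 4 (λ ν ι a b →
        (con 2ℚ :* ν :+ (con 2ℚ :* ν :+ ((con 2ℚ :* ι :+ con 1ℚ) :+ con 2ℚ))) :* b :- :- (con 2ℚ :* ι
          :+ con 1ℚ) :* a :=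
        con 1ℚ :* ((con 2ℚ :* ν :+ (con 2ℚ :* (ν :+ ι) :+ (con 1ℚ :+ con 2ℚ))) :* b
          :- (con 2ℚ :* ν :- (con 2ℚ :* (ν :+ ι) :+ con 1ℚ)) :* a)) refl
        (fromNat n) (fromNat i) (half n (n ℕ.+ i)) (half n (suc (n ℕ.+ i))))

  half-sum-bounds : ∀ n i → Σ< n (half n) ≤ Σ< (n ℕ.+ i) (half n) × Σ< (n ℕ.+ i) (half n) ≤ Σ< (suc n) (half n)
  half-sum-bounds n i = subst (λ s → Σ< n (half n) ≤ s × s ≤ Σ< (suc n) (half n)) (sym sum)
    ( p≤p+q (0≤* 0≤d 0≤h)
    , subst (Σ< n (half n) + d * half n n ≤_) (sym (Σ<-last n (half n)))
        (ℚ.+-monoʳ-≤ (Σ< n (half n)) (subst (d * half n n ≤_) (ℚ.*-identityˡ (half n n)) (*-monoʳ 0≤h d≤1))))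
    where
    alt = alternating i (λ j → half n (n ℕ.+ j)) (λ j → subst
      (λ k → ∃[ c ] (0ℚ ≤ c × c ≤ 1ℚ × half n k ≡ - c * half n (n ℕ.+ j)))
      (sym (ℕ.+-suc n j)) (half-tail-ratio n j))
    d = proj₁ alt
    0≤d = proj₁ (proj₂ alt)
    d≤1 = proj₁ (proj₂ (proj₂ alt))
    0≤h : 0ℚ ≤ half n n
    0≤h = subst (λ m → 0ℚ ≤ half m n) (ℕ.+-identityʳ n) (0≤half n 0)
    sum : Σ< (n ℕ.+ i) (half n) ≡ Σ< n (half n) + d * half n n
    sum = trans (Σ<-++ n i (half n)) (cong (Σ< n (half n) +_)
      (trans (proj₂ (proj₂ (proj₂ alt))) (cong (λ k → d * half n k) (ℕ.+-identityʳ n))))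

  -- Termwise by `half≤binomial`; the binomials with 0 ≤ k ≤ n have sum (1 + w)/2. In
  -- `half-sum-lower` the term k = 0 is left out and the sum is (1 - w)/2.
  half-sum-upper : ∀ n → 2ℚ * (wallis n * Σ< (suc n) (half n)) ≤ half n 0 * (1ℚ + wallis n)
  half-sum-upper n = begin
    2ℚ * (w * Σ< (suc n) (half n))
      ≡⟨ cong (2ℚ *_) (sym (Σ<-*ˡ (suc n) w (half n))) ⟩
    2ℚ * Σ< (suc n) (λ k → w * half n k)
      ≤⟨ *-monoˡ 0≤2ℚ (Σ<-mono (suc n) bound) ⟩
    2ℚ * Σ< (suc n) (λ k → a * binomial n k)
      ≡⟨ cong (2ℚ *_) (Σ<-*ˡ (suc n) a (binomial n)) ⟩
    2ℚ * (a * Σ< (suc n) (binomial n))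
      ≡⟨ linear₁ a (binomial-sum n n ℕ.≤-refl) (solve 3 (λ a s w →
           con 2ℚ :* (a :* s) :- a :* (con 1ℚ :+ w) :=
           a :* (con 2ℚ :* s :- w :- con 1ℚ)) refl a (Σ< (suc n) (binomial n)) w) ⟩
    a * (1ℚ + w) ∎
    where
    open ℚ.≤-Reasoning
    w = wallis n
    a = half n 0
    bound : ∀ k → k ℕ.< suc n → w * half n k ≤ a * binomial n k
    bound k (ℕ.s≤s k≤n) = subst (λ m → wallis m * half m k ≤ half m 0 * binomial m k) (ℕ.m+[n∸m]≡n k≤n)
      (subst₂ _≤_ (ℚ.*-comm (half m k) (wallis m))
        (ℚ.*-comm (binomial m k) (half m 0)) (half≤binomial k (n ℕ.∸ k)))
      where m = k ℕ.+ (n ℕ.∸ k)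

  half-sum-lower : ∀ n → half n 0 * (1ℚ - wallis n) ≤ 2ℚ * (wallis n * Σ< n (half n))
  half-sum-lower n = begin
    a * (1ℚ - w)
      ≡⟨ linear₁ (- a) (binomial-sum n n ℕ.≤-refl) (solve 3 (λ a s w →
          a :* (con 1ℚ :- w) :- con 2ℚ :* (a :* s) :=
          :- a :* (con 2ℚ :* (w :+ s) :- w :- con 1ℚ)) refl a s w) ⟩
    2ℚ * (a * s)
      ≡⟨ cong (2ℚ *_) (sym (Σ<-*ˡ n a (λ k → binomial n (suc k)))) ⟩
    2ℚ * Σ< n (λ k → a * binomial n (suc k))
      ≤⟨ *-monoˡ 0≤2ℚ (Σ<-mono n bound) ⟩
    2ℚ * Σ< n (λ k → w * half n k)
      ≡⟨ cong (2ℚ *_) (Σ<-*ˡ n w (half n)) ⟩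
    2ℚ * (w * Σ< n (half n)) ∎
    where
    open ℚ.≤-Reasoning
    w = wallis n
    a = half n 0
    s = Σ< n (λ k → binomial n (suc k))
    bound : ∀ k → k ℕ.< n → a * binomial n (suc k) ≤ w * half n k
    bound k k<n = subst (λ m → half m 0 * binomial m (suc k) ≤ wallis m * half m k) (ℕ.m+[n∸m]≡n (ℕ.<⇒≤ k<n))
      (subst₂ _≤_ (ℚ.*-comm (binomial m (suc k)) (half m 0))
        (ℚ.*-comm (half m k) (wallis m)) (binomial≤half k (n ℕ.∸ k)))
      where m = k ℕ.+ (n ℕ.∸ k)

  half-sum-close : ∀ n i → let O = 1ℚ + 2ℚ * fromNat n ; w = wallis n in
    ∣ 2ℚ * O * (w * w) * Σ< (n ℕ.+ i) (half n) - 1ℚ ∣ ≤ w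
  half-sum-close n i = ∣∣≤
    -- Both bounds are multiplied by O w, after which `half*wallis` replaces O a w by 1.
    (≤-by (O * w * (a * (1ℚ + w) - 2ℚ * (w * S))) (0≤* 0≤Ow (≤⇒0≤- upper))
      (linear₁ (- (1ℚ + w)) (half*wallis n) (solve 4 (λ o w a s →
        w :- (con 2ℚ :* o :* (w :* w) :* s :- con 1ℚ) :- o :* w :* (a :* (con 1ℚ :+ w) :- con 2ℚ :* (w :* s)) :=
        :- (con 1ℚ :+ w) :* (o :* a :* w :- con 1ℚ)) refl O w a S)))
    (≤-by (O * w * (2ℚ * (w * S) - a * (1ℚ - w))) (0≤* 0≤Ow (≤⇒0≤- lower))
      (linear₁ (1ℚ - w) (half*wallis n) (solve 4 (λ o w a s →
        w :- :- (con 2ℚ :* o :* (w :* w) :* s :- con 1ℚ) :- o :* w :* (con 2ℚ :* (w :* s) :- a :* (con 1ℚ :- w)) :=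
        (con 1ℚ :- w) :* (o :* a :* w :- con 1ℚ)) refl O w a S)))
    where
    O = 1ℚ + 2ℚ * fromNat n
    w = wallis n
    a = half n 0
    S = Σ< (n ℕ.+ i) (half n)
    0≤Ow = 0≤* (ℚ.<⇒≤ (0<odd n)) (0≤wallis n)
    scaled : ∀ {s t} → s ≤ t → 2ℚ * (w * s) ≤ 2ℚ * (w * t)
    scaled h = *-monoˡ 0≤2ℚ (*-monoˡ (0≤wallis n) h)
    upper = ℚ.≤-trans (scaled (proj₂ (half-sum-bounds n i))) (half-sum-upper n)
    lower = ℚ.≤-trans (half-sum-lower n) (scaled (proj₁ (half-sum-bounds n i)))

  half-zero-sum : ∀ m k → Σ< m (λ i → sign i * 1/1+ (2 ℕ.* (i ℕ.+ k))) ≡ leibniz k m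
  half-zero-sum zero    k = refl
  half-zero-sum (suc m) k = cong₂ _+_ (ℚ.*-identityˡ (1/1+ (2 ℕ.* k))) (begin
    Σ< m (λ i → - sign i * 1/1+ (2 ℕ.* suc (i ℕ.+ k)))
      ≡⟨ Σ<-cong m (λ i _ → trans (solve 2 (λ s u → :- s :* u
        := :- con 1ℚ :* (s :* u)) refl (sign i) (1/1+ (2 ℕ.* suc (i ℕ.+ k))))
           (cong (λ j → - 1ℚ * (sign i * 1/1+ (2 ℕ.* j))) (sym (ℕ.+-suc i k)))) ⟩
    Σ< m (λ i → - 1ℚ * (sign i * 1/1+ (2 ℕ.* (i ℕ.+ suc k))))
      ≡⟨ Σ<-*ˡ m (- 1ℚ) (λ i → sign i * 1/1+ (2 ℕ.* (i ℕ.+ suc k))) ⟩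
    - 1ℚ * Σ< m (λ i → sign i * 1/1+ (2 ℕ.* (i ℕ.+ suc k)))
      ≡⟨ cong (- 1ℚ *_) (half-zero-sum m (suc k)) ⟩
    - 1ℚ * leibniz (suc k) m
      ≡⟨ solve 1 (λ l → :- con 1ℚ :* l := :- l) refl (leibniz (suc k) m) ⟩
    - leibniz (suc k) m ∎)
    where open ≡-Reasoning

  half-sum-leibniz : ∀ m → Σ< m (half 0) ≡ leibniz 0 m
  half-sum-leibniz m = trans (Σ<-cong m (λ i _ → cong (λ j → sign i * 1/1+ (2 ℕ.* j)) (sym (ℕ.+-identityʳ i))))
    (half-zero-sum m 0)

  half-sum-suc : ∀ n m → Σ< (suc m) (half (suc n)) ≡ Σ< (suc m) (half n) + ¼ * (half n (suc m) - half n m)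
  half-sum-suc n zero = solve 2 (λ a b → con ¼ :* (a :+ (a :+ a) :+ b) :+ con 0ℚ
    := (a :+ con 0ℚ) :+ con ¼ :* (b :- a)) refl
    (half n 0) (half n 1)
  half-sum-suc n (suc m) = begin
    Σ< (suc (suc m)) (half (suc n))
      ≡⟨ Σ<-last (suc m) (half (suc n)) ⟩
    Σ< (suc m) (half (suc n)) + average a b c
      ≡⟨ cong (_+ average a b c) (half-sum-suc n m) ⟩
    Σ< (suc m) (half n) + ¼ * (b - a) + average a b c
      ≡⟨ solve 4 (λ s a b c → s :+ con ¼ :* (b :- a) :+ con ¼ :* (a :+ (b :+ b) :+ c)
        := (s :+ b) :+ con ¼ :* (c :- b)) refl
           (Σ< (suc m) (half n)) a b c ⟩
    (Σ< (suc m) (half n) + b) + ¼ * (c - b)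
      ≡⟨ cong (_+ ¼ * (c - b)) (sym (Σ<-last (suc m) (half n))) ⟩
    Σ< (suc (suc m)) (half n) + ¼ * (c - b) ∎
    where
    open ≡-Reasoning
    a = half n m
    b = half n (suc m)
    c = half n (suc (suc m))

  ∣sign∣ : ∀ k → ∣ sign k ∣ ≡ 1ℚ
  ∣sign∣ zero    = refl
  ∣sign∣ (suc k) = trans (ℚ.∣-p∣≡∣p∣ (sign k)) (∣sign∣ k)

  -- The walk moves by at most one place per step, so an entry of row n at k is an average of
  -- Leibniz terms at places k - n ≥ j and beyond.
  half-decay : ∀ n k j → n ℕ.+ j ℕ.≤ k → ∣ half n k ∣ ≤ 1/1+ j
  half-decay zero k j h = ℚ.≤-trans (ℚ.≤-reflexive (trans (ℚ.∣p*q∣≡∣p∣*∣q∣ (sign k) (1/1+ (2 ℕ.* k)))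
    (trans (cong₂ _*_ (∣sign∣ k) (ℚ.0≤p⇒∣p∣≡p (0≤1/1+ (2 ℕ.* k)))) (ℚ.*-identityˡ (1/1+ (2 ℕ.* k))))))
    (1/1+-antimono (ℕ.≤-trans h (ℕ.m≤n*m k 2)))
  half-decay (suc n) (suc k) j (ℕ.s≤s h) = begin
    ∣ average a b c ∣
      ≡⟨ ∣*∣ˡ (a + (b + b) + c) (ℚ.nonNegative⁻¹ ¼) ⟩
    ¼ * ∣ a + (b + b) + c ∣
      ≤⟨ *-monoˡ (ℚ.nonNegative⁻¹ ¼) (∣+∣≤ (∣+∣≤ ha (∣+∣≤ hb hb)) hc) ⟩
    ¼ * (u + (u + u) + u)
      ≡⟨ solve 1 (λ u → con ¼ :* (u :+ (u :+ u) :+ u) := u) refl u ⟩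
    u ∎
    where
    open ℚ.≤-Reasoning
    u = 1/1+ j
    a = half n k
    b = half n (suc k)
    c = half n (suc (suc k))
    ha = half-decay n k j h
    hb = half-decay n (suc k) j (ℕ.m≤n⇒m≤1+n h)
    hc = half-decay n (suc (suc k)) j (ℕ.m≤n⇒m≤1+n (ℕ.m≤n⇒m≤1+n h))

  -- The full sum of a row is invariant. A partial sum changes in each of the n steps by the flux at
  -- its end, which `half-decay` makes small.
  half-drift : ∀ n m j → n ℕ.+ j ℕ.≤ m → ∣ Σ< (suc m) (half n) - Σ< (suc m) (half 0) ∣ ≤ fromNat n * 1/1+ j
  half-drift zero m j h = ℚ.≤-reflexive
    (trans (cong ∣_∣ (ℚ.+-inverseʳ (Σ< (suc m) (half 0)))) (sym (ℚ.*-zeroˡ (1/1+ j))))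
  half-drift (suc n) m j h = begin
    ∣ Σ< (suc m) (half (suc n)) - S₀ ∣
      ≡⟨ cong (λ s → ∣ s - S₀ ∣) (half-sum-suc n m) ⟩
    ∣ S + ¼ * (b - a) - S₀ ∣
      ≡⟨ cong ∣_∣ (solve 3 (λ s d s₀ → s :+ d :- s₀ := d :+ (s :- s₀)) refl S (¼ * (b - a)) S₀) ⟩
    ∣ ¼ * (b - a) + (S - S₀) ∣
      ≤⟨ ∣+∣≤ small (half-drift n m j n+j≤m) ⟩
    u + fromNat n * u
      ≡⟨ solve 2 (λ n u → u :+ n :* u := (con 1ℚ :+ n) :* u) refl (fromNat n) u ⟩
    fromNat (suc n) * u ∎
    where
    open ℚ.≤-Reasoning
    n+j≤m = ℕ.<⇒≤ h
    u = 1/1+ j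
    a = half n m
    b = half n (suc m)
    S = Σ< (suc m) (half n)
    S₀ = Σ< (suc m) (half 0)
    small : ∣ ¼ * (b - a) ∣ ≤ u
    small = begin
      ∣ ¼ * (b - a) ∣
        ≡⟨ ∣*∣ˡ (b - a) (ℚ.nonNegative⁻¹ ¼) ⟩
      ¼ * ∣ b - a ∣
        ≤⟨ *-monoˡ (ℚ.nonNegative⁻¹ ¼) (ℚ.≤-trans (ℚ.∣p-q∣≤∣p∣+∣q∣ b a)
             (ℚ.+-mono-≤ (half-decay n (suc m) j (ℕ.m≤n⇒m≤1+n n+j≤m)) (half-decay n m j n+j≤m))) ⟩
      ¼ * (u + u)
        ≤⟨ ≤-by (½ * u) (0≤* (ℚ.nonNegative⁻¹ ½) (0≤1/1+ j))
             (solve 1 (λ u → u :- con ¼ :* (u :+ u) := con ½ :* u) refl u) ⟩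
      u ∎

  -- Here n is fixed while m grows, so `leibniz 0 m` stands for π/4. Row n is handled by
  -- `half-sum-close`; replacing it by row 0 costs at most C n/(j+1), and `j` is chosen to make this
  -- at most ε.
  wallis-leibniz : ∀ n ε → 0ℚ < ε → ∃[ M ] ∀ m → M ℕ.≤ m →
    ∣ 2ℚ * (1ℚ + 2ℚ * fromNat n) * (wallis n * wallis n) * leibniz 0 m - 1ℚ ∣ ≤ wallis n + ε
  wallis-leibniz n ε 0<ε = suc (n ℕ.+ j) , bound
    where
    C = 2ℚ * (1ℚ + 2ℚ * fromNat n) * (wallis n * wallis n)
    0≤C : 0ℚ ≤ C
    0≤C = 0≤* (0≤* 0≤2ℚ (ℚ.<⇒≤ (0<odd n))) (0≤* (0≤wallis n) (0≤wallis n))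
    0≤Cn = 0≤* 0≤C (0≤fromNat n)
    arch = archimedes-* 0≤Cn 0<ε
    j = proj₁ arch
    open ℚ.≤-Reasoning
    Cn≤ε : C * (fromNat n * 1/1+ j) ≤ ε
    Cn≤ε = begin
      C * (fromNat n * 1/1+ j)
        ≡⟨ sym (ℚ.*-assoc C (fromNat n) (1/1+ j)) ⟩
      C * fromNat n * 1/1+ j
        ≤⟨ *-monoʳ (0≤1/1+ j) (proj₂ arch (suc j) (ℕ.n≤1+n j)) ⟩
      ε * fromNat (suc j) * 1/1+ j
        ≡⟨ ℚ.*-assoc ε (fromNat (suc j)) (1/1+ j) ⟩
      ε * (fromNat (suc j) * 1/1+ j)
        ≡⟨ cong (ε *_) (fromNat*1/1+ j) ⟩
      ε * 1ℚ
        ≡⟨ ℚ.*-identityʳ ε ⟩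
      ε ∎
    bound : ∀ m → suc (n ℕ.+ j) ℕ.≤ m → ∣ C * leibniz 0 m - 1ℚ ∣ ≤ wallis n + ε
    bound (suc m) (ℕ.s≤s h) = begin
      ∣ C * leibniz 0 (suc m) - 1ℚ ∣
        ≡⟨ cong (λ l → ∣ C * l - 1ℚ ∣) (sym (half-sum-leibniz (suc m))) ⟩
      ∣ C * S₀ - 1ℚ ∣
        ≡⟨ cong ∣_∣ (solve 3 (λ c s s₀ → c :* s₀ :- con 1ℚ :=
             (c :* s :- con 1ℚ) :+ :- (c :* (s :- s₀))) refl C S S₀) ⟩
      ∣ (C * S - 1ℚ) + - (C * (S - S₀)) ∣
        ≤⟨ ∣+∣≤ close (ℚ.≤-reflexive (ℚ.∣-p∣≡∣p∣ (C * (S - S₀)))) ⟩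
      wallis n + ∣ C * (S - S₀) ∣
        ≡⟨ cong (wallis n +_) (∣*∣ˡ (S - S₀) 0≤C) ⟩
      wallis n + C * ∣ S - S₀ ∣
        ≤⟨ ℚ.+-monoʳ-≤ (wallis n) (ℚ.≤-trans (*-monoˡ 0≤C (half-drift n m j h)) Cn≤ε) ⟩
      wallis n + ε ∎
      where
      S = Σ< (suc m) (half n)
      S₀ = Σ< (suc m) (half 0)
      n≤1+m : n ℕ.≤ suc m
      n≤1+m = ℕ.≤-trans (ℕ.m≤m+n n j) (ℕ.m≤n⇒m≤1+n h)
      close : ∣ C * S - 1ℚ ∣ ≤ wallis n
      close = subst (λ k → ∣ C * Σ< k (half n) - 1ℚ ∣ ≤ wallis n)
        (ℕ.m+[n∸m]≡n n≤1+m) (half-sum-close n (suc m ℕ.∸ n))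

-- The ring of formal power series

module GeneratingFunctions where

  open import Algebra.Bundles using (CommutativeRing)
  open import Algebra.Solver.Ring.AlmostCommutativeRing using (fromCommutativeRing; _-Raw-AlmostCommutative⟶_)
  open import Data.Maybe using (Maybe; just; nothing)
  open import Data.Rational using (ℚ; 0ℚ; 1ℚ; _+_; _*_; _-_; -_)
  open import Level using (0ℓ)
  open import Relation.Nullary using (yes; no)
  open import Algebra.Definitions.RawSemiring ℚ.+-*-rawSemiring using () renaming (_^_ to _^ℚ_)
  open RationalLemmas
  open Counting using (count; split; apps; count-app; count-lam⊎app)
  open Wallis using (wallis; wallis-suc; 2ℚ; 0<even)

  Series : Set
  Series = ℕ → ℚ

  diag : (ℕ → ℕ → ℚ) → ℕ → ℚ
  diag p zero    = p 0 0
  diag p (suc n) = p 0 (suc n) + diag (λ i → p (suc i)) n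

  infixl 7 _⊛_
  infixl 6 _⊕_

  _⊛_ : Series → Series → Series
  (f ⊛ g) n = diag (λ i j → f i * g j) n

  _⊕_ : Series → Series → Series
  (f ⊕ g) n = f n + g n

  ⊖_ : Series → Series
  (⊖ f) n = - f n

  const : ℚ → Series
  const a zero    = a
  const a (suc n) = 0ℚ

  X : Series
  X zero          = 0ℚ
  X (suc zero)    = 1ℚ
  X (suc (suc n)) = 0ℚ

  diag-cong : ∀ n {p r : ℕ → ℕ → ℚ} → (∀ i j → i ℕ.+ j ≡ n → p i j ≡ r i j) → diag p n ≡ diag r n
  diag-cong zero    h = h 0 0 refl
  diag-cong (suc n) h = cong₂ _+_ (h 0 (suc n) refl) (diag-cong n (λ i j e → h (suc i) j (cong suc e)))

  diag-+ : ∀ n (p r : ℕ → ℕ → ℚ) → diag (λ i j → p i j + r i j) n ≡ diag p n + diag r n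
  diag-+ zero    p r = refl
  diag-+ (suc n) p r = trans (cong (_+_ (p 0 (suc n) + r 0 (suc n))) (diag-+ n (λ i → p (suc i))
    (λ i → r (suc i))))
    (solve 4 (λ a b c d → (a :+ b) :+ (c :+ d) := (a :+ c) :+ (b :+ d)) refl
      (p 0 (suc n)) (r 0 (suc n)) (diag (λ i → p (suc i)) n) (diag (λ i → r (suc i)) n))
    where open ℚ.+-*-Solver

  diag-* : ∀ n a (p : ℕ → ℕ → ℚ) → diag (λ i j → a * p i j) n ≡ a * diag p n
  diag-* zero    a p = refl
  diag-* (suc n) a p = trans (cong (_+_ (a * p 0 (suc n))) (diag-* n a (λ i → p (suc i))))
    (sym (ℚ.*-distribˡ-+ a (p 0 (suc n)) (diag (λ i → p (suc i)) n)))

  diag-last : ∀ n (p : ℕ → ℕ → ℚ) → diag p (suc n) ≡ p (suc n) 0 + diag (λ i j → p i (suc j)) n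
  diag-last zero    p = ℚ.+-comm (p 0 1) (p 1 0)
  diag-last (suc n) p = trans (cong (_+_ (p 0 (suc (suc n)))) (diag-last n (λ i → p (suc i))))
    (solve 3 (λ a b c → a :+ (b :+ c) := b :+ (a :+ c)) refl
      (p 0 (suc (suc n))) (p (suc (suc n)) 0) (diag (λ i j → p (suc i) (suc j)) n))
    where open ℚ.+-*-Solver

  diag-swap : ∀ n (p : ℕ → ℕ → ℚ) → diag p n ≡ diag (λ i j → p j i) n
  diag-swap zero    p = refl
  diag-swap (suc n) p = trans (cong (_+_ (p 0 (suc n))) (diag-swap n (λ i → p (suc i)))) (sym (diag-last n
    (λ i j → p j i)))

  ⊛-cong : ∀ {f f′ g g′ : Series} → (∀ n → f n ≡ f′ n) → (∀ n → g n ≡ g′ n) → ∀ n → (f ⊛ g) n ≡ (f′ ⊛ g′) n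
  ⊛-cong h k n = diag-cong n (λ i j _ → cong₂ _*_ (h i) (k j))

  ⊛-comm : ∀ (f g : Series) n → (f ⊛ g) n ≡ (g ⊛ f) n
  ⊛-comm f g n = trans (diag-swap n (λ i j → f i * g j)) (diag-cong n (λ i j _ → ℚ.*-comm (f j) (g i)))

  ⊛-distribʳ : ∀ (h f g : Series) n → ((f ⊕ g) ⊛ h) n ≡ (f ⊛ h) n + (g ⊛ h) n
  ⊛-distribʳ h f g n = trans (diag-cong n (λ i j _ → ℚ.*-distribʳ-+ (h j) (f i) (g i)))
    (diag-+ n (λ i j → f i * h j) (λ i j → g i * h j))

  ⊛-distribˡ : ∀ (h f g : Series) n → (h ⊛ (f ⊕ g)) n ≡ (h ⊛ f) n + (h ⊛ g) n
  ⊛-distribˡ h f g n = trans (⊛-comm h (f ⊕ g) n)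
    (trans (⊛-distribʳ h f g n) (cong₂ _+_ (⊛-comm f h n) (⊛-comm g h n)))

  ⊛-scaleˡ : ∀ a (f g : Series) n → ((λ i → a * f i) ⊛ g) n ≡ a * (f ⊛ g) n
  ⊛-scaleˡ a f g n = trans (diag-cong n (λ i j _ → ℚ.*-assoc a (f i) (g j))) (diag-* n a (λ i j → f i * g j))

  ⊛-assoc : ∀ (f g h : Series) n → ((f ⊛ g) ⊛ h) n ≡ (f ⊛ (g ⊛ h)) n
  ⊛-assoc f g h zero    = ℚ.*-assoc (f 0) (g 0) (h 0)
  ⊛-assoc f g h (suc n) = trans
    (cong (_+_ (f 0 * g 0 * h (suc n))) (trans (⊛-distribʳ h (λ i → f 0 * g (suc i)) ((λ i → f (suc i)) ⊛ g) n)
      (cong₂ _+_ (⊛-scaleˡ (f 0) (λ i → g (suc i)) h n) (⊛-assoc (λ i → f (suc i)) g h n))))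
    (solve 5 (λ a b c d e → a :* b :* c :+ (a :* d :+ e) := a :* (b :* c :+ d) :+ e) refl
      (f 0) (g 0) (h (suc n)) (((λ i → g (suc i)) ⊛ h) n) (((λ i → f (suc i)) ⊛ (g ⊛ h)) n))
    where open ℚ.+-*-Solver

  diag-zero : ∀ n {p : ℕ → ℕ → ℚ} → (∀ i j → p i j ≡ 0ℚ) → diag p n ≡ 0ℚ
  diag-zero zero    h = h 0 0
  diag-zero (suc n) h = cong₂ _+_ (h 0 (suc n)) (diag-zero n (λ i j → h (suc i) j))

  const-⊛ : ∀ a f n → (const a ⊛ f) n ≡ a * f n
  const-⊛ a f zero    = refl
  const-⊛ a f (suc n) = trans (cong (_+_ (a * f (suc n))) (diag-zero n (λ i j → ℚ.*-zeroˡ (f j))))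
    (ℚ.+-identityʳ (a * f (suc n)))

  X-⊛-zero : ∀ f → (X ⊛ f) 0 ≡ 0ℚ
  X-⊛-zero f = ℚ.*-zeroˡ (f 0)

  X-⊛ : ∀ f n → (X ⊛ f) (suc n) ≡ f n
  X-⊛ f n = trans (cong₂ _+_ (ℚ.*-zeroˡ (f (suc n))) (shifted n)) (ℚ.+-identityˡ (f n))
    where
    shifted : ∀ n → ((λ i → X (suc i)) ⊛ f) n ≡ f n
    shifted zero    = ℚ.*-identityˡ (f 0)
    shifted (suc n) = trans (cong₂ _+_ (ℚ.*-identityˡ (f (suc n))) (diag-zero n (λ i j → ℚ.*-zeroˡ (f j))))
      (ℚ.+-identityʳ (f (suc n)))

  seriesRing : CommutativeRing 0ℓ 0ℓ
  seriesRing = record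
    { Carrier = Series ; _≈_ = λ f g → ∀ n → f n ≡ g n
    ; _+_ = _⊕_ ; _*_ = _⊛_ ; -_ = ⊖_ ; 0# = λ _ → 0ℚ ; 1# = const 1ℚ
    ; isCommutativeRing = record
      { isRing = record
        { +-isAbelianGroup = record
          { isGroup = record
            { isMonoid = record
              { isSemigroup = record
                { isMagma = record
                  { isEquivalence = record { refl = λ _ →
                    refl ; sym = λ h n → sym (h n) ; trans = λ h k n → trans (h n) (k n) }
                  ; ∙-cong = λ h k n → cong₂ _+_ (h n) (k n) }
                ; assoc = λ f g h n → ℚ.+-assoc (f n) (g n) (h n) }
              ; identity = (λ f n → ℚ.+-identityˡ (f n)) , (λ f n → ℚ.+-identityʳ (f n)) }
            ; inverse = (λ f n → ℚ.+-inverseˡ (f n)) , (λ f n → ℚ.+-inverseʳ (f n))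
            ; ⁻¹-cong = λ h n → cong -_ (h n) }
          ; comm = λ f g n → ℚ.+-comm (f n) (g n) }
        ; *-cong = ⊛-cong
        ; *-assoc = ⊛-assoc
        ; *-identity = one-⊛ , (λ f n → trans (⊛-comm f (const 1ℚ) n) (one-⊛ f n))
        ; distrib = ⊛-distribˡ , ⊛-distribʳ }
      ; *-comm = ⊛-comm } }
    where
    one-⊛ : ∀ f n → (const 1ℚ ⊛ f) n ≡ f n
    one-⊛ f n = trans (const-⊛ 1ℚ f n) (ℚ.*-identityˡ (f n))

  open CommutativeRing seriesRing using (_≈_) renaming (setoid to seriesSetoid; refl to ≈-refl;
    sym to ≈-sym; trans to ≈-trans) public

  constMorphism : CommutativeRing.rawRing ℚ.+-*-commutativeRing -Raw-AlmostCommutative⟶ fromCommutativeRing seriesRing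
  constMorphism = record
    { ⟦_⟧ = const
    ; +-homo = λ { a b zero → refl ; a b (suc n) → refl }
    ; *-homo = λ a b n → sym (trans (const-⊛ a (const b) n) (homo a b n))
    ; -‿homo = λ { a zero → refl ; a (suc n) → refl }
    ; 0-homo = λ { zero → refl ; (suc n) → refl }
    ; 1-homo = λ _ → refl
    }
    where
    homo : ∀ a b n → a * const b n ≡ const (a * b) n
    homo a b zero    = refl
    homo a b (suc n) = ℚ.*-zeroʳ a

  const≟ : ∀ a b → Maybe (const a ≈ const b)
  const≟ a b with a ℚ.≟ b
  ... | yes refl = just ≈-refl
  ... | no  _    = nothing

  module S = RingSolver (CommutativeRing.rawRing ℚ.+-*-commutativeRing) (fromCommutativeRing seriesRing) constMorphism const≟

  ⊕-cong : ∀ {f f′ g g′} → f ≈ f′ → g ≈ g′ → f ⊕ g ≈ f′ ⊕ g′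
  ⊕-cong h k n = cong₂ _+_ (h n) (k n)

  -- The Euler operator X d/dX, a derivation by `θ-⊛`.
  θ : Series → Series
  θ f n = fromNat n * f n

  θ-⊛ : ∀ f g → θ (f ⊛ g) ≈ θ f ⊛ g ⊕ f ⊛ θ g
  θ-⊛ f g zero    = solve 2 (λ a b → con 0ℚ :* (a :* b) := con 0ℚ :* a :* b :+ a :* (con 0ℚ :* b)) refl (f 0) (g 0)
    where open ℚ.+-*-Solver
  θ-⊛ f g (suc n) = begin
    (1ℚ + fromNat n) * (f 0 * g (suc n) + T n)
      ≡⟨ solve 4 (λ m a b t → (con 1ℚ :+ m) :* (a :* b :+ t) := a :* ((con 1ℚ :+ m) :* b) :+ (t :+ m :* t)) refl
           (fromNat n) (f 0) (g (suc n)) (T n) ⟩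
    f 0 * θ g (suc n) + (T n + fromNat n * T n)
      ≡⟨ cong (λ z → f 0 * θ g (suc n) + (T n + z)) (θ-⊛ tf g n) ⟩
    f 0 * θ g (suc n) + (T n + ((θ tf ⊛ g) n + (tf ⊛ θ g) n))
      ≡⟨ solve 5 (λ u a b c z → u :+ (a :+ (b :+ c)) := (con 0ℚ :* z :+ (a :+ b)) :+ (u :+ c)) refl
           (f 0 * θ g (suc n)) (T n) ((θ tf ⊛ g) n) ((tf ⊛ θ g) n) (f 0 * g (suc n)) ⟩
    (0ℚ * (f 0 * g (suc n)) + (T n + (θ tf ⊛ g) n)) + (f 0 * θ g (suc n) + (tf ⊛ θ g) n)
      ≡⟨ cong₂ (λ y z → (y + z) + (f 0 * θ g (suc n) + (tf ⊛ θ g) n)) (sym (ℚ.*-assoc 0ℚ (f 0) (g (suc n))))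
           (sym (trans (⊛-cong {f = λ i → θ f (suc i)} {f′ = tf ⊕ θ tf} (λ i → solve 2 (λ m a → (con 1ℚ :+ m) :* a
             := a :+ m :* a) refl (fromNat i) (f (suc i)))
                  (λ _ → refl) n) (⊛-distribʳ g tf (θ tf) n))) ⟩
    (θ f ⊛ g) (suc n) + (f ⊛ θ g) (suc n) ∎
    where
    open ≡-Reasoning
    open ℚ.+-*-Solver
    tf : Series
    tf i = f (suc i)
    T = tf ⊛ g

  -- Generating functions of terms and the square-root kernel

  fromNat-split : ∀ n (p : ℕ → ℕ → ℕ) → fromNat (split p n) ≡ diag (λ i j → fromNat (p i j)) n
  fromNat-split zero    p = refl
  fromNat-split (suc n) p = trans (fromNat-+ (p 0 (suc n)) (split (λ i → p (suc i)) n))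
    (cong (_+_ (fromNat (p 0 (suc n)))) (fromNat-split n (λ i → p (suc i))))

  ^-+ : ∀ x m n → x ^ℚ (m ℕ.+ n) ≡ x ^ℚ m * x ^ℚ n
  ^-+ x zero    n = sym (ℚ.*-identityˡ (x ^ℚ n))
  ^-+ x (suc m) n = trans (cong (x *_) (^-+ x m n)) (sym (ℚ.*-assoc x (x ^ℚ m) (x ^ℚ n)))

  -- `diag` without its last pair (n, 0). It serves to single out the product whose second factor
  -- has no abstraction.
  init : (ℕ → ℕ → ℚ) → ℕ → ℚ
  init p zero    = 0ℚ
  init p (suc n) = p 0 (suc n) + init (λ i → p (suc i)) n

  diag-init : ∀ n p → diag p n ≡ init p n + p n 0
  diag-init zero    p = sym (ℚ.+-identityˡ (p 0 0))
  diag-init (suc n) p = trans (cong (_+_ (p 0 (suc n))) (diag-init n (λ i → p (suc i)))) (sym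
    (ℚ.+-assoc (p 0 (suc n)) (init (λ i → p (suc i)) n) (p (suc n) 0)))

  -- Generating functions in the number of binary nodes, with the variable
  -- scaled so that the dominant singularity sits at 1 when there are q
  -- unary nodes.

  module Scaled (ζ : ℚ) where

    terms : ℕ → ℕ → Series
    terms k j b = fromNat (count k j b) * ζ ^ℚ b

    fromNat-apps : ∀ k j b → fromNat (apps (count k) j b) * ζ ^ℚ b ≡
                   diag (λ i i′ → (terms k i ⊛ terms k i′) b) j
    fromNat-apps k j b = begin
      fromNat (apps (count k) j b) * z
        ≡⟨ cong (_* z) (fromNat-split j _) ⟩
      diag (λ i i′ → fromNat (split (λ x y → count k i x ℕ.* count k i′ y) b)) j * z
        ≡⟨ ℚ.*-comm _ z ⟩
      z * diag (λ i i′ → fromNat (split (λ x y → count k i x ℕ.* count k i′ y) b)) j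
        ≡⟨ sym (diag-* j z _) ⟩
      diag (λ i i′ → z * fromNat (split (λ x y → count k i x ℕ.* count k i′ y) b)) j
        ≡⟨ diag-cong j (λ i i′ _ → product i i′) ⟩
      diag (λ i i′ → (terms k i ⊛ terms k i′) b) j ∎
      where
      open ≡-Reasoning
      open ℚ.+-*-Solver
      z = ζ ^ℚ b
      product : ∀ i i′ → z * fromNat (split (λ x y → count k i x ℕ.* count k i′ y) b) ≡ (terms k i ⊛ terms k i′) b
      product i i′ = trans (cong (z *_) (fromNat-split b _)) (trans (sym (diag-* b z _)) (diag-cong b λ x y e →
        trans (cong₂ _*_ (trans (cong (ζ ^ℚ_) (sym e)) (^-+ ζ x y)) (fromNat-* (count k i x) (count k i′ y)))
          (solve 4 (λ a b c d → (a :* b) :* (c :* d) := (c :* a) :* (d :* b)) refl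
            (ζ ^ℚ x) (ζ ^ℚ y) (fromNat (count k i x)) (fromNat (count k i′ y)))))

    ζX⊛ : ∀ f n → (const ζ ⊛ (X ⊛ f)) (suc n) ≡ ζ * f n
    ζX⊛ f n = trans (const-⊛ ζ (X ⊛ f) (suc n)) (cong (ζ *_) (X-⊛ f n))

    ζX⊛-zero : ∀ f → (const ζ ⊛ (X ⊛ f)) 0 ≡ 0ℚ
    ζX⊛-zero f = trans (cong (ζ *_) (X-⊛-zero f)) (ℚ.*-zeroʳ ζ)

    terms-zero : ∀ k → terms k 0 ≈ const (fromNat k) ⊕ const ζ ⊛ (X ⊛ (terms k 0 ⊛ terms k 0))
    terms-zero k zero    = trans (ℚ.*-identityʳ (fromNat k)) (sym
      (trans (cong (_+_ (fromNat k)) (ζX⊛-zero (terms k 0 ⊛ terms k 0)))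
      (ℚ.+-identityʳ (fromNat k))))
    terms-zero k (suc b) = begin
      fromNat (count k 0 (suc b)) * (ζ * ζ ^ℚ b)
        ≡⟨ cong (λ c → fromNat c * (ζ * ζ ^ℚ b)) (count-app k b) ⟩
      fromNat (apps (count k) 0 b) * (ζ * ζ ^ℚ b)
        ≡⟨ solve 3 (λ a z y → a :* (z :* y) := z :* (a :* y)) refl
             (fromNat (apps (count k) 0 b)) ζ (ζ ^ℚ b) ⟩
      ζ * (fromNat (apps (count k) 0 b) * ζ ^ℚ b)
        ≡⟨ cong (ζ *_) (fromNat-apps k 0 b) ⟩
      ζ * (terms k 0 ⊛ terms k 0) b
        ≡⟨ sym (ζX⊛ (terms k 0 ⊛ terms k 0) b) ⟩
      (const ζ ⊛ (X ⊛ (terms k 0 ⊛ terms k 0))) (suc b)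
        ≡⟨ sym (ℚ.+-identityˡ _) ⟩
      0ℚ + (const ζ ⊛ (X ⊛ (terms k 0 ⊛ terms k 0))) (suc b) ∎
      where
      open ≡-Reasoning
      open ℚ.+-*-Solver

    products : ℕ → ℕ → Series
    products k j b = diag (λ i i′ → (terms k i ⊛ terms k i′) b) j

    terms-suc : ∀ k j → terms k (suc j) ≈ terms (suc k) j ⊕ const ζ ⊛ (X ⊛ products k (suc j))
    terms-suc k j zero    = sym (trans (cong (_+_ (terms (suc k) j 0)) (ζX⊛-zero (products k (suc j))))
      (ℚ.+-identityʳ _))
    terms-suc k j (suc b) = begin
      fromNat (count k (suc j) (suc b)) * Z
        ≡⟨ cong (λ c → fromNat c * Z) (count-lam⊎app k j b) ⟩
      fromNat (count (suc k) j (suc b) ℕ.+ apps (count k) (suc j) b) * Z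
        ≡⟨ cong (_* Z) (fromNat-+ (count (suc k) j (suc b)) (apps (count k) (suc j) b)) ⟩
      (fromNat (count (suc k) j (suc b)) + fromNat (apps (count k) (suc j) b)) * Z
        ≡⟨ solve 4 (λ a b z y → (a :+ b) :* (z :* y) := a :* (z :* y) :+ z :* (b :* y)) refl
             (fromNat (count (suc k) j (suc b))) (fromNat (apps (count k) (suc j) b)) ζ (ζ ^ℚ b) ⟩
      terms (suc k) j (suc b) + ζ * (fromNat (apps (count k) (suc j) b) * ζ ^ℚ b)
        ≡⟨ cong (λ z → terms (suc k) j (suc b) + ζ * z) (fromNat-apps k (suc j) b) ⟩
      terms (suc k) j (suc b) + ζ * products k (suc j) b
        ≡⟨ cong (_+_ (terms (suc k) j (suc b))) (sym (ζX⊛ (products k (suc j)) b)) ⟩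
      terms (suc k) j (suc b) + (const ζ ⊛ (X ⊛ products k (suc j))) (suc b) ∎
      where
      open ≡-Reasoning
      open ℚ.+-*-Solver
      Z = ζ * ζ ^ℚ b

    innerProducts : ℕ → ℕ → Series
    innerProducts k j b = init (λ i i′ → (terms k (suc i) ⊛ terms k i′) b) j

    -- The two extreme summands are those containing the unknown `terms k (suc j)`; in
    -- `innerProducts` each factor has at least one abstraction and at most j.
    products-suc : ∀ k j → products k (suc j) ≈
      terms k 0 ⊛ terms k (suc j) ⊕ (innerProducts k j ⊕ terms k (suc j) ⊛ terms k 0)
    products-suc k j b = cong (_+_ ((terms k 0 ⊛ terms k (suc j)) b))
      (diag-init j (λ i i′ → (terms k (suc i) ⊛ terms k i′) b))

    -- Keeping `x` a parameter allows the literal 1 at k = q, where 4ζq = 1 holds only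
    -- propositionally.
    module Kernel (k : ℕ) (x : ℚ) (x≡ : (2ℚ * 2ℚ) * ζ * fromNat k ≡ x) where

      open S using (solve; _:=_; _:+_; _:*_; _:-_; :-_; con)
      open import Relation.Binary.Reasoning.Setoid seriesSetoid

      C : Series
      C = terms k 0

      D : Series
      D = const 1ℚ ⊕ ⊖ (const (2ℚ * ζ) ⊛ (X ⊛ C))

      1-xX : Series
      1-xX = const 1ℚ ⊕ ⊖ (const x ⊛ X)

      const-* : ∀ a b → const (a * b) ≈ const a ⊛ const b
      const-* a b n = _-Raw-AlmostCommutative⟶_.*-homo constMorphism a b n

      -- Completing the square in C = k + ζXC²: (1 - 2ζXC)² = 1 - 4ζX(C - ζXC²) = 1 - 4ζkX.
      D² : D ⊛ D ≈ 1-xX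
      D² = begin
        D ⊛ D
          ≈⟨ ⊛-cong D≈ D≈ ⟩
        (const 1ℚ ⊕ ⊖ (const 2ℚ ⊛ const ζ ⊛ (X ⊛ C))) ⊛ (const 1ℚ ⊕ ⊖ (const 2ℚ ⊛ const ζ ⊛ (X ⊛ C)))
          ≈⟨ solve 3 (λ z X C → (con 1ℚ :+ :- (con 2ℚ :* z :* (X :* C))) :* (con 1ℚ :+
            :- (con 2ℚ :* z :* (X :* C))) :=
               con 1ℚ :+ :- (con 2ℚ :* con 2ℚ :* z :* (X :* C))
                 :+ con 2ℚ :* con 2ℚ :* z :* X :* (z :* (X :* (C :* C)))) (λ _ → refl) (const ζ) X C ⟩
        const 1ℚ ⊕ ⊖ (const 2ℚ ⊛ const 2ℚ ⊛ const ζ ⊛ (X ⊛ C)) ⊕ const 2ℚ ⊛ const 2ℚ ⊛ const ζ ⊛ X ⊛ Q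
          ≈⟨ ⊕-cong (⊕-cong {const 1ℚ} ≈-refl
            (λ n → cong -_ (⊛-cong {const 2ℚ ⊛ const 2ℚ ⊛ const ζ} ≈-refl (⊛-cong {X} ≈-refl (terms-zero k)) n))) ≈-refl ⟩
        const 1ℚ ⊕ ⊖ (const 2ℚ ⊛ const 2ℚ ⊛ const ζ ⊛ (X ⊛ (const (fromNat k) ⊕ Q))) ⊕ const 2ℚ ⊛ const 2ℚ ⊛ const ζ ⊛ X ⊛ Q
          ≈⟨ solve 4 (λ z X K Q → con 1ℚ :+ :- (con 2ℚ :* con 2ℚ :* z :* (X :* (K :+ Q)))
            :+ con 2ℚ :* con 2ℚ :* z :* X :* Q
               := con 1ℚ :+ :- (con 2ℚ :* con 2ℚ :* z :* K :* X)) (λ _ → refl) (const ζ) X (const (fromNat k)) Q ⟩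
        const 1ℚ ⊕ ⊖ (const 2ℚ ⊛ const 2ℚ ⊛ const ζ ⊛ const (fromNat k) ⊛ X)
          ≈⟨ ⊕-cong {const 1ℚ} ≈-refl (λ n → cong -_ (⊛-cong {g = X} (≈-sym x≈) ≈-refl n)) ⟩
        1-xX ∎
        where
        Q = const ζ ⊛ (X ⊛ (C ⊛ C))
        D≈ : D ≈ const 1ℚ ⊕ ⊖ (const 2ℚ ⊛ const ζ ⊛ (X ⊛ C))
        D≈ = ⊕-cong {const 1ℚ} ≈-refl (λ n → cong -_ (⊛-cong {g = X ⊛ C} (const-* 2ℚ ζ) ≈-refl n))
        x≈ : const x ≈ const 2ℚ ⊛ const 2ℚ ⊛ const ζ ⊛ const (fromNat k)
        x≈ = ≈-trans (λ n → cong (λ y → const y n) (sym x≡)) (≈-trans (const-* (2ℚ * 2ℚ * ζ) (fromNat k))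
          (⊛-cong {g = const (fromNat k)} (≈-trans (const-* (2ℚ * 2ℚ) ζ) (⊛-cong {g = const ζ} (const-* 2ℚ 2ℚ) ≈-refl)) ≈-refl))

      1-xX⊛ : ∀ f n → (1-xX ⊛ f) (suc n) ≡ f (suc n) - x * f n
      1-xX⊛ f n = trans (solve 3 (λ x X f → (con 1ℚ :+ :- (x :* X)) :* f
        := f :+ :- (x :* (X :* f))) (λ _ → refl) (const x) X f (suc n))
        (cong (λ z → f (suc n) - z) (trans (const-⊛ x (X ⊛ f) (suc n)) (cong (x *_) (X-⊛ f n))))

      1-xX⊛-zero : ∀ f → (1-xX ⊛ f) 0 ≡ f 0
      1-xX⊛-zero f = Q.solve 2 (λ x f → (Q.con 1ℚ Q.:+ Q.:- (x Q.:* Q.con 0ℚ)) Q.:* f Q.:= f) refl x (f 0)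
        where module Q = ℚ.+-*-Solver

      θ-1-xX : θ 1-xX ≈ ⊖ (const x ⊛ X)
      θ-1-xX n = trans (cong (λ z → fromNat n * (const 1ℚ n - z)) (const-⊛ x X n))
        (trans (coefficients n) (cong -_ (sym (const-⊛ x X n))))
        where
        module Q = ℚ.+-*-Solver
        coefficients : ∀ n → fromNat n * (const 1ℚ n - x * X n) ≡ - (x * X n)
        coefficients zero          = Q.solve 1
          (λ x → Q.con 0ℚ Q.:* (Q.con 1ℚ Q.:- x Q.:* Q.con 0ℚ) Q.:= Q.:- (x Q.:* Q.con 0ℚ)) refl x
        coefficients (suc zero)    = Q.solve 1
          (λ x → (Q.con 1ℚ Q.:+ Q.con 0ℚ) Q.:* (Q.con 0ℚ Q.:- x Q.:* Q.con 1ℚ) Q.:= Q.:- (x Q.:* Q.con 1ℚ)) refl x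
        coefficients (suc (suc n)) = Q.solve 2
          (λ m x → m Q.:* (Q.con 0ℚ Q.:- x Q.:* Q.con 0ℚ) Q.:= Q.:- (x Q.:* Q.con 0ℚ)) refl
          (fromNat (suc (suc n))) x

      -- From D² = 1 - xX, the differential equation 2 (1 - xX) θD = - xX D.

      D-recurrence : ∀ n → 2ℚ * ((1ℚ + fromNat n) * D (suc n) - x * (fromNat n * D n)) ≡ - (x * D n)
      D-recurrence n = trans (sym (trans (const-⊛ 2ℚ (1-xX ⊛ θ D) (suc n)) (cong (2ℚ *_) (1-xX⊛ (θ D) n))))
        (trans (ode (suc n)) (cong -_ (trans (const-⊛ x (X ⊛ D) (suc n)) (cong (x *_) (X-⊛ D n)))))
        where
        ode : const 2ℚ ⊛ (1-xX ⊛ θ D) ≈ ⊖ (const x ⊛ (X ⊛ D))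
        ode = begin
          const 2ℚ ⊛ (1-xX ⊛ θ D)
            ≈⟨ ⊛-cong {const 2ℚ} ≈-refl (⊛-cong {g = θ D} (≈-sym D²) ≈-refl) ⟩
          const 2ℚ ⊛ (D ⊛ D ⊛ θ D)
            ≈⟨ solve 2 (λ d t → con 2ℚ :* (d :* d :* t) := d :* (t :* d :+ d :* t)) (λ _ → refl) D (θ D) ⟩
          D ⊛ (θ D ⊛ D ⊕ D ⊛ θ D)
            ≈⟨ ⊛-cong {D} ≈-refl (≈-sym (θ-⊛ D D)) ⟩
          D ⊛ θ (D ⊛ D)
            ≈⟨ ⊛-cong {D} ≈-refl (λ n → cong (fromNat n *_) (D² n)) ⟩
          D ⊛ θ 1-xX
            ≈⟨ ⊛-cong {D} ≈-refl θ-1-xX ⟩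
          D ⊛ ⊖ (const x ⊛ X)
            ≈⟨ solve 3 (λ d x X → d :* :- (x :* X) := :- (x :* (X :* d))) (λ _ → refl) D (const x) X ⟩
          ⊖ (const x ⊛ (X ⊛ D)) ∎

      module Q = ℚ.+-*-Solver

      D-zero : D 0 ≡ 1ℚ
      D-zero = Q.solve 2 (λ z c → Q.con 1ℚ Q.:+ Q.:- (z Q.:* (Q.con 0ℚ Q.:* c)) Q.:= Q.con 1ℚ) refl (2ℚ * ζ) (C 0)

      -- The coefficients of (1 - xX)^(1/2). `D-recurrence` amounts to 2(n+2) D(n+2) = (2n+1) x
      -- D(n+1), and the factor 2n+1 is also that of `wallis-suc`.
      D-closed : ∀ n → 2ℚ * (1ℚ + fromNat n) * D (suc n) ≡ - (x * x ^ℚ n * wallis n)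
      D-closed zero    = linear₂ 1ℚ (- x) (D-recurrence 0) D-zero
        (Q.solve 3 (λ x d d′ → Q.con 2ℚ Q.:* (Q.con 1ℚ Q.:+ Q.con 0ℚ) Q.:* d′ Q.:- Q.:- (x Q.:* Q.con 1ℚ Q.:* Q.con 1ℚ) Q.:=
           Q.con 1ℚ Q.:* (Q.con 2ℚ Q.:* ((Q.con 1ℚ Q.:+ Q.con 0ℚ) Q.:* d′ Q.:- x Q.:* (Q.con 0ℚ Q.:* d)) Q.:- Q.:- (x Q.:* d))
           Q.:+ Q.:- x Q.:* (d Q.:- Q.con 1ℚ)) refl x (D 0) (D 1))
      D-closed (suc n) = *-cancelˡ (0<even n)
        (linear₃ (2ℚ * (1ℚ + fromNat n)) (x * (1ℚ + 2ℚ * fromNat n)) (- (x * (x * x ^ℚ n)))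
        (D-recurrence (suc n)) (D-closed n) (sym (wallis-suc n))
        (Q.solve 7 (λ m x p d′ d″ w w′ →
           Q.con 2ℚ Q.:* (Q.con 1ℚ Q.:+ m) Q.:* (Q.con 2ℚ Q.:* (Q.con 1ℚ Q.:+ (Q.con 1ℚ Q.:+ m)) Q.:* d″) Q.:-
           Q.con 2ℚ Q.:* (Q.con 1ℚ Q.:+ m) Q.:* Q.:- (x Q.:* (x Q.:* p) Q.:* w′) Q.:=
           Q.con 2ℚ Q.:* (Q.con 1ℚ Q.:+ m) Q.:* (Q.con 2ℚ Q.:* ((Q.con 1ℚ Q.:+ (Q.con 1ℚ Q.:+ m)) Q.:* d″ Q.:- x Q.:* ((Q.con 1ℚ Q.:+ m) Q.:* d′)) Q.:- Q.:- (x Q.:* d′)) Q.:+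
           x Q.:* (Q.con 1ℚ Q.:+ Q.con 2ℚ Q.:* m) Q.:* (Q.con 2ℚ Q.:* (Q.con 1ℚ Q.:+ m) Q.:* d′ Q.:- Q.:- (x Q.:* p Q.:* w)) Q.:+
           Q.:- (x Q.:* (x Q.:* p)) Q.:* ((Q.con 1ℚ Q.:+ Q.con 2ℚ Q.:* m) Q.:* w Q.:- Q.con 2ℚ Q.:* (Q.con 1ℚ Q.:+ m) Q.:* w′)) refl
           (fromNat n) x (x ^ℚ n) (D (suc n)) (D (suc (suc n))) (wallis n) (wallis (suc n))))

      D-suc : ∀ n → D (suc n) ≡ - (2ℚ * ζ * C n)
      D-suc n = trans (ℚ.+-identityˡ _) (cong -_
        (trans (const-⊛ (2ℚ * ζ) (X ⊛ C) (suc n)) (cong (2ℚ * ζ *_) (X-⊛ C n))))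

      C-closed : ∀ n → (2ℚ * 2ℚ) * ζ * (1ℚ + fromNat n) * C n ≡ x * x ^ℚ n * wallis n
      C-closed n = linear₂ (- 1ℚ) (2ℚ * (1ℚ + fromNat n)) (D-closed n) (D-suc n)
        (Q.solve 5 (λ m z c d r → (Q.con 2ℚ Q.:* Q.con 2ℚ) Q.:* z Q.:* (Q.con 1ℚ Q.:+ m) Q.:* c Q.:- r Q.:=
           Q.:- Q.con 1ℚ Q.:* (Q.con 2ℚ Q.:* (Q.con 1ℚ Q.:+ m) Q.:* d Q.:- Q.:- r) Q.:+
           Q.con 2ℚ Q.:* (Q.con 1ℚ Q.:+ m) Q.:* (d Q.:- Q.:- (Q.con 2ℚ Q.:* z Q.:* c))) refl
           (fromNat n) ζ (C n) (D (suc n)) (x * x ^ℚ n * wallis n))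

      -- The binomial series of (1 - xX)^(-1/2), with coefficients C(2n,n)(x/4)ⁿ.
      B : Series
      B n = wallis n * x ^ℚ n

      G : Series
      G n = x ^ℚ n

      1-xX⊛B : 1-xX ⊛ B ≈ D
      1-xX⊛B zero    = trans (1-xX⊛-zero B) (sym D-zero)
      1-xX⊛B (suc n) = trans (1-xX⊛ B n) (*-cancelˡ (0<even n)
        (linear₂ (x * x ^ℚ n) (- 1ℚ) (wallis-suc n) (D-closed n)
        (Q.solve 6 (λ m x p w w′ d → Q.con 2ℚ Q.:* (Q.con 1ℚ Q.:+ m) Q.:* (w′ Q.:* (x Q.:* p) Q.:- x Q.:* (w Q.:* p)) Q.:-
             Q.con 2ℚ Q.:* (Q.con 1ℚ Q.:+ m) Q.:* d Q.:=
           x Q.:* p Q.:* (Q.con 2ℚ Q.:* (Q.con 1ℚ Q.:+ m) Q.:* w′ Q.:- (Q.con 1ℚ Q.:+ Q.con 2ℚ Q.:* m) Q.:* w) Q.:+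
           Q.:- Q.con 1ℚ Q.:* (Q.con 2ℚ Q.:* (Q.con 1ℚ Q.:+ m) Q.:* d Q.:- Q.:- (x Q.:* p Q.:* w))) refl
           (fromNat n) x (x ^ℚ n) (wallis n) (wallis (suc n)) (D (suc n)))))

      1-xX⊛G : 1-xX ⊛ G ≈ const 1ℚ
      1-xX⊛G zero    = 1-xX⊛-zero G
      1-xX⊛G (suc n) = trans (1-xX⊛ G n) (ℚ.+-inverseʳ (x * x ^ℚ n))

      -- Since `G` inverts 1 - xX and (1 - xX)B = D holds coefficientwise, BD = G(1 - xX)BD = GD² =
      -- 1.
      B⊛D : B ⊛ D ≈ const 1ℚ
      B⊛D = begin
        B ⊛ D
          ≈⟨ solve 2 (λ b d → b :* d := con 1ℚ :* (b :* d)) (λ _ → refl) B D ⟩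
        const 1ℚ ⊛ (B ⊛ D)
          ≈⟨ ⊛-cong {g = B ⊛ D} (≈-sym 1-xX⊛G) ≈-refl ⟩
        1-xX ⊛ G ⊛ (B ⊛ D)
          ≈⟨ solve 4 (λ o g b d → o :* g :* (b :* d) := g :* (o :* b :* d)) (λ _ → refl) 1-xX G B D ⟩
        G ⊛ (1-xX ⊛ B ⊛ D)
          ≈⟨ ⊛-cong {G} ≈-refl (⊛-cong {g = D} 1-xX⊛B ≈-refl) ⟩
        G ⊛ (D ⊛ D)
          ≈⟨ ⊛-cong {G} ≈-refl D² ⟩
        G ⊛ 1-xX
          ≈⟨ ⊛-comm G 1-xX ⟩
        1-xX ⊛ G
          ≈⟨ 1-xX⊛G ⟩
        const 1ℚ ∎

      -- This makes the sum of the coefficients of B accessible through its square, a geometric sum,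
      -- without naming a square root.
      B⊛B : B ⊛ B ≈ G
      B⊛B = begin
        B ⊛ B
          ≈⟨ solve 1 (λ b → b :* b := con 1ℚ :* (b :* b)) (λ _ → refl) B ⟩
        const 1ℚ ⊛ (B ⊛ B)
          ≈⟨ ⊛-cong {g = B ⊛ B} (≈-sym 1-xX⊛G) ≈-refl ⟩
        1-xX ⊛ G ⊛ (B ⊛ B)
          ≈⟨ solve 3 (λ o g b → o :* g :* (b :* b) := g :* (b :* (o :* b))) (λ _ → refl) 1-xX G B ⟩
        G ⊛ (B ⊛ (1-xX ⊛ B))
          ≈⟨ ⊛-cong {G} ≈-refl (⊛-cong {B} ≈-refl 1-xX⊛B) ⟩
        G ⊛ (B ⊛ D)
          ≈⟨ ⊛-cong {G} ≈-refl B⊛D ⟩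
        G ⊛ const 1ℚ
          ≈⟨ solve 1 (λ g → g :* con 1ℚ := g) (λ _ → refl) G ⟩
        G ∎

      -- The extreme products move to the left and turn the equation into D Y = H + ζXM, which is
      -- multiplied by B = 1/D. For ζ, x ≥ 0 no series on the right has negative coefficients, so
      -- monotone estimates apply.
      terms-convolution : ∀ j → terms k (suc j) ≈ B ⊛ (terms (suc k) j ⊕ const ζ ⊛ (X ⊛ innerProducts k j))
      terms-convolution j = begin
        Y                        ≈⟨ solve 1 (λ y → y := con 1ℚ :* y) (λ _ → refl) Y ⟩
        const 1ℚ ⊛ Y
          ≈⟨ ⊛-cong {g = Y} (≈-sym B⊛D) ≈-refl ⟩
        B ⊛ D ⊛ Y
          ≈⟨ ⊛-assoc B D Y ⟩
        B ⊛ (D ⊛ Y)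
          ≈⟨ ⊛-cong {B} ≈-refl D⊛Y ⟩
        B ⊛ (H ⊕ const ζ ⊛ (X ⊛ M)) ∎
        where
        Y = terms k (suc j)
        H = terms (suc k) j
        M = innerProducts k j
        D⊛Y : D ⊛ Y ≈ H ⊕ const ζ ⊛ (X ⊛ M)
        D⊛Y = begin
          D ⊛ Y
            ≈⟨ ⊛-cong {g = Y} (⊕-cong {const 1ℚ} ≈-refl
              (λ n → cong -_ (⊛-cong {g = X ⊛ C} (const-* 2ℚ ζ) ≈-refl n))) ≈-refl ⟩
          (const 1ℚ ⊕ ⊖ (const 2ℚ ⊛ const ζ ⊛ (X ⊛ C))) ⊛ Y
            ≈⟨ solve 4 (λ z X c y → (con 1ℚ :+ :- (con 2ℚ :* z :* (X :* c))) :* y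
              := y :+ :- (con 2ℚ :* z :* (X :* (c :* y)))) (λ _ → refl)
                 (const ζ) X C Y ⟩
          Y ⊕ ⊖ (const 2ℚ ⊛ const ζ ⊛ (X ⊛ (C ⊛ Y)))
            ≈⟨ ⊕-cong {g = ⊖ (const 2ℚ ⊛ const ζ ⊛ (X ⊛ (C ⊛ Y)))} (≈-trans (terms-suc k j) (⊕-cong {H} ≈-refl
                 (⊛-cong {const ζ} ≈-refl (⊛-cong {X} ≈-refl (products-suc k j))))) ≈-refl ⟩
          H ⊕ const ζ ⊛ (X ⊛ (C ⊛ Y ⊕ (M ⊕ Y ⊛ C))) ⊕ ⊖ (const 2ℚ ⊛ const ζ ⊛ (X ⊛ (C ⊛ Y)))
            ≈⟨ solve 6 (λ h z X c y m → h :+ z :* (X :* (c :* y :+ (m :+ y :* c))) :+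
              :- (con 2ℚ :* z :* (X :* (c :* y)))
                 := h :+ z :* (X :* m)) (λ _ → refl) H (const ζ) X C Y M ⟩
          H ⊕ const ζ ⊛ (X ⊛ M) ∎

-- Convolutions measured against the Catalan sequence

module Convolution where

  open import Data.Rational using (ℚ; 0ℚ; 1ℚ; ½; _+_; _*_; _-_; -_; ∣_∣; _≤_; _<_)
  open import Function using (_$_)
  open import Defs using (recip)
  open Defs.Lemmas using (≤⇒0≤-; *-mono; *-pos; 0<½; recip-inverse; recip-pos; cancel-recip)
  open import Algebra.Definitions.RawSemiring ℚ.+-*-rawSemiring using () renaming (_^_ to _^ℚ_)
  open ℚ.+-*-Solver using (solve; _:=_; _:+_; _:*_; _:-_; :-_; con)
  open RationalLemmas
  open Wallis
  open GeneratingFunctions hiding (module S)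

  infix 9 1+_

  1+_ : ℕ → ℚ
  1+ n = fromNat (suc n)

  0≤1+ : ∀ n → 0ℚ ≤ 1+ n
  0≤1+ n = 0≤fromNat (suc n)

  1≤1+ : ∀ n → 1ℚ ≤ 1+ n
  1≤1+ n = p≤p+q (0≤fromNat n)

  -- The rescaled Catalan numbers C(2n,n) / ((n+1) 4ⁿ).

  catalan : ℕ → ℚ
  catalan n = wallis n * recip (1+ n)

  1+*catalan : ∀ n → 1+ n * catalan n ≡ wallis n
  1+*catalan n = cancel-recip (0<fromNat n) (wallis n)

  catalan-positive : ∀ n → 0ℚ < catalan n
  catalan-positive n = *-pos (wallis-positive n) (recip-pos (0<fromNat n))

  0≤catalan : ∀ n → 0ℚ ≤ catalan n
  0≤catalan n = ℚ.<⇒≤ (catalan-positive n)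

  catalan-suc : ∀ n → 2ℚ * 1+ suc n * catalan (suc n) ≡ (1ℚ + 2ℚ * fromNat n) * catalan n
  catalan-suc n = *-cancelˡ (0<fromNat n) (linear₃ (2ℚ * 1+ n) 1ℚ (- (1ℚ + 2ℚ * fromNat n))
    (1+*catalan (suc n)) (wallis-suc n) (1+*catalan n)
    (solve 5 (λ m t t′ w w′ →
      (con 1ℚ :+ m) :* (con 2ℚ :* (con 1ℚ :+ (con 1ℚ :+ m)) :* t′) :- (con 1ℚ :+ m) :* ((con 1ℚ
        :+ con 2ℚ :* m) :* t) :=
      con 2ℚ :* (con 1ℚ :+ m) :* ((con 1ℚ :+ (con 1ℚ :+ m)) :* t′ :- w′) :+
      con 1ℚ :* (con 2ℚ :* (con 1ℚ :+ m) :* w′ :- (con 1ℚ :+ con 2ℚ :* m) :* w) :+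
      :- (con 1ℚ :+ con 2ℚ :* m) :* ((con 1ℚ :+ m) :* t :- w)) refl
      (fromNat n) (catalan n) (catalan (suc n)) (wallis n) (wallis (suc n))))

  -- `catalan n` decays like n^(-3/2), so the square of n+1 outweighs it. By `catalan-suc` the
  -- difference of the two sides is n catalan n / 2.
  square-catalan-suc : ∀ n → 1+ n * 1+ n * catalan n ≤ 1+ suc n * 1+ suc n * catalan (suc n)
  square-catalan-suc n = *-cancelˡ-≤ 0<2ℚ (≤-by (fromNat n * catalan n) (0≤* (0≤fromNat n) (0≤catalan n))
    (linear₁ (1+ suc n) (catalan-suc n) (solve 3 (λ m t t′ →
      con 2ℚ :* ((con 1ℚ :+ (con 1ℚ :+ m)) :* (con 1ℚ :+ (con 1ℚ :+ m)) :* t′) :- con 2ℚ :* ((con 1ℚ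
        :+ m) :* (con 1ℚ :+ m) :* t) :- m :* t :=
      (con 1ℚ :+ (con 1ℚ :+ m)) :* (con 2ℚ :* (con 1ℚ :+ (con 1ℚ :+ m)) :* t′ :- (con 1ℚ
        :+ con 2ℚ :* m) :* t)) refl
      (fromNat n) (catalan n) (catalan (suc n)))))

  square-catalan-mono : ∀ i n → 1+ n * 1+ n * catalan n ≤ 1+ (i ℕ.+ n) * 1+ (i ℕ.+ n) * catalan (i ℕ.+ n)
  square-catalan-mono zero    n = ℚ.≤-refl
  square-catalan-mono (suc i) n = ℚ.≤-trans (square-catalan-mono i n) (square-catalan-suc (i ℕ.+ n))

  1≤square-catalan : ∀ n → 1ℚ ≤ 1+ n * 1+ n * catalan n
  1≤square-catalan n = subst (λ m → 1ℚ ≤ 1+ m * 1+ m * catalan m) (ℕ.+-identityʳ n) (square-catalan-mono n 0)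

  1+-sub : ∀ i n → 1+ (i ℕ.+ n) ≤ 1+ i * 1+ n
  1+-sub i n = ≤-by (fromNat i * fromNat n) (0≤* (0≤fromNat i) (0≤fromNat n))
    (linear₁ (- 1ℚ) (fromNat-+ i n) (solve 3 (λ a b c →
      (con 1ℚ :+ a) :* (con 1ℚ :+ b) :- (con 1ℚ :+ c) :- a :* b := :- con 1ℚ :* (c :- (a :+ b))) refl
      (fromNat i) (fromNat n) (fromNat (i ℕ.+ n))))

  -- From the monotonicity of (n+1)² catalan n and (i+n+1) ≤ (i+1)(n+1). An index shift by i thus
  -- costs a factor independent of n.
  catalan-ratio : ∀ i n → catalan n ≤ 1+ i * 1+ i * catalan (i ℕ.+ n)
  catalan-ratio i n = *-cancelˡ-≤ (*-pos (0<fromNat n) (0<fromNat n)) (begin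
    1+ n * 1+ n * catalan n
      ≤⟨ square-catalan-mono i n ⟩
    1+ (i ℕ.+ n) * 1+ (i ℕ.+ n) * c
      ≤⟨ *-monoʳ (0≤catalan (i ℕ.+ n)) (*-mono (0≤1+ (i ℕ.+ n)) (0≤1+ (i ℕ.+ n)) (1+-sub i n) (1+-sub i n)) ⟩
    1+ i * 1+ n * (1+ i * 1+ n) * c
      ≡⟨ solve 3 (λ a b c → a :* b :* (a :* b) :* c := b :* b :* (a :* a :* c)) refl (1+ i) (1+ n) c ⟩
    1+ n * 1+ n * (1+ i * 1+ i * c) ∎)
    where
    open ℚ.≤-Reasoning
    c = catalan (i ℕ.+ n)

  record Near (f : Series) (c ε : ℚ) : Set where
    constructor from
    field
      eventually : ∃[ N ] ∀ b → N ℕ.≤ b → ∣ f b - c * catalan b ∣ ≤ ε * catalan b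

  open Near

  near-cong : ∀ {f g c c′ ε ε′} → f ≈ g → c ≡ c′ → ε ≤ ε′ → Near f c ε → Near g c′ ε′
  near-cong e refl h (from (N , k)) = from $ N , λ b N≤b → ℚ.≤-trans
    (subst (λ z → ∣ z - _ ∣ ≤ _) (e b) (k b N≤b)) (*-monoʳ (0≤catalan b) h)

  near-⊕ : ∀ {f g c d ε δ} → Near f c ε → Near g d δ → Near (f ⊕ g) (c + d) (ε + δ)
  near-⊕ {f} {g} {c} {d} {ε} {δ} (from (N , h)) (from (M , k)) = from $ N ℕ.⊔ M , λ b le → let t = catalan b in begin
    ∣ (f b + g b) - (c + d) * t ∣
      ≡⟨ cong ∣_∣ (solve 5 (λ f g c d t → (f :+ g) :- (c :+ d) :* t
        := (f :- c :* t) :+ (g :- d :* t)) refl (f b) (g b) c d t) ⟩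
    ∣ (f b - c * t) + (g b - d * t) ∣
      ≤⟨ ∣+∣≤ (h b (ℕ.m⊔n≤o⇒m≤o N M le)) (k b (ℕ.m⊔n≤o⇒n≤o N M le)) ⟩
    ε * t + δ * t
      ≡⟨ sym (ℚ.*-distribʳ-+ t ε δ) ⟩
    (ε + δ) * t ∎
    where open ℚ.≤-Reasoning

  near-scale : ∀ {f c ε} a → 0ℚ ≤ a → Near f c ε → Near (λ b → a * f b) (a * c) (a * ε)
  near-scale {f} {c} {ε} a 0≤a (from (N , h)) = from $ N , λ b le → let t = catalan b in begin
    ∣ a * f b - a * c * t ∣
      ≡⟨ cong ∣_∣ (solve 4 (λ a f c t → a :* f :- a :* c :* t := a :* (f :- c :* t)) refl a (f b) c t) ⟩
    ∣ a * (f b - c * t) ∣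
      ≡⟨ ∣*∣ˡ (f b - c * t) 0≤a ⟩
    a * ∣ f b - c * t ∣
      ≤⟨ *-monoˡ 0≤a (h b le) ⟩
    a * (ε * t)
      ≡⟨ sym (ℚ.*-assoc a ε t) ⟩
    a * ε * t ∎
    where open ℚ.≤-Reasoning

  -- The constant survives because catalan (b+1)/catalan b tends to 1; δ absorbs the deviation of
  -- this ratio from 1.
  near-shift : ∀ {f c ε δ} → 0ℚ ≤ c → 0ℚ ≤ ε → 0ℚ < δ → Near f c ε → Near (X ⊛ f) c (ε + δ)
  near-shift {f} {c} {ε} {δ} 0≤c 0≤ε 0<δ (from (N , h)) = from $ suc (N ℕ.⊔ M) , bound
    where
    -- By `catalan-suc`, consecutive terms t and t′ satisfy (2b+1)(t - t′) = 3t′.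
    3ℚ = 1ℚ + 2ℚ
    0≤3 : 0ℚ ≤ 3ℚ
    0≤3 = ℚ.nonNegative⁻¹ 3ℚ
    arch = archimedes-* (0≤* 0≤3 (0≤+ 0≤ε 0≤c)) 0<δ
    M = proj₁ arch
    open ℚ.≤-Reasoning
    bound : ∀ b → suc (N ℕ.⊔ M) ℕ.≤ b → ∣ (X ⊛ f) b - c * catalan b ∣ ≤ (ε + δ) * catalan b
    bound (suc b) (ℕ.s≤s le) = begin
      ∣ (X ⊛ f) (suc b) - c * t′ ∣
        ≡⟨ cong (λ z → ∣ z - c * t′ ∣) (X-⊛ f b) ⟩
      ∣ f b - c * t′ ∣
        ≡⟨ cong ∣_∣ (solve 4 (λ f c t t′ → f :- c :* t′ := (f :- c :* t) :+ c :* (t :- t′)) refl (f b) c t t′) ⟩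
      ∣ (f b - c * t) + c * (t - t′) ∣
        ≤⟨ ∣+∣≤ (h b (ℕ.m⊔n≤o⇒m≤o N M le)) (ℚ.≤-reflexive (ℚ.0≤p⇒∣p∣≡p (0≤* 0≤c (≤⇒0≤- decreasing)))) ⟩
      ε * t + c * (t - t′)
        ≤⟨ *-cancelˡ-≤ (0<odd b) (≤-by ((δ * fromNat b - 3ℚ * (ε + c)) * t′ + (δ + δ * fromNat b) * t′)
             (0≤+ (0≤* (≤⇒0≤- (proj₂ arch b (ℕ.m⊔n≤o⇒n≤o N M le))) 0≤t′)
                  (0≤* (0≤+ (ℚ.<⇒≤ 0<δ) (0≤* (ℚ.<⇒≤ 0<δ) (0≤fromNat b))) 0≤t′))
             (linear₁ (ε + c) (catalan-suc b) (solve 6 (λ m t t′ e c d →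
               (con 1ℚ :+ con 2ℚ :* m) :* ((e :+ d) :* t′) :- (con 1ℚ :+ con 2ℚ :* m) :* (e :* t :+ c :* (t :- t′))
                 :- ((d :* m :- con 3ℚ :* (e :+ c)) :* t′ :+ (d :+ d :* m) :* t′) :=
               (e :+ c) :* (con 2ℚ :* (con 1ℚ :+ (con 1ℚ :+ m)) :* t′ :- (con 1ℚ :+ con 2ℚ :* m) :* t)) refl
               (fromNat b) t t′ ε c δ))) ⟩
      (ε + δ) * t′ ∎
      where
      t = catalan b
      t′ = catalan (suc b)
      0≤t′ = 0≤catalan (suc b)
      decreasing : t′ ≤ t
      decreasing = *-cancelˡ-≤ (0<odd b) (≤-by (3ℚ * t′) (0≤* 0≤3 0≤t′) (linear₁ (- 1ℚ) (catalan-suc b)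
        (solve 3 (λ m t t′ →
        (con 1ℚ :+ con 2ℚ :* m) :* t :- (con 1ℚ :+ con 2ℚ :* m) :* t′ :- con 3ℚ :* t′ :=
        :- con 1ℚ :* (con 2ℚ :* (con 1ℚ :+ (con 1ℚ :+ m)) :* t′ :- (con 1ℚ :+ con 2ℚ :* m) :* t))
          refl (fromNat b) t t′)))

  ∣diag∣≤ : ∀ n {p r : ℕ → ℕ → ℚ} → (∀ i j → i ℕ.+ j ≡ n → ∣ p i j ∣ ≤ r i j) → ∣ diag p n ∣ ≤ diag r n
  ∣diag∣≤ zero    h = h 0 0 refl
  ∣diag∣≤ (suc n) h = ∣+∣≤ (h 0 (suc n) refl) (∣diag∣≤ n (λ i j e → h (suc i) j (cong suc e)))

  diag-Σ< : ∀ n u → diag (λ i _ → u i) n ≡ Σ< (suc n) u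
  diag-Σ< zero    u = sym (ℚ.+-identityʳ (u 0))
  diag-Σ< (suc n) u = cong (u 0 +_) (diag-Σ< n (λ i → u (suc i)))

  -- `catalan-ratio` bounds catalan j by (i+1)² catalan (i+j), which is the origin of the weight on
  -- `g`.
  ⊛-bound : ∀ {g h : Series} {H A} → (∀ i → 0ℚ ≤ g i) → 0ℚ ≤ H → (∀ b → ∣ h b ∣ ≤ H * catalan b) →
            (∀ K → Σ< K (λ i → g i * (1+ i * 1+ i)) ≤ A) → ∀ b → ∣ (g ⊛ h) b ∣ ≤ H * A * catalan b
  ⊛-bound {g} {h} {H} {A} 0≤g 0≤H h≤ g≤ b = begin
    ∣ (g ⊛ h) b ∣
      ≤⟨ ∣diag∣≤ b pointwise ⟩
    diag (λ i j → H * catalan b * (g i * (1+ i * 1+ i))) b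
      ≡⟨ diag-* b (H * catalan b) (λ i j → g i * (1+ i * 1+ i)) ⟩
    H * catalan b * diag (λ i j → g i * (1+ i * 1+ i)) b
      ≡⟨ cong (H * catalan b *_) (diag-Σ< b (λ i → g i * (1+ i * 1+ i))) ⟩
    H * catalan b * Σ< (suc b) (λ i → g i * (1+ i * 1+ i))
      ≤⟨ *-monoˡ (0≤* 0≤H (0≤catalan b)) (g≤ (suc b)) ⟩
    H * catalan b * A
      ≡⟨ solve 3 (λ h t a → h :* t :* a := h :* a :* t) refl H (catalan b) A ⟩
    H * A * catalan b ∎
    where
    open ℚ.≤-Reasoning
    pointwise : ∀ i j → i ℕ.+ j ≡ b → ∣ g i * h j ∣ ≤ H * catalan b * (g i * (1+ i * 1+ i))
    pointwise i j refl = begin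
      ∣ g i * h j ∣
        ≡⟨ ∣*∣ˡ (h j) (0≤g i) ⟩
      g i * ∣ h j ∣
        ≤⟨ *-monoˡ (0≤g i) (ℚ.≤-trans (h≤ j) (*-monoˡ 0≤H (catalan-ratio i j))) ⟩
      g i * (H * (1+ i * 1+ i * catalan (i ℕ.+ j)))
        ≡⟨ solve 4 (λ g h s t → g :* (h :* (s :* t)) := h :* t :* (g :* s)) refl
             (g i) H (1+ i * 1+ i) (catalan (i ℕ.+ j)) ⟩
      H * catalan (i ℕ.+ j) * (g i * (1+ i * 1+ i)) ∎

  -- Induction on J: the first J terms of g act through shifts of h, which do
  -- not change the constant c, and A bounds the contribution of the others.

  near-⊛ : ∀ J {g h : Series} {c ε H A δ} → (∀ i → 0ℚ ≤ g i) → 0ℚ ≤ H → 0ℚ ≤ A → 0ℚ ≤ c → 0ℚ ≤ ε → 0ℚ < δ →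
           (∀ b → ∣ h b ∣ ≤ H * catalan b) → Near h c ε → (∀ K → Σ< K (λ i → g (J ℕ.+ i) * (1+ i * 1+ i)) ≤ A) →
           Near (g ⊛ h) (c * Σ< J g) (ε * Σ< J g + H * A + δ)
  near-⊛ zero {g} {h} {c} {ε} {H} {A} {δ} 0≤g 0≤H 0≤A 0≤c 0≤ε 0<δ h≤ near g≤ = from $ 0 , λ b _ → let t = catalan b in begin
    ∣ (g ⊛ h) b - c * 0ℚ * t ∣
      ≡⟨ cong ∣_∣ (solve 3 (λ y c t → y :- c :* con 0ℚ :* t := y) refl ((g ⊛ h) b) c t) ⟩
    ∣ (g ⊛ h) b ∣
      ≤⟨ ⊛-bound 0≤g 0≤H h≤ g≤ b ⟩
    H * A * t
      ≤⟨ *-monoʳ {catalan b} {H * A} {ε * 0ℚ + H * A + δ} (0≤catalan b) (≤-by δ (ℚ.<⇒≤ 0<δ)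
        (solve 3 (λ e a d → e :* con 0ℚ :+ a :+ d :- a := d) refl ε (H * A) δ)) ⟩
    (ε * 0ℚ + H * A + δ) * t ∎
    where open ℚ.≤-Reasoning
  near-⊛ (suc J) {g} {h} {c} {ε} {H} {A} {δ} 0≤g 0≤H 0≤A 0≤c 0≤ε 0<δ h≤ near g≤ =
    near-cong step
      (solve 3 (λ a c s → a :* c :+ c :* s := c :* (a :+ s)) refl (g 0) c (Σ< J tg))
      (ℚ.≤-reflexive (solve 5 (λ a e s y d → a :* e :+ (e :* s :+ y :+ con ½ :* d :+ con ½ :* d)
        := e :* (a :+ s) :+ y :+ d) refl
        (g 0) ε (Σ< J tg) (H * A) δ))
      (near-⊕ (near-scale (g 0) (0≤g 0) near)
        (near-shift (0≤* 0≤c 0≤S) (0≤+ (0≤+ (0≤* 0≤ε 0≤S) (0≤* 0≤H 0≤A)) (ℚ.<⇒≤ 0<½δ)) 0<½δ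
          (near-⊛ J {tg} (λ i → 0≤g (suc i)) 0≤H 0≤A 0≤c 0≤ε 0<½δ h≤ near g≤)))
    where
    tg : Series
    tg i = g (suc i)
    0<½δ = *-pos 0<½ 0<δ
    0≤S : 0ℚ ≤ Σ< J tg
    0≤S = 0≤Σ< J (λ i → 0≤g (suc i))
    step : (λ b → g 0 * h b) ⊕ X ⊛ (tg ⊛ h) ≈ g ⊛ h
    step zero    = trans (cong (_+_ (g 0 * h 0)) (X-⊛-zero (tg ⊛ h))) (ℚ.+-identityʳ (g 0 * h 0))
    step (suc b) = cong (_+_ (g 0 * h (suc b))) (X-⊛ (tg ⊛ h) b)

  -- The weight (i+1)^p is submultiplicative, so this class is closed under ⊛.

  record Summable (p : ℕ) (f : Series) : Set where
    constructor summable
    field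
      nonneg  : ∀ i → 0ℚ ≤ f i
      total   : ℚ
      partial : ∀ K → Σ< K (λ i → f i * 1+ i ^ℚ p) ≤ total

  open Summable

  0≤^ : ∀ {x} n → 0ℚ ≤ x → 0ℚ ≤ x ^ℚ n
  0≤^ zero    h = 0≤1
  0≤^ (suc n) h = 0≤* h (0≤^ n h)

  ^-mono : ∀ {x y} n → 0ℚ ≤ x → x ≤ y → x ^ℚ n ≤ y ^ℚ n
  ^-mono zero    0≤x h = ℚ.≤-refl
  ^-mono (suc n) 0≤x h = *-mono 0≤x (0≤^ n 0≤x) h (^-mono n 0≤x h)

  ^-* : ∀ x y n → (x * y) ^ℚ n ≡ x ^ℚ n * y ^ℚ n
  ^-* x y zero    = refl
  ^-* x y (suc n) = trans (cong (x * y *_) (^-* x y n))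
    (solve 4 (λ x y a b → x :* y :* (a :* b) := x :* a :* (y :* b)) refl x y (x ^ℚ n) (y ^ℚ n))

  1^ : ∀ n → 1ℚ ^ℚ n ≡ 1ℚ
  1^ zero    = refl
  1^ (suc n) = trans (ℚ.*-identityˡ (1ℚ ^ℚ n)) (1^ n)

  1≤1+^ : ∀ i p → 1ℚ ≤ 1+ i ^ℚ p
  1≤1+^ i p = subst (_≤ 1+ i ^ℚ p) (1^ p) (^-mono p 0≤1 (1≤1+ i))

  0≤total : ∀ {p f} (s : Summable p f) → 0ℚ ≤ total s
  0≤total s = partial s 0

  -- The triangle i + j < K lies in the square i, j < K.
  Σ<-⊛ : ∀ K {f g : Series} → (∀ i → 0ℚ ≤ f i) → (∀ i → 0ℚ ≤ g i) → Σ< K (f ⊛ g) ≤ Σ< K f * Σ< K g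
  Σ<-⊛-split : ∀ K f g → Σ< (suc K) (f ⊛ g) ≡ f 0 * Σ< (suc K) g + Σ< K ((λ i → f (suc i)) ⊛ g)

  Σ<-⊛-split K f g = trans (cong (_+_ (f 0 * g 0)) (trans (Σ<-+ K (λ n → f 0 * g (suc n)) ((λ i → f (suc i)) ⊛ g))
      (cong (_+ Σ< K ((λ i → f (suc i)) ⊛ g)) (Σ<-*ˡ K (f 0) (λ n → g (suc n))))))
    (solve 4 (λ a b c d → a :* b :+ (a :* c :+ d) := a :* (b :+ c) :+ d) refl
      (f 0) (g 0) (Σ< K (λ n → g (suc n))) (Σ< K ((λ i → f (suc i)) ⊛ g)))

  Σ<-⊛ zero    0≤f 0≤g = ℚ.≤-refl
  Σ<-⊛ (suc K) {f} {g} 0≤f 0≤g = begin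
    Σ< (suc K) (f ⊛ g)
      ≡⟨ Σ<-⊛-split K f g ⟩
    f 0 * Σ< (suc K) g + Σ< K (tf ⊛ g)
      ≤⟨ ℚ.+-monoʳ-≤ (f 0 * Σ< (suc K) g) (Σ<-⊛ K (λ i → 0≤f (suc i)) 0≤g) ⟩
    f 0 * Σ< (suc K) g + Σ< K tf * Σ< K g
      ≤⟨ ℚ.+-monoʳ-≤ (f 0 * Σ< (suc K) g) (*-monoˡ (0≤Σ< K (λ i → 0≤f (suc i)))
           (subst (Σ< K g ≤_) (sym (Σ<-last K g)) (p≤p+q (0≤g K)))) ⟩
    f 0 * Σ< (suc K) g + Σ< K tf * Σ< (suc K) g  ≡⟨ sym (ℚ.*-distribʳ-+ (Σ< (suc K) g) (f 0) (Σ< K tf)) ⟩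
    Σ< (suc K) f * Σ< (suc K) g ∎
    where
    open ℚ.≤-Reasoning
    tf : Series
    tf i = f (suc i)

  Σ<-monoᵏ : ∀ {K L} {f : Series} → (∀ i → 0ℚ ≤ f i) → K ℕ.≤ L → Σ< K f ≤ Σ< L f
  Σ<-monoᵏ {L = L} 0≤f ℕ.z≤n = 0≤Σ< L 0≤f
  Σ<-monoᵏ {f = f} 0≤f (ℕ.s≤s h) = ℚ.+-monoʳ-≤ (f 0) (Σ<-monoᵏ (λ i → 0≤f (suc i)) h)

  -- The rectangle i < K, j < L lies in the triangle i + j < K + L. Together with `Σ<-⊛` this
  -- squeezes the squared partial sums of the kernel in `lim-⊛`.
  Σ<-⊛-lower : ∀ K L {f g : Series} → (∀ i → 0ℚ ≤ f i) → (∀ i → 0ℚ ≤ g i) → Σ< K f * Σ< L g ≤ Σ< (K ℕ.+ L) (f ⊛ g)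
  0≤⊛ : ∀ {f g : Series} → (∀ i → 0ℚ ≤ f i) → (∀ i → 0ℚ ≤ g i) → ∀ n → 0ℚ ≤ (f ⊛ g) n
  0≤⊛ h k zero    = 0≤* (h 0) (k 0)
  0≤⊛ h k (suc n) = 0≤+ (0≤* (h 0) (k (suc n))) (0≤⊛ (λ i → h (suc i)) k n)

  Σ<-⊛-lower zero    L {f} {g} 0≤f 0≤g = subst (_≤ Σ< L (f ⊛ g)) (sym (ℚ.*-zeroˡ (Σ< L g))) (0≤Σ< L (0≤⊛ 0≤f 0≤g))
  Σ<-⊛-lower (suc K) L {f} {g} 0≤f 0≤g = begin
    Σ< (suc K) f * Σ< L g
      ≡⟨ ℚ.*-distribʳ-+ (Σ< L g) (f 0) (Σ< K tf) ⟩
    f 0 * Σ< L g + Σ< K tf * Σ< L g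
      ≤⟨ ℚ.+-mono-≤ (*-monoˡ (0≤f 0) (Σ<-monoᵏ 0≤g (ℕ.m≤n⇒m≤1+n (ℕ.m≤n+m L K))))
           (Σ<-⊛-lower K L (λ i → 0≤f (suc i)) 0≤g) ⟩
    f 0 * Σ< (suc (K ℕ.+ L)) g + Σ< (K ℕ.+ L) (tf ⊛ g)
      ≡⟨ sym (Σ<-⊛-split (K ℕ.+ L) f g) ⟩
    Σ< (suc (K ℕ.+ L)) (f ⊛ g) ∎
    where
    open ℚ.≤-Reasoning
    tf : Series
    tf i = f (suc i)

  diag-mono : ∀ n {p r : ℕ → ℕ → ℚ} → (∀ i j → i ℕ.+ j ≡ n → p i j ≤ r i j) → diag p n ≤ diag r n
  diag-mono zero    h = h 0 0 refl
  diag-mono (suc n) h = ℚ.+-mono-≤ (h 0 (suc n) refl) (diag-mono n (λ i j e → h (suc i) j (cong suc e)))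

  summable-⊛ : ∀ {p f g} → Summable p f → Summable p g → Summable p (f ⊛ g)
  summable-⊛ {p} {f} {g} sf sg .nonneg  = 0≤⊛ (nonneg sf) (nonneg sg)
  summable-⊛ {p} {f} {g} sf sg .total   = total sf * total sg
  summable-⊛ {p} {f} {g} sf sg .partial K = begin
    Σ< K (λ n → (f ⊛ g) n * 1+ n ^ℚ p)
      ≤⟨ Σ<-mono K (λ n _ → weight n) ⟩
    Σ< K (f′ ⊛ g′)
      ≤⟨ Σ<-⊛ K 0≤f′ 0≤g′ ⟩
    Σ< K f′ * Σ< K g′
      ≤⟨ *-mono (0≤Σ< K 0≤f′) (0≤Σ< K 0≤g′) (partial sf K) (partial sg K) ⟩
    total sf * total sg ∎
    where
    open ℚ.≤-Reasoning
    f′ g′ : Series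
    f′ i = f i * 1+ i ^ℚ p
    g′ i = g i * 1+ i ^ℚ p
    0≤f′ : ∀ i → 0ℚ ≤ f′ i
    0≤f′ i = 0≤* (nonneg sf i) (0≤^ p (0≤1+ i))
    0≤g′ : ∀ i → 0ℚ ≤ g′ i
    0≤g′ i = 0≤* (nonneg sg i) (0≤^ p (0≤1+ i))
    weight : ∀ n → (f ⊛ g) n * 1+ n ^ℚ p ≤ (f′ ⊛ g′) n
    weight n = subst (_≤ (f′ ⊛ g′) n)
      (trans (diag-* n (1+ n ^ℚ p) (λ i j → f i * g j)) (ℚ.*-comm (1+ n ^ℚ p) ((f ⊛ g) n)))
      (diag-mono n λ { i j refl → begin
        1+ (i ℕ.+ j) ^ℚ p * (f i * g j)
          ≤⟨ *-monoʳ (0≤* (nonneg sf i) (nonneg sg j)) (^-mono p (0≤1+ (i ℕ.+ j)) (1+-sub i j)) ⟩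
        (1+ i * 1+ j) ^ℚ p * (f i * g j)
          ≡⟨ cong (_* (f i * g j)) (^-* (1+ i) (1+ j) p) ⟩
        1+ i ^ℚ p * 1+ j ^ℚ p * (f i * g j)
          ≡⟨ solve 4 (λ a b c d → a :* b :* (c :* d) := c :* a :* (d :* b)) refl
               (1+ i ^ℚ p) (1+ j ^ℚ p) (f i) (g j) ⟩
        f′ i * g′ j ∎ })

  summable-≤ : ∀ {p f g} a → 0ℚ ≤ a → (∀ i → 0ℚ ≤ g i) → (∀ i → g i ≤ a * f i) → Summable p f → Summable p g
  summable-≤ a 0≤a 0≤g g≤ s .nonneg = 0≤g
  summable-≤ a 0≤a 0≤g g≤ s .total  = a * total s
  summable-≤ {p} {f} {g} a 0≤a 0≤g g≤ s .partial K = begin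
    Σ< K (λ i → g i * 1+ i ^ℚ p)
      ≤⟨ Σ<-mono K (λ i _ → ℚ.≤-trans (*-monoʳ (0≤^ p (0≤1+ i)) (g≤ i))
           (ℚ.≤-reflexive (ℚ.*-assoc a (f i) (1+ i ^ℚ p)))) ⟩
    Σ< K (λ i → a * (f i * 1+ i ^ℚ p))
      ≡⟨ Σ<-*ˡ K a (λ i → f i * 1+ i ^ℚ p) ⟩
    a * Σ< K (λ i → f i * 1+ i ^ℚ p)
      ≤⟨ *-monoˡ 0≤a (partial s K) ⟩
    a * total s ∎
    where open ℚ.≤-Reasoning

  summable-cong : ∀ {p f g} → f ≈ g → Summable p f → Summable p g
  summable-cong {f = f} {g} e s = summable-≤ 1ℚ 0≤1 (λ i → subst (0ℚ ≤_) (e i) (nonneg s i))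
    (λ i → ℚ.≤-reflexive (trans (sym (e i)) (sym (ℚ.*-identityˡ (f i))))) s

  summable-⊕ : ∀ {p f g} → Summable p f → Summable p g → Summable p (f ⊕ g)
  summable-⊕ sf sg .nonneg i = 0≤+ (nonneg sf i) (nonneg sg i)
  summable-⊕ sf sg .total    = total sf + total sg
  summable-⊕ {p} {f} {g} sf sg .partial K = begin
    Σ< K (λ i → (f i + g i) * 1+ i ^ℚ p)
      ≡⟨ Σ<-cong K (λ i _ → ℚ.*-distribʳ-+ (1+ i ^ℚ p) (f i) (g i)) ⟩
    Σ< K (λ i → f i * 1+ i ^ℚ p + g i * 1+ i ^ℚ p)
      ≡⟨ Σ<-+ K (λ i → f i * 1+ i ^ℚ p) (λ i → g i * 1+ i ^ℚ p) ⟩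
    Σ< K (λ i → f i * 1+ i ^ℚ p) + Σ< K (λ i → g i * 1+ i ^ℚ p)
      ≤⟨ ℚ.+-mono-≤ (partial sf K) (partial sg K) ⟩
    total sf + total sg ∎
    where open ℚ.≤-Reasoning

  Σ<-zero : ∀ K {f : Series} → (∀ i → f i ≡ 0ℚ) → Σ< K f ≡ 0ℚ
  Σ<-zero zero    h = refl
  Σ<-zero (suc K) h = cong₂ _+_ (h 0) (Σ<-zero K (λ i → h (suc i)))

  summable-0 : ∀ {p} → Summable p (λ _ → 0ℚ)
  summable-0 .nonneg _ = ℚ.≤-refl
  summable-0 .total    = 0ℚ
  summable-0 {p} .partial K = ℚ.≤-reflexive (Σ<-zero K (λ i → ℚ.*-zeroˡ (1+ i ^ℚ p)))

  summable-X⊛ : ∀ {p f} → Summable p f → Summable p (X ⊛ f)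
  summable-X⊛ = summable-⊛ X-summable
    where
    0≤X : ∀ i → 0ℚ ≤ X i
    0≤X zero          = ℚ.≤-refl
    0≤X (suc zero)    = 0≤1
    0≤X (suc (suc i)) = ℚ.≤-refl
    X-summable : ∀ {p} → Summable p X
    X-summable .nonneg    = 0≤X
    X-summable {p} .total = 0ℚ * 1+ 0 ^ℚ p + (1ℚ * 1+ 1 ^ℚ p + 0ℚ)
    X-summable {p} .partial K = ℚ.≤-trans (Σ<-monoᵏ (λ i → 0≤* (0≤X i) (0≤^ p (0≤1+ i))) (ℕ.m≤n+m K 2))
      (ℚ.≤-reflexive (cong (λ s → 0ℚ * 1+ 0 ^ℚ p + (1ℚ * 1+ 1 ^ℚ p + s)) (Σ<-zero K
        (λ i → ℚ.*-zeroˡ (1+ (suc (suc i)) ^ℚ p)))))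

  summable-scale : ∀ {p f} a → 0ℚ ≤ a → Summable p f → Summable p (const a ⊛ f)
  summable-scale {f = f} a 0≤a s = summable-≤ a 0≤a (λ i → subst (0ℚ ≤_) (sym (const-⊛ a f i))
    (0≤* 0≤a (nonneg s i)))
    (λ i → ℚ.≤-reflexive (const-⊛ a f i)) s

  summable-init : ∀ {p} n (F : ℕ → ℕ → Series) → (∀ i j → i ℕ.+ suc j ≡ n → Summable p (F i (suc j))) →
                  Summable p (λ b → init (λ i j → F i j b) n)
  summable-init zero    F h = summable-0
  summable-init (suc n) F h = summable-⊕ (h 0 n refl) (summable-init n (λ i → F (suc i)) (λ i j e → h (suc i) j
    (cong suc e)))

  module Geometric (x : ℚ) (0≤x : 0ℚ ≤ x) (x<1 : x < 1ℚ) where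

    0<1-x : 0ℚ < 1ℚ - x
    0<1-x = subst (_< 1ℚ - x) (ℚ.+-inverseʳ x) (ℚ.+-monoˡ-< (- x) x<1)

    Σ<-geometric : ∀ K → (1ℚ - x) * Σ< K (x ^ℚ_) ≡ 1ℚ - x ^ℚ K
    Σ<-geometric zero    = ℚ.*-zeroʳ (1ℚ - x)
    Σ<-geometric (suc K) = trans (cong ((1ℚ - x) *_) (Σ<-last K (x ^ℚ_))) (linear₁ 1ℚ (Σ<-geometric K)
      (solve 3 (λ x s p → (con 1ℚ :- x) :* (s :+ p) :- (con 1ℚ :- x :* p)
        := con 1ℚ :* ((con 1ℚ :- x) :* s :- (con 1ℚ :- p))) refl
        x (Σ< K (x ^ℚ_)) (x ^ℚ K)))

    geometric-⊛ : ∀ n → ((x ^ℚ_) ⊛ (x ^ℚ_)) n ≡ x ^ℚ n * 1+ n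
    geometric-⊛ n = trans (diag-cong n (λ i j e → trans (sym (^-+ x i j)) (cong (x ^ℚ_) e))) (constant n)
      where
      constant : ∀ m → diag (λ _ _ → x ^ℚ n) m ≡ x ^ℚ n * 1+ m
      constant zero    = sym (ℚ.*-identityʳ (x ^ℚ n))
      constant (suc m) = trans (cong (_+_ (x ^ℚ n)) (constant m))
        (solve 2 (λ a m → a :+ a :* m := a :* (con 1ℚ :+ m)) refl (x ^ℚ n) (1+ m))

    -- The square of the geometric series has coefficients (n+1)xⁿ. Its summability with exponent p
    -- is that of the geometric series with exponent p + 1.
    summable-geometric : ∀ p → Summable p (x ^ℚ_)
    summable-geometric zero .nonneg i = 0≤^ i 0≤x
    summable-geometric zero .total    = recip (1ℚ - x)
    summable-geometric zero .partial K = *-cancelˡ-≤ 0<1-x (begin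
      (1ℚ - x) * Σ< K (λ i → x ^ℚ i * 1ℚ)
        ≡⟨ cong ((1ℚ - x) *_) (Σ<-cong K (λ i _ → ℚ.*-identityʳ (x ^ℚ i))) ⟩
      (1ℚ - x) * Σ< K (x ^ℚ_)
        ≡⟨ Σ<-geometric K ⟩
      1ℚ - x ^ℚ K
        ≤⟨ ≤-by (x ^ℚ K) (0≤^ K 0≤x) (solve 1 (λ p → con 1ℚ :- (con 1ℚ :- p) := p) refl (x ^ℚ K)) ⟩
      1ℚ
        ≡⟨ sym (recip-inverse 0<1-x) ⟩
      (1ℚ - x) * recip (1ℚ - x) ∎)
      where open ℚ.≤-Reasoning
    summable-geometric (suc p) = record
      { nonneg  = λ i → 0≤^ i 0≤x
      ; total   = total square
      ; partial = λ K → subst (_≤ total square) (Σ<-cong K λ i _ → trans (cong (_* 1+ i ^ℚ p) (geometric-⊛ i))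
          (ℚ.*-assoc (x ^ℚ i) (1+ i) (1+ i ^ℚ p))) (partial square K)
      }
      where square = summable-⊛ (summable-geometric p) (summable-geometric p)

  summable-pointwise : ∀ {p f} (s : Summable p f) n → f n * 1+ n ^ℚ p ≤ total s
  summable-pointwise {p} {f} s n = ℚ.≤-trans
    (subst (f n * 1+ n ^ℚ p ≤_) (trans (ℚ.+-comm (f n * 1+ n ^ℚ p) _) (sym (Σ<-last n _)))
    (p≤p+q (0≤Σ< n (λ i → 0≤* (nonneg s i) (0≤^ p (0≤1+ i)))))) (partial s (suc n))

  -- In a convolution with catalan, two of the three factors i+1 absorb
  -- catalan (n-i) / catalan n and the third makes the tails vanish.

  Small : Series → Set
  Small = Summable 3

  small-tail : ∀ {f} (s : Small f) J K → Σ< K (λ i → f (J ℕ.+ i) * (1+ i * 1+ i)) ≤ total s * recip (1+ J)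
  small-tail {f} s J K = *-cancelˡ-≤ (0<fromNat J) (begin
    1+ J * Σ< K (λ i → f (J ℕ.+ i) * (1+ i * 1+ i))
      ≡⟨ sym (Σ<-*ˡ K (1+ J) (λ i → f (J ℕ.+ i) * (1+ i * 1+ i))) ⟩
    Σ< K (λ i → 1+ J * (f (J ℕ.+ i) * (1+ i * 1+ i)))
      ≤⟨ Σ<-mono K (λ i _ → weight i) ⟩
    Σ< K (λ i → u (J ℕ.+ i))
      ≤⟨ ≤-by (Σ< J u) (0≤Σ< J 0≤u) (linear₁ 1ℚ (Σ<-++ J K u)
           (solve 3 (λ a b c → c :- b :- a := con 1ℚ :* (c :- (a :+ b))) refl
             (Σ< J u) (Σ< K (λ i → u (J ℕ.+ i))) (Σ< (J ℕ.+ K) u))) ⟩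
    Σ< (J ℕ.+ K) u
      ≤⟨ partial s (J ℕ.+ K) ⟩
    total s
      ≡⟨ sym (cancel-recip (0<fromNat J) (total s)) ⟩
    1+ J * (total s * recip (1+ J)) ∎)
    where
    open ℚ.≤-Reasoning
    u : Series
    u i = f i * 1+ i ^ℚ 3
    0≤u : ∀ i → 0ℚ ≤ u i
    0≤u i = 0≤* (nonneg s i) (0≤^ 3 (0≤1+ i))
    weight : ∀ i → 1+ J * (f (J ℕ.+ i) * (1+ i * 1+ i)) ≤ u (J ℕ.+ i)
    weight i = begin
      1+ J * (y * (1+ i * 1+ i))
        ≡⟨ solve 3 (λ a b c → a :* (b :* (c :* c)) := b :* (a :* (c :* c))) refl (1+ J) y (1+ i) ⟩
      y * (1+ J * (1+ i * 1+ i))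
        ≤⟨ *-monoˡ (nonneg s (J ℕ.+ i)) (*-mono (0≤1+ J) (0≤* (0≤1+ i) (0≤1+ i)) J≤ (*-mono (0≤1+ i)
          (0≤1+ i) i≤ i≤)) ⟩
      y * (m * (m * m))
        ≡⟨ cong (λ z → y * (m * (m * z))) (sym (ℚ.*-identityʳ m)) ⟩
      y * (m * (m * (m * 1ℚ))) ∎
      where
      y = f (J ℕ.+ i)
      m = 1+ (J ℕ.+ i)
      J≤ = fromNat-mono (ℕ.s≤s (ℕ.m≤m+n J i))
      i≤ = fromNat-mono (ℕ.s≤s (ℕ.m≤n+m i J))

  -- Two of the three weights are traded for `catalan n` by 1 ≤ (n+1)² catalan n. The third stays on
  -- the left and makes f negligible against `catalan`.
  small-≤ : ∀ {f} (s : Small f) n → 1+ n * f n ≤ total s * catalan n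
  small-≤ {f} s n = begin
    1+ n * f n
      ≡⟨ sym (ℚ.*-identityʳ (1+ n * f n)) ⟩
    1+ n * f n * 1ℚ
      ≤⟨ *-monoˡ (0≤* (0≤1+ n) (nonneg s n)) (1≤square-catalan n) ⟩
    1+ n * f n * (1+ n * 1+ n * catalan n)
      ≡⟨ solve 3 (λ m y t → m :* y :* (m :* m :* t)
        := y :* (m :* (m :* (m :* con 1ℚ))) :* t) refl (1+ n) (f n) (catalan n) ⟩
    f n * 1+ n ^ℚ 3 * catalan n
      ≤⟨ *-monoʳ (0≤catalan n) (summable-pointwise s n) ⟩
    total s * catalan n ∎
    where open ℚ.≤-Reasoning

  small-bound : ∀ {f} (s : Small f) n → ∣ f n ∣ ≤ total s * catalan n
  small-bound {f} s n = ℚ.≤-trans (ℚ.≤-reflexive (ℚ.0≤p⇒∣p∣≡p (nonneg s n))) (ℚ.≤-trans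
    (subst (_≤ 1+ n * f n) (ℚ.*-identityˡ (f n)) (*-monoʳ (nonneg s n) (1≤1+ n))) (small-≤ s n))

  small-near : ∀ {f ε} → Small f → 0ℚ < ε → Near f 0ℚ ε
  small-near {f} {ε} s 0<ε = from $ proj₁ arch , λ n le → *-cancelˡ-≤ (0<fromNat n) (begin
    1+ n * ∣ f n - 0ℚ * catalan n ∣
      ≡⟨ cong (λ z → 1+ n * ∣ z ∣) (solve 2 (λ y t → y :- con 0ℚ :* t := y) refl (f n) (catalan n)) ⟩
    1+ n * ∣ f n ∣
      ≡⟨ cong (1+ n *_) (ℚ.0≤p⇒∣p∣≡p (nonneg s n)) ⟩
    1+ n * f n
      ≤⟨ small-≤ s n ⟩
    total s * catalan n
      ≤⟨ *-monoʳ (0≤catalan n) (proj₂ arch (suc n) (ℕ.m≤n⇒m≤1+n le)) ⟩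
    ε * 1+ n * catalan n
      ≡⟨ solve 3 (λ e m t → e :* m :* t := m :* (e :* t)) refl ε (1+ n) (catalan n) ⟩
    1+ n * (ε * catalan n) ∎)
    where
    open ℚ.≤-Reasoning
    arch = archimedes-* (0≤total s) 0<ε

-- Asymptotic constants and their squares

module Limits where

  open import Data.Nat using (_!)
  open import Data.Rational using (ℚ; 0ℚ; 1ℚ; ½; _+_; _*_; _-_; -_; ∣_∣; _≤_; _<_)
  open import Data.Sum using (inj₁; inj₂)
  open import Function using (_$_)
  open import Defs using (recip)
  open Defs.Lemmas using (≤⇒0≤-; *-mono; *-pos; 0<½; ½+½; recip-inverse; recip-pos; cancel-recip)
  open import Algebra.Definitions.RawSemiring ℚ.+-*-rawSemiring using () renaming (_^_ to _^ℚ_)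
  open ℚ.+-*-Solver using (solve; _:=_; _:+_; _:*_; _:-_; :-_; con)
  open RationalLemmas
  open Counting using (count)
  open Wallis
  open GeneratingFunctions hiding (module S)
  open Convolution

  open Near
  open Summable

  fraction : ∀ {K ε} → 0ℚ ≤ K → 0ℚ < ε → ∃[ δ ] (0ℚ < δ × δ ≤ 1ℚ × δ * K ≤ ε)
  fraction {K} {ε} 0≤K 0<ε = δ , 0<δ ,
    *-cancelˡ-≤ 0<K+ε (subst₂ _≤_ (sym δ*) (sym (ℚ.*-identityʳ (K + ε))) (≤-by K 0≤K
      (solve 2 (λ k e → (k :+ e) :- e := k) refl K ε))) ,
    subst (δ * K ≤_) δ* (≤-by (δ * ε) (0≤* (ℚ.<⇒≤ 0<δ) (ℚ.<⇒≤ 0<ε))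
      (solve 3 (λ d k e → (k :+ e) :* d :- d :* k := d :* e) refl δ K ε))
    where
    0<K+ε = ℚ.+-mono-≤-< 0≤K 0<ε
    -- Dividing by K + ε covers K = 0 and gives δ ≤ 1 without a minimum.
    δ = ε * recip (K + ε)
    0<δ = *-pos 0<ε (recip-pos 0<K+ε)
    δ* : (K + ε) * δ ≡ ε
    δ* = cancel-recip 0<K+ε ε

  0≤square : ∀ p → 0ℚ ≤ p * p
  0≤square p with ℚ.≤-total 0ℚ p
  ... | inj₁ h = 0≤* h h
  ... | inj₂ h = subst (0ℚ ≤_) (solve 1 (λ p → :- p :* :- p
    := p :* p) refl p) (0≤* (ℚ.neg-antimono-≤ h) (ℚ.neg-antimono-≤ h))

  square-cancel-≤ : ∀ {p q} → 0ℚ ≤ q → p * p ≤ q * q → p ≤ q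
  square-cancel-≤ {p} {q} 0≤q h = ℚ.≮⇒≥ λ q<p → ℚ.<-irrefl refl (ℚ.<-≤-trans (q*q<p*p q<p) h)
    where
    q*q<p*p : q < p → q * q < p * p
    q*q<p*p q<p = ℚ.≤-<-trans (*-monoˡ 0≤q (ℚ.<⇒≤ q<p))
      (ℚ.*-monoˡ-<-pos p {{ℚ.positive (ℚ.≤-<-trans 0≤q q<p)}} q<p)

  wallis≤1 : ∀ n → wallis n ≤ 1ℚ
  wallis≤1 zero    = ℚ.≤-refl
  wallis≤1 (suc n) = *-cancelˡ-≤ (0<even n) (ℚ.≤-trans (ℚ.≤-reflexive (wallis-suc n)) (ℚ.≤-trans
    (*-monoˡ (ℚ.<⇒≤ (0<odd n)) (wallis≤1 n))
    (≤-by 1ℚ 0≤1 (solve 1 (λ m → con 2ℚ :* (con 1ℚ :+ m) :* con 1ℚ :- (con 1ℚ :+ con 2ℚ :* m) :* con 1ℚ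
      := con 1ℚ) refl (fromNat n)))))

  -- f is asymptotic to √ r times catalan; c approximates √ r, which need
  -- not be rational.

  record Lim (f : Series) (r : ℚ) : Set where
    field
      rate    : ℚ
      0≤rate  : 0ℚ ≤ rate
      bigO    : ∀ b → ∣ f b ∣ ≤ rate * catalan b
      0≤limit : 0ℚ ≤ r
      approx  : ∀ ε → 0ℚ < ε → ∃[ c ] (0ℚ ≤ c × ∣ c * c - r ∣ ≤ ε × Near f c ε)

  open Lim

  lim-cong : ∀ {f g r s} → f ≈ g → r ≡ s → Lim f r → Lim g s
  lim-cong e refl l = record
    { rate = rate l ; 0≤rate = 0≤rate l ; bigO = λ b → subst
      (λ z → ∣ z ∣ ≤ _) (e b) (bigO l b) ; 0≤limit = 0≤limit l
    ; approx = λ ε 0<ε → let c , 0≤c , h , near = approx l ε 0<ε in c , 0≤c , h , near-cong e refl ℚ.≤-refl near }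

  lim-⊕ : ∀ {f g r} → Lim f r → Small g → Lim (f ⊕ g) r
  lim-⊕ {f} {g} {r} l s = record
    { rate = rate l + total s ; 0≤rate = 0≤+ (0≤rate l) (0≤total s)
    ; bigO = λ b → subst (∣ f b + g b ∣ ≤_) (sym
      (ℚ.*-distribʳ-+ (catalan b) (rate l) (total s))) (∣+∣≤ (bigO l b) (small-bound s b))
    ; 0≤limit = 0≤limit l
    ; approx = λ ε 0<ε → let 0<½ε = *-pos 0<½ 0<ε ; c , 0≤c , h , near = approx l (½ * ε) 0<½ε in
        c , 0≤c , ℚ.≤-trans h (subst (½ * ε ≤_) (½+½ ε) (p≤p+q (ℚ.<⇒≤ 0<½ε))) ,
        near-cong ≈-refl (ℚ.+-identityʳ c) (ℚ.≤-reflexive (½+½ ε)) (near-⊕ near (small-near s 0<½ε)) }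

  -- Convolution multiplies the constant by the sum of B, whose square is s = 1/(1 - x). With
  -- partial sums S J for that sum, an approximation c for `h` becomes c · S J.
  lim-⊛ : ∀ {h r s} x → 0ℚ ≤ x → x < 1ℚ → (let B = λ n → wallis n * x ^ℚ n) → B ⊛ B ≈ (x ^ℚ_) →
          0ℚ ≤ s → s * (1ℚ - x) ≡ 1ℚ → Lim h r → Lim (B ⊛ h) (r * s)
  lim-⊛ {h} {r} {s} x 0≤x x<1 B⊛B 0≤s s*y l = record
    { rate    = rate l * total sB
    ; 0≤rate  = 0≤* (0≤rate l) (0≤total sB)
    ; bigO    = ⊛-bound 0≤B (0≤rate l) (bigO l) (λ K → ℚ.≤-trans (Σ<-mono K (λ i _ → *-monoˡ
      (0≤B i) (square≤cube i))) (partial sB K))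
    ; 0≤limit = 0≤* (0≤limit l) 0≤s
    ; approx  = approximate
    }
    where
    open ℚ.≤-Reasoning
    open Geometric x 0≤x x<1
    B : Series
    B n = wallis n * x ^ℚ n
    y = 1ℚ - x
    0≤B : ∀ i → 0ℚ ≤ B i
    0≤B i = 0≤* (0≤wallis i) (0≤^ i 0≤x)
    sB : Small B
    sB = summable-≤ 1ℚ 0≤1 0≤B (λ i → *-monoʳ (0≤^ i 0≤x) (wallis≤1 i)) (summable-geometric 3)
    M = total sB
    square≤cube : ∀ i → 1+ i * 1+ i ≤ 1+ i ^ℚ 3
    square≤cube i = *-monoˡ (0≤1+ i) (subst (_≤ 1+ i * (1+ i * 1ℚ)) (ℚ.*-identityʳ (1+ i)) (*-monoˡ (0≤1+ i)
      (subst (1ℚ ≤_) (sym (ℚ.*-identityʳ (1+ i))) (1≤1+ i))))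
    S : ℕ → ℚ
    S J = Σ< J B
    S≤M : ∀ J → S J ≤ M
    S≤M J = ℚ.≤-trans (Σ<-mono J (λ i _ → subst (_≤ B i * 1+ i ^ℚ 3) (ℚ.*-identityʳ (B i)) (*-monoˡ
      (0≤B i) (1≤1+^ i 3)))) (partial sB J)
    -- The square of S J is compared with geometric sums of length 2J and J, hence lies between s(1
    -- - x^J) and s.
    yS² : ∀ J → y * (S J * S J) ≤ 1ℚ
    yS² J = begin
      y * (S J * S J)
        ≤⟨ *-monoˡ (ℚ.<⇒≤ 0<1-x) (Σ<-⊛-lower J J 0≤B 0≤B) ⟩
      y * Σ< (J ℕ.+ J) (B ⊛ B)
        ≡⟨ cong (y *_) (Σ<-cong (J ℕ.+ J) (λ i _ → B⊛B i)) ⟩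
      y * Σ< (J ℕ.+ J) (x ^ℚ_)
        ≡⟨ Σ<-geometric (J ℕ.+ J) ⟩
      1ℚ - x ^ℚ (J ℕ.+ J)
        ≤⟨ ≤-by (x ^ℚ (J ℕ.+ J)) (0≤^ (J ℕ.+ J) 0≤x) (solve 1 (λ p → con 1ℚ :- (con 1ℚ :- p)
          := p) refl (x ^ℚ (J ℕ.+ J))) ⟩
      1ℚ ∎
    yS²-lower : ∀ J → 1ℚ - x ^ℚ J ≤ y * (S J * S J)
    yS²-lower J = begin
      1ℚ - x ^ℚ J
        ≡⟨ sym (Σ<-geometric J) ⟩
      y * Σ< J (x ^ℚ_)
        ≡⟨ cong (y *_) (Σ<-cong J (λ i _ → sym (B⊛B i))) ⟩
      y * Σ< J (B ⊛ B)
        ≤⟨ *-monoˡ (ℚ.<⇒≤ 0<1-x) (Σ<-⊛ J 0≤B 0≤B) ⟩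
      y * (S J * S J) ∎
    S²≡ : ∀ J → S J * S J ≡ s * (y * (S J * S J))
    S²≡ J = sym (trans (sym (ℚ.*-assoc s y (S J * S J)))
      (trans (cong (_* (S J * S J)) s*y) (ℚ.*-identityˡ (S J * S J))))
    S²≤s : ∀ J → S J * S J ≤ s
    S²≤s J = subst₂ _≤_ (sym (S²≡ J)) (ℚ.*-identityʳ s) (*-monoˡ 0≤s (yS² J))
    s-S² : ∀ J → s - S J * S J ≤ s * x ^ℚ J
    s-S² J = subst (λ z → s - z ≤ s * x ^ℚ J) (sym (S²≡ J)) (≤-by (s * (y * (S J * S J) - (1ℚ - x ^ℚ J)))
      (0≤* 0≤s (≤⇒0≤- (yS²-lower J)))
      (solve 3 (λ s p z → s :* p :- (s :- s :* z) := s :* (z :- (con 1ℚ :- p))) refl s (x ^ℚ J) (y * (S J * S J))))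
    M₁ = total (summable-geometric 1)
    approximate : ∀ ε → 0ℚ < ε → ∃[ c ] (0ℚ ≤ c × ∣ c * c - r * s ∣ ≤ ε × Near (B ⊛ h) c ε)
    approximate ε 0<ε = c * S J , 0≤* 0≤c (0≤Σ< J 0≤B) , square , near-cong ≈-refl refl sum≤ε
      (near-⊛ J 0≤B (0≤rate l) (0≤* (0≤total sB) (ℚ.<⇒≤ (recip-pos (0<fromNat J)))) 0≤c
        (ℚ.<⇒≤ 0<δ) 0<ε₄ (bigO l) near (small-tail sB J))
      where
      ε₄ = ¼ * ε
      0<ε₄ = *-pos (ℚ.positive⁻¹ ¼) 0<ε
      0≤ε₄ = ℚ.<⇒≤ 0<ε₄
      frac = fraction (0≤+ (0≤total sB) 0≤s) 0<ε₄
      δ = proj₁ frac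
      0<δ = proj₁ (proj₂ frac)
      δ*≤ = proj₂ (proj₂ (proj₂ frac))
      app = approx l δ 0<δ
      c = proj₁ app
      0≤c = proj₁ (proj₂ app)
      c²≈r = proj₁ (proj₂ (proj₂ app))
      near = proj₂ (proj₂ (proj₂ app))
      H = rate l
      0≤HM = 0≤* (0≤rate l) (0≤total sB)
      0≤rs = 0≤* (0≤limit l) 0≤s
      0≤rsM₁ = 0≤* 0≤rs (0≤total (summable-geometric 1))
      -- One J for two purposes: the tail H M/(J+1) of the convolution and the defect r s x^J of the
      -- squared constant each become at most ε/4. For the latter, (J+1) x^J ≤ M₁.
      arch = archimedes-* (0≤+ 0≤HM 0≤rsM₁) 0<ε₄
      J = proj₁ arch
      J-large : H * M + r * s * M₁ ≤ ε₄ * 1+ J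
      J-large = proj₂ arch (suc J) (ℕ.n≤1+n J)
      δM : δ * S J ≤ ε₄
      δM = ℚ.≤-trans (*-monoˡ (ℚ.<⇒≤ 0<δ) (ℚ.≤-trans (S≤M J) (p≤p+q 0≤s))) δ*≤
      HA : H * (M * recip (1+ J)) ≤ ε₄
      HA = *-cancelˡ-≤ (0<fromNat J) (begin
        1+ J * (H * (M * recip (1+ J)))
          ≡⟨ solve 4 (λ j h m i → j :* (h :* (m :* i)) := h :* (j :* (m :* i))) refl (1+ J) H M (recip (1+ J)) ⟩
        H * (1+ J * (M * recip (1+ J)))
          ≡⟨ cong (H *_) (cancel-recip (0<fromNat J) M) ⟩
        H * M
          ≤⟨ p≤p+q 0≤rsM₁ ⟩
        H * M + r * s * M₁
          ≤⟨ J-large ⟩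
        ε₄ * 1+ J
          ≡⟨ ℚ.*-comm ε₄ (1+ J) ⟩
        1+ J * ε₄ ∎)
      rsx : r * s * x ^ℚ J ≤ ε₄
      rsx = *-cancelˡ-≤ (0<fromNat J) (begin
        1+ J * (r * s * x ^ℚ J)
          ≡⟨ solve 3 (λ j a p → j :* (a :* p) := a :* (p :* (j :* con 1ℚ))) refl (1+ J) (r * s) (x ^ℚ J) ⟩
        r * s * (x ^ℚ J * (1+ J * 1ℚ))
          ≤⟨ *-monoˡ 0≤rs (summable-pointwise (summable-geometric 1) J) ⟩
        r * s * M₁
          ≤⟨ ≤-by (H * M) 0≤HM (solve 2 (λ a b → (a :+ b) :- b := a) refl (H * M) (r * s * M₁)) ⟩
        H * M + r * s * M₁
          ≤⟨ J-large ⟩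
        ε₄ * 1+ J
          ≡⟨ ℚ.*-comm ε₄ (1+ J) ⟩
        1+ J * ε₄ ∎)
      4ε₄ : ε₄ + ε₄ + ε₄ + ε₄ ≡ ε
      4ε₄ = solve 1 (λ e → con ¼ :* e :+ con ¼ :* e :+ con ¼ :* e :+ con ¼ :* e := e) refl ε
      sum≤ε : δ * S J + H * (M * recip (1+ J)) + ε₄ ≤ ε
      sum≤ε = begin
        δ * S J + H * (M * recip (1+ J)) + ε₄
          ≤⟨ ℚ.+-monoˡ-≤ ε₄ (ℚ.+-mono-≤ δM HA) ⟩
        ε₄ + ε₄ + ε₄
          ≤⟨ p≤p+q 0≤ε₄ ⟩
        ε₄ + ε₄ + ε₄ + ε₄
          ≡⟨ 4ε₄ ⟩
        ε ∎
      square : ∣ c * S J * (c * S J) - r * s ∣ ≤ ε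
      square = begin
        ∣ c * S J * (c * S J) - r * s ∣
          ≡⟨ cong ∣_∣ (solve 4 (λ c z r s → c :* z :* (c :* z) :- r :* s
            := z :* z :* (c :* c :- r) :+ :- (r :* (s :- z :* z))) refl c (S J) r s) ⟩
        ∣ S J * S J * (c * c - r) + - (r * (s - S J * S J)) ∣
          ≤⟨ ∣+∣≤ (ℚ.≤-reflexive (∣*∣ˡ (c * c - r) (0≤square (S J)))) (ℚ.≤-reflexive (trans (ℚ.∣-p∣≡∣p∣ _)
               (ℚ.0≤p⇒∣p∣≡p (0≤* (0≤limit l) (≤⇒0≤- (S²≤s J)))))) ⟩
        S J * S J * ∣ c * c - r ∣ + r * (s - S J * S J)
          ≤⟨ ℚ.+-mono-≤ (*-mono (0≤square (S J)) (ℚ.0≤∣p∣ (c * c - r)) (S²≤s J) c²≈r) (*-monoˡ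
            (0≤limit l) (s-S² J)) ⟩
        s * δ + r * (s * x ^ℚ J)
          ≡⟨ cong₂ _+_ (ℚ.*-comm s δ) (sym (ℚ.*-assoc r s (x ^ℚ J))) ⟩
        δ * s + r * s * x ^ℚ J
          ≤⟨ ℚ.+-mono-≤ (ℚ.≤-trans (*-monoˡ (ℚ.<⇒≤ 0<δ) (≤-by M (0≤total sB) (solve 2 (λ a b → (a :+ b) :- b
            := a) refl M s))) δ*≤) rsx ⟩
        ε₄ + ε₄
          ≤⟨ ≤-by (ε₄ + ε₄) (0≤+ 0≤ε₄ 0≤ε₄) (linear₁ (- 1ℚ) 4ε₄ (solve 2 (λ e u → e :- (u :+ u) :- (u :+ u)
            := :- con 1ℚ :* (u :+ u :+ u :+ u :- e)) refl ε ε₄)) ⟩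
        ε ∎

  -- Squaring eliminates the approximations c; only the rational r remains.
  lim-square : ∀ {f r} → Lim f r → ∀ ε → 0ℚ < ε →
               ∃[ N ] ∀ b → N ℕ.≤ b → ∣ f b * f b - r * (catalan b * catalan b) ∣ ≤ ε * (catalan b * catalan b)
  lim-square {f} {r} l ε 0<ε = proj₁ (eventually near) , λ b le → bound b (proj₂ (eventually near) b le)
    where
    open ℚ.≤-Reasoning
    4ℚ = 2ℚ * 2ℚ
    -- 2r + 6 bounds the factor δ + 2c + 1 below, since δ ≤ 1 and c ≤ c² + 1 ≤ r + 2.
    0≤K : 0ℚ ≤ 2ℚ * r + (4ℚ + 2ℚ)
    0≤K = 0≤+ (0≤* 0≤2ℚ (0≤limit l)) (ℚ.nonNegative⁻¹ (4ℚ + 2ℚ))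
    frac = fraction 0≤K 0<ε
    δ = proj₁ frac
    0<δ = proj₁ (proj₂ frac)
    0≤δ = ℚ.<⇒≤ 0<δ
    δ≤1 = proj₁ (proj₂ (proj₂ frac))
    δK≤ε = proj₂ (proj₂ (proj₂ frac))
    app = approx l δ 0<δ
    c = proj₁ app
    0≤c = proj₁ (proj₂ app)
    c²≈r = proj₁ (proj₂ (proj₂ app))
    near = proj₂ (proj₂ (proj₂ app))
    c≤ : c ≤ r + 2ℚ
    c≤ = begin
      c              ≤⟨ ≤-by ((c - ½) * (c - ½) + (½ + ¼)) (0≤+ (0≤square (c - ½)) (ℚ.nonNegative⁻¹ (½ + ¼)))
                          (solve 1 (λ c → c :* c :+ con 1ℚ :- c
                            := (c :- con ½) :* (c :- con ½) :+ (con ½ :+ con ¼)) refl c) ⟩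
      c * c + 1ℚ
        ≤⟨ ≤-by (1ℚ - (c * c - r)) (≤⇒0≤- (ℚ.≤-trans (∣∣-≤ c²≈r) δ≤1))
             (solve 2 (λ c r → r :+ con 2ℚ :- (c :* c :+ con 1ℚ) := con 1ℚ :- (c :* c :- r)) refl c r) ⟩
      r + 2ℚ ∎
    bound : ∀ b → ∣ f b - c * catalan b ∣ ≤ δ * catalan b
      → ∣ f b * f b - r * (catalan b * catalan b) ∣ ≤ ε * (catalan b * catalan b)
    bound b h = begin
      ∣ y * y - r * (t * t) ∣
        ≡⟨ cong ∣_∣ (solve 4 (λ y r t c → y :* y :- r :* (t :* t)
          := (y :- c :* t) :* ((y :- c :* t) :+ con 2ℚ :* c :* t) :+ t :* t :* (c :* c :- r)) refl y r t c) ⟩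
      ∣ (y - c * t) * ((y - c * t) + 2ℚ * c * t) + t * t * (c * c - r) ∣
        ≤⟨ ∣+∣≤ (ℚ.≤-reflexive (ℚ.∣p*q∣≡∣p∣*∣q∣ (y - c * t) ((y - c * t) + 2ℚ * c * t)))
          (ℚ.≤-reflexive (∣*∣ˡ (c * c - r) 0≤tt)) ⟩
      ∣ y - c * t ∣ * ∣ (y - c * t) + 2ℚ * c * t ∣ + t * t * ∣ c * c - r ∣
        ≤⟨ ℚ.+-mono-≤ (*-mono (ℚ.0≤∣p∣ (y - c * t)) (ℚ.0≤∣p∣ ((y - c * t) + 2ℚ * c * t)) h
             (∣+∣≤ h (ℚ.≤-reflexive (ℚ.0≤p⇒∣p∣≡p (0≤* (0≤* 0≤2ℚ 0≤c) 0≤t))))) (*-monoˡ 0≤tt c²≈r) ⟩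
      δ * t * (δ * t + 2ℚ * c * t) + t * t * δ
        ≡⟨ solve 3 (λ d t c → d :* t :* (d :* t :+ con 2ℚ :* c :* t) :+ t :* t :* d
          := d :* (d :+ con 2ℚ :* c :+ con 1ℚ) :* (t :* t)) refl δ t c ⟩
      δ * (δ + 2ℚ * c + 1ℚ) * (t * t)
        ≤⟨ *-monoʳ 0≤tt (ℚ.≤-trans (*-monoˡ 0≤δ (ℚ.+-monoˡ-≤ 1ℚ (ℚ.+-mono-≤ δ≤1 (*-monoˡ 0≤2ℚ c≤))))
             (ℚ.≤-trans (ℚ.≤-reflexive (solve 2 (λ d r → d :* (con 1ℚ :+ con 2ℚ :* (r :+ con 2ℚ) :+ con 1ℚ)
               := d :* (con 2ℚ :* r :+ (con 4ℚ :+ con 2ℚ))) refl δ r)) δK≤ε)) ⟩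
      ε * (t * t) ∎
      where
      y = f b
      t = catalan b
      0≤t = 0≤catalan b
      0≤tt = 0≤* 0≤t 0≤t

  -- The chain of term series for a fixed number of abstractions

  module Terms (q : ℕ) (ζ : ℚ) (0<ζ : 0ℚ < ζ) (4ζq : 2ℚ * 2ℚ * ζ * fromNat q ≡ 1ℚ) where

    open Scaled ζ

    4ζ = 2ℚ * 2ℚ * ζ
    0<4ζ : 0ℚ < 4ζ
    0<4ζ = *-pos (*-pos 0<2ℚ 0<2ℚ) 0<ζ

    -- This is k/q, the value of 4kz at the dominant singularity z = 1/(4q).
    ratio : ℕ → ℚ
    ratio k = 4ζ * fromNat k

    0≤ratio : ∀ k → 0ℚ ≤ ratio k
    0≤ratio k = 0≤* (ℚ.<⇒≤ 0<4ζ) (0≤fromNat k)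

    1-ratio : ∀ {k} j → k ℕ.+ suc j ≡ q → 1ℚ - ratio k ≡ 4ζ * 1+ j
    1-ratio {k} j e = linear₂ (- 1ℚ) 4ζ 4ζq (trans (cong fromNat (sym e)) (fromNat-+ k (suc j)))
      (solve 4 (λ z k q j → con 1ℚ :- z :* k :- z :* j
        := :- con 1ℚ :* (z :* q :- con 1ℚ) :+ z :* (q :- (k :+ j))) refl
        4ζ (fromNat k) (fromNat q) (1+ j))

    ratio<1 : ∀ {k} j → k ℕ.+ suc j ≡ q → ratio k < 1ℚ
    ratio<1 {k} j e = subst₂ _<_ (ℚ.+-identityˡ (ratio k)) (solve 1 (λ r → con 1ℚ :- r :+ r
      := con 1ℚ) refl (ratio k))
      (ℚ.+-monoˡ-< (ratio k) (subst (0ℚ <_) (sym (1-ratio j e)) (*-pos 0<4ζ (0<fromNat j))))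

    module K (k : ℕ) = Kernel k (ratio k) refl

    difference : ∀ {k} → k ℕ.< q → ∃[ j ] k ℕ.+ suc j ≡ q
    difference {k} k<q = q ℕ.∸ suc k , trans (ℕ.+-suc k (q ℕ.∸ suc k)) (ℕ.m+[n∸m]≡n k<q)

    small-kernel : ∀ {k} → k ℕ.< q → Small (K.B k)
    small-kernel {k} k<q = let j , e = difference k<q in
      summable-≤ 1ℚ 0≤1 (λ i → 0≤* (0≤wallis i) (0≤^ i (0≤ratio k))) (λ i → *-monoʳ (0≤^ i
        (0≤ratio k)) (wallis≤1 i))
        (Geometric.summable-geometric (ratio k) (0≤ratio k) (ratio<1 j e) 3)

    0≤terms : ∀ k j b → 0ℚ ≤ terms k j b
    0≤terms k j b = 0≤* (0≤fromNat (count k j b)) (0≤^ b (ℚ.<⇒≤ 0<ζ))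

    small-terms-zero : ∀ {k} → k ℕ.< q → Small (terms k 0)
    small-terms-zero {k} k<q = let j , e = difference k<q in
      summable-≤ (recip 4ζ) (ℚ.<⇒≤ (recip-pos 0<4ζ)) (0≤terms k 0) (λ n → *-cancelˡ-≤ 0<4ζ (bound n (ratio<1 j e)))
        (Geometric.summable-geometric (ratio k) (0≤ratio k) (ratio<1 j e) 3)
      where
      open ℚ.≤-Reasoning
      x = ratio k
      bound : ∀ n → x < 1ℚ → 4ζ * terms k 0 n ≤ 4ζ * (recip 4ζ * x ^ℚ n)
      bound n x<1 = begin
        4ζ * terms k 0 n
          ≤⟨ ≤-by (4ζ * fromNat n * terms k 0 n) (0≤* (0≤* (ℚ.<⇒≤ 0<4ζ) (0≤fromNat n)) (0≤terms k 0 n))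
               (solve 3 (λ z m c → z :* (con 1ℚ :+ m) :* c :- z :* c
                 := z :* m :* c) refl 4ζ (fromNat n) (terms k 0 n)) ⟩
        4ζ * (1ℚ + fromNat n) * terms k 0 n  ≡⟨ K.C-closed k n ⟩
        x * x ^ℚ n * wallis n
          ≤⟨ *-monoˡ (0≤* (0≤ratio k) (0≤^ n (0≤ratio k))) (wallis≤1 n) ⟩
        x * x ^ℚ n * 1ℚ
          ≤⟨ *-monoʳ 0≤1 (*-monoʳ (0≤^ n (0≤ratio k)) (ℚ.<⇒≤ x<1)) ⟩
        1ℚ * x ^ℚ n * 1ℚ
          ≡⟨ trans (ℚ.*-identityʳ (1ℚ * x ^ℚ n)) (cong (_* x ^ℚ n) (sym (recip-inverse 0<4ζ))) ⟩
        4ζ * recip 4ζ * x ^ℚ n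
          ≡⟨ ℚ.*-assoc 4ζ (recip 4ζ) (x ^ℚ n) ⟩
        4ζ * (recip 4ζ * x ^ℚ n) ∎

    small-inner : ∀ k j → (∀ i → i ℕ.≤ j → Small (terms k i)) → Small (const ζ ⊛ (X ⊛ innerProducts k j))
    small-inner k j h = summable-scale ζ (ℚ.<⇒≤ 0<ζ) (summable-X⊛ (summable-init j
      (λ i i′ → terms k (suc i) ⊛ terms k i′)
      λ i i′ e → summable-⊛ (h (suc i) (subst (suc i ℕ.≤_) (trans (sym (ℕ.+-suc i i′)) e) (ℕ.s≤s (ℕ.m≤m+n i i′))))
                            (h (suc i′) (subst (suc i′ ℕ.≤_) e (ℕ.m≤n+m (suc i′) i)))))

    -- At most k + j variables are ever in scope, so every kernel met has ratio below 1 when k + j <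
    -- q. The inner products call for all i ≤ j at the same k; `n` makes this recursion structural.
    small-terms : ∀ n j k → j ℕ.≤ n → k ℕ.+ j ℕ.< q → Small (terms k j)
    small-terms n       zero    k _         k<q = small-terms-zero (subst (ℕ._< q) (ℕ.+-identityʳ k) k<q)
    small-terms (suc n) (suc j) k (ℕ.s≤s l) k+j<q = summable-cong (≈-sym (K.terms-convolution k j)) (summable-⊛
      (small-kernel (ℕ.≤-<-trans (ℕ.m≤m+n k (suc j)) k+j<q))
      (summable-⊕ (small-terms n j (suc k) l (subst (ℕ._< q) (ℕ.+-suc k j) k+j<q))
        (small-inner k j (λ i i≤j → small-terms n i k (ℕ.≤-trans i≤j l)
          (ℕ.≤-<-trans (ℕ.+-monoʳ-≤ k (ℕ.m≤n⇒m≤1+n i≤j)) k+j<q)))))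

    Q = fromNat q

    -- The initial Q² is the square of the constant in `terms-critical`. The step to j + 1 takes
    -- place at k = q - (j+1), where 1/(1 - k/q) = q/(j+1).
    limit : ℕ → ℚ
    limit zero    = Q * Q
    limit (suc j) = limit j * (Q * recip (1+ j))

    limit-closed : ∀ j → limit j * fromNat (j !) ≡ Q * Q * Q ^ℚ j
    limit-closed zero    = solve 1 (λ a → a :* (con 1ℚ :+ con 0ℚ) := a :* con 1ℚ) refl (Q * Q)
    limit-closed (suc j) = trans (cong (limit (suc j) *_) (fromNat-* (suc j) (j !)))
      (linear₂ (limit j * Q * fromNat (j !)) Q
      (recip-inverse (0<fromNat j)) (limit-closed j)
      (solve 6 (λ l q i j f p → l :* (q :* i) :* (j :* f) :- q :* q :* (q :* p)
        := l :* q :* f :* (j :* i :- con 1ℚ) :+ q :* (l :* f :- q :* q :* p)) refl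
        (limit j) Q (recip (1+ j)) (1+ j) (fromNat (j !)) (Q ^ℚ j)))

    terms-critical : ∀ n → terms q 0 n ≡ Q * catalan n
    terms-critical n = *-cancelˡ (0<fromNat n) (linear₃ (- (1+ n * terms q 0 n)) Q (- Q) 4ζq closed (1+*catalan n)
      (solve 6 (λ z q m c t w → (con 1ℚ :+ m) :* c :- (con 1ℚ :+ m) :* (q :* t) :=
        :- ((con 1ℚ :+ m) :* c) :* (z :* q :- con 1ℚ) :+ q :* (z :* (con 1ℚ :+ m) :* c :- w) :+ :- q :* ((con 1ℚ
          :+ m) :* t :- w)) refl
        4ζ Q (fromNat n) (terms q 0 n) (catalan n) (wallis n)))
      where
      closed : 4ζ * (1ℚ + fromNat n) * terms q 0 n ≡ wallis n
      closed = trans (Kernel.C-closed q 1ℚ 4ζq n) (trans (cong (λ z → 1ℚ * z * wallis n) (1^ n))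
        (trans (ℚ.*-assoc 1ℚ 1ℚ (wallis n))
        (trans (ℚ.*-identityˡ (1ℚ * wallis n)) (ℚ.*-identityˡ (wallis n)))))

    lim-terms : ∀ j k → k ℕ.+ j ≡ q → Lim (terms k j) (limit j)
    lim-terms zero k e = subst (λ k → Lim (terms k 0) (Q * Q)) (trans (sym e) (ℕ.+-identityʳ k)) record
      { rate = Q ; 0≤rate = 0≤fromNat q
      ; bigO = λ b → ℚ.≤-reflexive (trans (ℚ.0≤p⇒∣p∣≡p (0≤terms q 0 b)) (terms-critical b))
      ; 0≤limit = 0≤square Q
      ; approx = λ ε 0<ε → Q , 0≤fromNat q , subst (λ z → ∣ z ∣ ≤ ε) (sym (ℚ.+-inverseʳ (Q * Q)))
        (ℚ.<⇒≤ 0<ε) , (from $ 0 , λ b _ →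
          subst (λ z → ∣ z ∣ ≤ ε * catalan b) (sym
            (trans (cong (_- Q * catalan b) (terms-critical b)) (ℚ.+-inverseʳ (Q * catalan b))))
            (0≤* (ℚ.<⇒≤ 0<ε) (0≤catalan b))) }
    lim-terms (suc j) k e = lim-cong (≈-sym (K.terms-convolution k j)) refl
      (lim-⊛ (ratio k) (0≤ratio k) (ratio<1 j e) (K.B⊛B k) (0≤* (0≤fromNat q)
        (ℚ.<⇒≤ (recip-pos (0<fromNat j)))) inverse
        (lim-⊕ (lim-terms j (suc k) (trans (sym (ℕ.+-suc k j)) e))
          (small-inner k j (λ i i≤j → small-terms j i k i≤j
            (subst (k ℕ.+ i ℕ.<_) e (ℕ.+-monoʳ-< k (ℕ.s≤s i≤j)))))))
      where
      inverse : Q * recip (1+ j) * (1ℚ - ratio k) ≡ 1ℚ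
      inverse = trans (cong (Q * recip (1+ j) *_) (1-ratio j e))
        (linear₂ (4ζ * Q) 1ℚ (recip-inverse (0<fromNat j)) 4ζq
        (solve 4 (λ q i j z → q :* i :* (z :* j) :- con 1ℚ
          := z :* q :* (j :* i :- con 1ℚ) :+ con 1ℚ :* (z :* q :- con 1ℚ)) refl
          Q (recip (1+ j)) (1+ j) 4ζ))

-- Relative errors and the appearance of π

module Reals where

  open import Data.Rational using (ℚ; 0ℚ; 1ℚ; ½; _+_; _*_; _-_; -_; ∣_∣; _≤_; _<_)
  open import Relation.Binary.Definitions using (tri<; tri≈; tri>)
  open import Defs using (ℝ; approx; cauchy; Positive; positive; Cauchy; recip; leibniz; sqrtApprox; 1/1+_)
  open Defs.Lemmas using (≤⇒0≤-; *-mono; *-pos; 0<1; 0<½; ½+½; ∣∣≤; recip-inverse; recip-pos;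
    cancel-recip; bounded; *-close; archimedes; 0≤sqrtApprox; sqrtApprox-lower; sqrtApprox-upper; 0≤1/1+; const-cauchy; 1/1+-antimono)
  open import Algebra.Definitions.RawSemiring ℚ.+-*-rawSemiring using () renaming (_^_ to _^ℚ_)
  open ℚ.+-*-Solver using (solve; _:=_; _:+_; _:*_; _:-_; :-_; con)
  open RationalLemmas
  open Wallis
  open GeneratingFunctions hiding (module S)
  open Convolution
  open Limits

  -- As δ ≤ 1, |y| is at most 2y′, so the error ε of the first factor counts twice.
  close-* : ∀ {x x′ y y′ ε δ} → 0ℚ ≤ x′ → 0ℚ ≤ y′ → 0ℚ ≤ ε → δ ≤ 1ℚ →
            ∣ x - x′ ∣ ≤ ε * x′ → ∣ y - y′ ∣ ≤ δ * y′ → ∣ x * y - x′ * y′ ∣ ≤ (ε + ε + δ) * (x′ * y′)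
  close-* {x} {x′} {y} {y′} {ε} {δ} 0≤x′ 0≤y′ 0≤ε δ≤1 h k = begin
    ∣ x * y - x′ * y′ ∣
      ≡⟨ cong ∣_∣ (solve 4 (λ x x′ y y′ → x :* y :- x′ :* y′
        := (x :- x′) :* (y′ :+ (y :- y′)) :+ x′ :* (y :- y′)) refl x x′ y y′) ⟩
    ∣ (x - x′) * (y′ + (y - y′)) + x′ * (y - y′) ∣
      ≤⟨ ∣+∣≤ (ℚ.≤-reflexive (ℚ.∣p*q∣≡∣p∣*∣q∣ (x - x′) (y′ + (y - y′)))) (ℚ.≤-reflexive (∣*∣ˡ (y - y′) 0≤x′)) ⟩
    ∣ x - x′ ∣ * ∣ y′ + (y - y′) ∣ + x′ * ∣ y - y′ ∣
      ≤⟨ ℚ.+-mono-≤ (*-mono (ℚ.0≤∣p∣ (x - x′)) (ℚ.0≤∣p∣ (y′ + (y - y′))) h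
           (∣+∣≤ (ℚ.≤-reflexive (ℚ.0≤p⇒∣p∣≡p 0≤y′)) (ℚ.≤-trans k (*-monoʳ 0≤y′ δ≤1)))) (*-monoˡ 0≤x′ k) ⟩
    ε * x′ * (y′ + 1ℚ * y′) + x′ * (δ * y′)
      ≡⟨ solve 4 (λ x y e d → e :* x :* (y :+ con 1ℚ :* y) :+ x :* (d :* y)
        := (e :+ e :+ d) :* (x :* y)) refl x′ y′ ε δ ⟩
    (ε + ε + δ) * (x′ * y′) ∎
    where open ℚ.≤-Reasoning

  cube : ℚ → ℚ
  cube x = x * (x * (x * 1ℚ))

  -- The leading term 8b³ is written so that its factors cancel against the
  -- 2b+1 in wallis-leibniz and the b+1 in the denominator of catalan.

  cube-close : ∀ q ε → 0ℚ < ε → ∃[ N ] ∀ b → N ℕ.≤ b → let O = 1ℚ + 2ℚ * fromNat b ; D = 2ℚ * 2ℚ * O * (1+ b * 1+ b) in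
               ∣ cube (fromNat (q ℕ.+ suc (2 ℕ.* b))) - D ∣ ≤ ε * D
  cube-close q ε 0<ε = proj₁ arch , λ b le → ℚ.≤-trans (polynomial b) (begin
    C * (1+ b * 1+ b)
      ≤⟨ *-monoʳ (0≤bb b) (ℚ.≤-trans (proj₂ arch b le) (*-monoˡ (ℚ.<⇒≤ 0<ε) (b≤4O b))) ⟩
    ε * (2ℚ * 2ℚ * (1ℚ + 2ℚ * fromNat b)) * (1+ b * 1+ b)
      ≡⟨ ℚ.*-assoc ε (2ℚ * 2ℚ * (1ℚ + 2ℚ * fromNat b)) (1+ b * 1+ b) ⟩
    ε * (2ℚ * 2ℚ * (1ℚ + 2ℚ * fromNat b) * (1+ b * 1+ b)) ∎)
    where
    open ℚ.≤-Reasoning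
    4ℚ = 2ℚ * 2ℚ
    6ℚ = 4ℚ + 2ℚ
    12ℚ = 6ℚ * 2ℚ
    20ℚ = 4ℚ * (4ℚ + 1ℚ)
    p = fromNat (suc q)
    0≤p : 0ℚ ≤ p
    0≤p = 0≤1+ q
    -- The terms 8b³ cancel. The remaining coefficients of (p + 2b)³ are 12p, 6p² and p³; those of
    -- the leading product are 20, 16 and 4. So C bounds every coefficient of the difference, and 1
    -- + b + b² ≤ (1+b)².
    C = 12ℚ * p + 6ℚ * (p * p) + p * (p * p) + 20ℚ
    0≤p² = 0≤* 0≤p 0≤p
    0≤p³ = 0≤* 0≤p 0≤p²
    nn : ∀ k → {{ℚ.NonNegative k}} → 0ℚ ≤ k
    nn k = ℚ.nonNegative⁻¹ k
    0≤C : 0ℚ ≤ C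
    0≤C = 0≤+ (0≤+ (0≤+ (0≤* (nn 12ℚ) 0≤p) (0≤* (nn 6ℚ) 0≤p²)) 0≤p³) (nn 20ℚ)
    arch = archimedes-* 0≤C 0<ε
    0≤bb : ∀ b → 0ℚ ≤ 1+ b * 1+ b
    0≤bb b = 0≤* (0≤1+ b) (0≤1+ b)
    b≤4O : ∀ b → fromNat b ≤ 2ℚ * 2ℚ * (1ℚ + 2ℚ * fromNat b)
    b≤4O b = ≤-by (4ℚ + (6ℚ + 1ℚ) * fromNat b) (0≤+ (nn 4ℚ) (0≤* (nn (6ℚ + 1ℚ)) (0≤fromNat b)))
      (solve 1 (λ b → con 2ℚ :* con 2ℚ :* (con 1ℚ :+ con 2ℚ :* b) :- b
        := con 4ℚ :+ (con 6ℚ :+ con 1ℚ) :* b) refl (fromNat b))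
    polynomial : ∀ b → ∣ cube (fromNat (q ℕ.+ suc (2 ℕ.* b))) - 2ℚ * 2ℚ * (1ℚ + 2ℚ * fromNat b) * (1+ b * 1+ b) ∣ ≤ C * (1+ b * 1+ b)
    polynomial b = subst (λ ν → ∣ cube ν - 2ℚ * 2ℚ * (1ℚ + 2ℚ * fromNat b) * (1+ b * 1+ b) ∣ ≤ C * (1+ b * 1+ b))
      (sym ν≡)
      (∣∣≤
        (≤-by ((40ℚ + 6ℚ * (p * p) + p * (p * p)) * (β * β) + (24ℚ * p + 6ℚ * (p * p) + 2ℚ * (p * (p * p)) + 56ℚ) * β + (12ℚ * p + 6ℚ * (p * p) + 24ℚ))
          (0≤+ (0≤+ (0≤* (0≤+ (0≤+ (nn 40ℚ) (0≤* (nn 6ℚ) 0≤p²)) 0≤p³) 0≤β²)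
                    (0≤* (0≤+ (0≤+ (0≤+ (0≤* (nn 24ℚ) 0≤p) (0≤* (nn 6ℚ) 0≤p²)) (0≤* (nn 2ℚ) 0≤p³)) (nn 56ℚ)) 0≤β))
               (0≤+ (0≤+ (0≤* (nn 12ℚ) 0≤p) (0≤* (nn 6ℚ) 0≤p²)) (nn 24ℚ)))
          (solve 2 (λ p β → let p² = p :* p ; p³ = p :* (p :* p) ; ν = p :+ con 2ℚ :* β ; β′ = con 1ℚ :+ β in
            (con 12ℚ :* p :+ con 6ℚ :* p² :+ p³ :+ con 20ℚ) :* (β′ :* β′)
              :- (ν :* (ν :* (ν :* con 1ℚ)) :- con 2ℚ :* con 2ℚ :* (con 1ℚ :+ con 2ℚ :* β) :* (β′ :* β′)) :=
            (con 40ℚ :+ con 6ℚ :* p² :+ p³) :* (β :* β) :+ (con 24ℚ :* p :+ con 6ℚ :* p² :+ con 2ℚ :* p³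
              :+ con 56ℚ) :* β :+ (con 12ℚ :* p :+ con 6ℚ :* p² :+ con 24ℚ)) refl p β))
        (≤-by ((24ℚ * p + 6ℚ * (p * p) + p * (p * p)) * (β * β) + (24ℚ * p + 18ℚ * (p * p) + 2ℚ * (p * (p * p)) + 24ℚ) * β + (12ℚ * p + 6ℚ * (p * p) + 2ℚ * (p * (p * p)) + 16ℚ))
          (0≤+ (0≤+ (0≤* (0≤+ (0≤+ (0≤* (nn 24ℚ) 0≤p) (0≤* (nn 6ℚ) 0≤p²)) 0≤p³) 0≤β²)
                    (0≤* (0≤+ (0≤+ (0≤+ (0≤* (nn 24ℚ) 0≤p) (0≤* (nn 18ℚ) 0≤p²)) (0≤* (nn 2ℚ) 0≤p³)) (nn 24ℚ)) 0≤β))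
               (0≤+ (0≤+ (0≤+ (0≤* (nn 12ℚ) 0≤p) (0≤* (nn 6ℚ) 0≤p²)) (0≤* (nn 2ℚ) 0≤p³)) (nn 16ℚ)))
          (solve 2 (λ p β → let p² = p :* p ; p³ = p :* (p :* p) ; ν = p :+ con 2ℚ :* β ; β′ = con 1ℚ :+ β in
            (con 12ℚ :* p :+ con 6ℚ :* p² :+ p³ :+ con 20ℚ) :* (β′ :* β′)
              :- :- (ν :* (ν :* (ν :* con 1ℚ)) :- con 2ℚ :* con 2ℚ :* (con 1ℚ :+ con 2ℚ :* β) :* (β′ :* β′)) :=
            (con 24ℚ :* p :+ con 6ℚ :* p² :+ p³) :* (β :* β) :+ (con 24ℚ :* p :+ con 18ℚ :* p² :+ con 2ℚ :* p³
              :+ con 24ℚ) :* β :+ (con 12ℚ :* p :+ con 6ℚ :* p² :+ con 2ℚ :* p³ :+ con 16ℚ)) refl p β)))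
      where
      β = fromNat b
      0≤β = 0≤fromNat b
      0≤β² = 0≤* 0≤β 0≤β
      16ℚ = 4ℚ * 4ℚ
      18ℚ = 16ℚ + 2ℚ
      24ℚ = 12ℚ * 2ℚ
      40ℚ = 20ℚ * 2ℚ
      56ℚ = 40ℚ + 16ℚ
      ν≡ : fromNat (q ℕ.+ suc (2 ℕ.* b)) ≡ p + 2ℚ * β
      ν≡ = trans (cong fromNat (ℕ.+-suc q (2 ℕ.* b)))
        (trans (fromNat-+ (suc q) (2 ℕ.* b)) (cong (p +_) (fromNat-* 2 b)))

  wallis-small : ∀ δ → 0ℚ < δ → ∃[ N ] ∀ b → N ℕ.≤ b → wallis b ≤ δ
  wallis-small δ 0<δ = proj₁ arch , λ b le → square-cancel-≤ (ℚ.<⇒≤ 0<δ) (*-cancelˡ-≤ (0<odd b) (begin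
    (1ℚ + 2ℚ * fromNat b) * (wallis b * wallis b)
      ≤⟨ wallis-bound b ⟩
    1ℚ
      ≤⟨ proj₂ arch b le ⟩
    δ * δ * fromNat b
      ≤⟨ ≤-by ((1ℚ + fromNat b) * (δ * δ)) (0≤* (0≤1+ b) (0≤square δ))
           (solve 2 (λ d b → (con 1ℚ :+ con 2ℚ :* b) :* (d :* d) :- d :* d :* b
             := (con 1ℚ :+ b) :* (d :* d)) refl δ (fromNat b)) ⟩
    (1ℚ + 2ℚ * fromNat b) * (δ * δ) ∎))
    where
    open ℚ.≤-Reasoning
    arch = archimedes-* 0≤1 (*-pos 0<δ 0<δ)

  -- Three estimates are multiplied: f² ~ r t², n³ ~ 4O(b+1)² and 2Ow² `leibniz 0 m` ~ 1. Since
  -- (b+1)t = w, the first two leading terms have product 2Ow² · 2r, and the common factor C = 2Ow²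
  -- is cancelled.
  lim-asymptotic : ∀ {f r} q → 0ℚ < r → Lim f r → ∀ η → 0ℚ < η → ∃[ N ] ∀ b → N ℕ.≤ b → ∃[ M ] ∀ m → M ℕ.≤ m →
    ∣ f b * f b * cube (fromNat (q ℕ.+ suc (2 ℕ.* b))) * leibniz 0 m - 2ℚ * r ∣ ≤ η * (2ℚ * r)
  lim-asymptotic {f} {r} q 0<r l η 0<η = N₁ ℕ.⊔ (N₂ ℕ.⊔ N₃) , λ b le →
    bound b (h₁ b (ℕ.m⊔n≤o⇒m≤o N₁ _ le)) (h₂ b (ℕ.m⊔n≤o⇒m≤o N₂ N₃ (ℕ.m⊔n≤o⇒n≤o N₁ _ le)))
      (h₃ b (ℕ.m⊔n≤o⇒n≤o N₂ N₃ (ℕ.m⊔n≤o⇒n≤o N₁ _ le)))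
    where
    -- Two uses of `close-*` with all errors ε: first 2ε + ε, then 2(3ε) + ε = 7ε.
    7ℚ = 1ℚ + 2ℚ + (2ℚ + 2ℚ)
    frac = fraction (ℚ.nonNegative⁻¹ 7ℚ) 0<η
    ε = proj₁ frac
    0<ε = proj₁ (proj₂ frac)
    ε≤1 = proj₁ (proj₂ (proj₂ frac))
    ε7≤η = proj₂ (proj₂ (proj₂ frac))
    0<½ε = *-pos 0<½ 0<ε
    sq = lim-square l (ε * r) (*-pos 0<ε 0<r)
    N₁ = proj₁ sq
    h₁ = proj₂ sq
    cb = cube-close q ε 0<ε
    N₂ = proj₁ cb
    h₂ = proj₂ cb
    ws = wallis-small (½ * ε) 0<½ε
    N₃ = proj₁ ws
    h₃ = proj₂ ws
    open ℚ.≤-Reasoning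
    bound : ∀ b → let O = 1ℚ + 2ℚ * fromNat b ; E = 2ℚ * 2ℚ * O * (1+ b * 1+ b) ; t = catalan b in
      ∣ f b * f b - r * (t * t) ∣ ≤ ε * r * (t * t) →
      ∣ cube (fromNat (q ℕ.+ suc (2 ℕ.* b))) - E ∣ ≤ ε * E → wallis b ≤ ½ * ε →
      ∃[ M ] ∀ m → M ℕ.≤ m → ∣ f b * f b * cube (fromNat (q ℕ.+ suc (2 ℕ.* b))) * leibniz 0 m - 2ℚ * r ∣ ≤ η * (2ℚ * r)
    bound b k₁ k₂ k₃ = proj₁ wl , λ m le → *-cancelˡ-≤ 0<C (begin
      C * ∣ F * ν³ * leibniz 0 m - 2ℚ * r ∣
        ≡⟨ sym (∣*∣ˡ (F * ν³ * leibniz 0 m - 2ℚ * r) (ℚ.<⇒≤ 0<C)) ⟩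
      ∣ C * (F * ν³ * leibniz 0 m - 2ℚ * r) ∣
        ≡⟨ cong ∣_∣ (linear₁ (2ℚ * (2ℚ * (r * O)) * (1+ b * t + wallis b)) (1+*catalan b)
             (solve 8 (λ o w f n l r m t →
               con 2ℚ :* o :* (w :* w) :* (f :* n :* l :- con 2ℚ :* r)
                 :- (f :* n :* (con 2ℚ :* o :* (w :* w) :* l)
                   :- r :* (t :* t) :* (con 2ℚ :* con 2ℚ :* o :* (m :* m)) :* con 1ℚ) :=
               con 2ℚ :* (con 2ℚ :* (r :* o)) :* (m :* t :+ w) :* (m :* t :- w)) refl
               O (wallis b) F ν³ (leibniz 0 m) r (1+ b) t)) ⟩
      ∣ F * ν³ * (C * leibniz 0 m) - r * (t * t) * E * 1ℚ ∣
        ≤⟨ close-* {x = F * ν³} {y = C * leibniz 0 m} (0≤* 0≤rtt 0≤E) 0≤1 (0≤+ (0≤+ 0≤ε 0≤ε) 0≤ε) ε≤1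
             (close-* {x = F} {y = ν³} 0≤rtt 0≤E 0≤ε ε≤1 (ℚ.≤-trans k₁ (ℚ.≤-reflexive (ℚ.*-assoc ε r (t * t)))) k₂)
             (ℚ.≤-trans (proj₂ wl m le) (ℚ.≤-trans (ℚ.+-monoˡ-≤ (½ * ε) k₃) (ℚ.≤-reflexive
               (trans (½+½ ε) (sym (ℚ.*-identityʳ ε)))))) ⟩
      (ε + ε + ε + (ε + ε + ε) + ε) * (r * (t * t) * E * 1ℚ)
        ≡⟨ linear₁ (ε * 7ℚ * (2ℚ * (2ℚ * (r * O)) * (1+ b * t + wallis b))) (1+*catalan b)
             (solve 6 (λ o w e r m t →
               (e :+ e :+ e :+ (e :+ e :+ e) :+ e) :* (r :* (t :* t) :* (con 2ℚ :* con 2ℚ :* o :* (m :* m)) :* con 1ℚ)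
                 :- e :* con 7ℚ :* (con 2ℚ :* o :* (w :* w) :* (con 2ℚ :* r)) :=
               e :* con 7ℚ :* (con 2ℚ :* (con 2ℚ :* (r :* o)) :* (m :* t :+ w)) :* (m :* t :- w)) refl
               O (wallis b) ε r (1+ b) t) ⟩
      ε * 7ℚ * (C * (2ℚ * r))
        ≤⟨ *-monoʳ (0≤* (ℚ.<⇒≤ 0<C) (ℚ.<⇒≤ (*-pos 0<2ℚ 0<r))) ε7≤η ⟩
      η * (C * (2ℚ * r))
        ≡⟨ solve 3 (λ e c r → e :* (c :* r) := c :* (e :* r)) refl η C (2ℚ * r) ⟩
      C * (η * (2ℚ * r)) ∎)
      where
      O = 1ℚ + 2ℚ * fromNat b
      C = 2ℚ * O * (wallis b * wallis b)
      0<C : 0ℚ < C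
      0<C = *-pos (*-pos 0<2ℚ (0<odd b)) (*-pos (wallis-positive b) (wallis-positive b))
      F = f b * f b
      ν³ = cube (fromNat (q ℕ.+ suc (2 ℕ.* b)))
      t = catalan b
      E = 2ℚ * 2ℚ * O * (1+ b * 1+ b)
      0≤ε = ℚ.<⇒≤ 0<ε
      0≤rtt : 0ℚ ≤ r * (t * t)
      0≤rtt = 0≤* (ℚ.<⇒≤ 0<r) (0≤square t)
      0≤E : 0ℚ ≤ E
      0≤E = 0≤* (0≤* (ℚ.<⇒≤ (*-pos 0<2ℚ 0<2ℚ)) (ℚ.<⇒≤ (0<odd b))) (0≤square (1+ b))
      wl = wallis-leibniz b (½ * ε) 0<½ε

  -- Sequences with difference tending to zero, and squares of reals

  infix 4 _≃_

  record _≃_ (f g : ℕ → ℚ) : Set where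
    constructor null
    field
      close : ∀ ε → 0ℚ < ε → ∃[ M ] ∀ m → M ℕ.≤ m → ∣ f m - g m ∣ ≤ ε

  open _≃_

  ≡⇒≃ : ∀ {f g} N → (∀ m → N ℕ.≤ m → f m ≡ g m) → f ≃ g
  ≡⇒≃ {f} {g} N h .close ε 0<ε = N , λ m le → subst (λ z → ∣ f m - z ∣ ≤ ε) (h m le)
    (subst (λ z → ∣ z ∣ ≤ ε) (sym (ℚ.+-inverseʳ (f m))) (ℚ.<⇒≤ 0<ε))

  ≃-trans : ∀ {f g h} → f ≃ g → g ≃ h → f ≃ h
  ≃-trans {f} {g} {h} p q .close ε 0<ε =
    let N , hp = close p (½ * ε) (*-pos 0<½ 0<ε) ; M , hq = close q (½ * ε) (*-pos 0<½ 0<ε) in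
    N ℕ.⊔ M , λ m le → subst₂ _≤_
      (cong ∣_∣ (solve 3 (λ a b c → (a :- b) :+ (b :- c) := a :- c) refl (f m) (g m) (h m))) (½+½ ε)
      (∣+∣≤ (hp m (ℕ.m⊔n≤o⇒m≤o N M le)) (hq m (ℕ.m⊔n≤o⇒n≤o N M le)))

  ≃-* : ∀ {f f′ g g′} → Cauchy f → Cauchy g′ → f ≃ f′ → g ≃ g′ → (λ m → f m * g m) ≃ (λ m → f′ m * g′ m)
  ≃-* {f} {f′} {g} {g′} cf cg′ p q .close ε 0<ε =
    let A , 0<A , N₁ , hA = bounded {f} cf
        B , 0<B , N₂ , hB = bounded {g′} cg′
        0<A+B = ℚ.+-mono-< 0<A 0<B
        0<η = *-pos 0<ε (recip-pos 0<A+B)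
        N₃ , hp = close p (ε * recip (A + B)) 0<η
        N₄ , hq = close q (ε * recip (A + B)) 0<η
    in (N₁ ℕ.⊔ N₂) ℕ.⊔ (N₃ ℕ.⊔ N₄) , λ m le →
      let l₁ = ℕ.m⊔n≤o⇒m≤o (N₁ ℕ.⊔ N₂) (N₃ ℕ.⊔ N₄) le ; l₂ = ℕ.m⊔n≤o⇒n≤o (N₁ ℕ.⊔ N₂) (N₃ ℕ.⊔ N₄) le in
      subst (∣ f m * g m - f′ m * g′ m ∣ ≤_) (cancel-recip 0<A+B ε)
        (*-close (f m) (g m) (f′ m) (g′ m) (hA m (ℕ.m⊔n≤o⇒m≤o N₁ N₂ l₁)) (hB m (ℕ.m⊔n≤o⇒n≤o N₁ N₂ l₁))
          (hp m (ℕ.m⊔n≤o⇒m≤o N₃ N₄ l₂)) (hq m (ℕ.m⊔n≤o⇒n≤o N₃ N₄ l₂)))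

  ≃-^ : ∀ {f c} n → Cauchy f → f ≃ (λ _ → c) → (λ m → f m ^ℚ n) ≃ (λ _ → c ^ℚ n)
  ≃-^         zero    cf p = ≡⇒≃ 0 (λ _ _ → refl)
  ≃-^ {f} {c} (suc n) cf p = ≃-* {f} {λ _ → c} cf (const-cauchy (c ^ℚ n)) p (≃-^ n cf p)

  -- `sqrtApprox` rounds down with error below u = 1/(m+1), so its square misses p by at most (2s +
  -- u)u, and s is bounded.
  √² : ∀ (x : ℝ) → Positive x → (λ m → approx (D.√ x) m * approx (D.√ x) m) ≃ approx x
  √² x px .close ε 0<ε =
    let δ , 0<δ , N , δ≤x = positive px
        B , 0<B , N′ , hB = bounded {approx (D.√ x)} (cauchy (D.√ x))
        0<K = ℚ.+-mono-< (ℚ.+-mono-< 0<B 0<B) 0<1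
        M , small = archimedes (*-pos 0<ε (recip-pos 0<K))
    in N ℕ.⊔ (N′ ℕ.⊔ M) , λ m le →
      let l₁ = ℕ.m⊔n≤o⇒m≤o N (N′ ℕ.⊔ M) le ; l₂ = ℕ.m⊔n≤o⇒n≤o N (N′ ℕ.⊔ M) le
          p = approx x m ; s = sqrtApprox m p ; u = 1/1+ m
          0≤p = ℚ.≤-trans (ℚ.<⇒≤ 0<δ) (δ≤x m l₁)
          0≤s = 0≤sqrtApprox m p
          s≤B = ∣∣-≤ (hB m (ℕ.m⊔n≤o⇒m≤o N′ M l₂))
          u≤1 = 1/1+-antimono {0} {m} ℕ.z≤n
      in subst (_≤ ε) (Defs.Lemmas.∣-∣-sym p (s * s))
        (subst (_≤ ε) (sym (ℚ.0≤p⇒∣p∣≡p (≤⇒0≤- (lower m p 0≤p)))) (begin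
        p - s * s
          ≤⟨ ℚ.+-monoˡ-≤ (- (s * s)) (ℚ.<⇒≤ (sqrtApprox-upper m p)) ⟩
        (s + u) * (s + u) - s * s
          ≡⟨ solve 2 (λ s u → (s :+ u) :* (s :+ u) :- s :* s := (s :+ s :+ u) :* u) refl s u ⟩
        (s + s + u) * u
          ≤⟨ *-mono (0≤+ (0≤+ 0≤s 0≤s) (0≤1/1+ m)) (0≤1/1+ m) (ℚ.+-mono-≤ (ℚ.+-mono-≤ s≤B s≤B) u≤1)
               (small m (ℕ.m⊔n≤o⇒n≤o N′ M l₂)) ⟩
        (B + B + 1ℚ) * (ε * recip (B + B + 1ℚ)) ≡⟨ cancel-recip 0<K ε ⟩
        ε ∎))
    where
    open ℚ.≤-Reasoning
    lower : ∀ m p → 0ℚ ≤ p → sqrtApprox m p * sqrtApprox m p ≤ p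
    lower m p 0≤p with ℚ.<-cmp 0ℚ (sqrtApprox m p)
    ... | tri< 0<s _ _ = sqrtApprox-lower m p 0<s
    ... | tri≈ _ 0≡s _ = subst (λ s → s * s ≤ p) 0≡s 0≤p
    ... | tri> _ _ s<0 = ⊥-elim (ℚ.<-irrefl refl (ℚ.<-≤-trans s<0 (0≤sqrtApprox m p)))

  -- Closeness of squares suffices, by |a - G| G ≤ |a² - G²|.

  compare : ∀ {a G Z V η ε} → 0ℚ ≤ a → 0ℚ ≤ G → 0ℚ < Z → 0ℚ < V → η ≤ ½ → η * (2ℚ * 2ℚ) ≤ ε →
            ∣ a * a * Z - V ∣ ≤ η * V → ∣ G * G * Z - V ∣ ≤ η * V → ∣ a - G ∣ ≤ ε * G
  compare {a} {G} {Z} {V} {η} {ε} 0≤a 0≤G 0<Z 0<V η≤½ 4η≤ε ha hG = *-cancelˡ-≤ 0<G (*-cancelˡ-≤ 0<Z (begin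
    Z * (G * ∣ a - G ∣)
      ≤⟨ *-monoˡ 0≤Z (*-monoʳ {∣ a - G ∣} {G} {a + G} (ℚ.0≤∣p∣ (a - G)) (≤-by a 0≤a (solve 2 (λ a g → (a :+ g) :- g
        := a) refl a G))) ⟩
    Z * ((a + G) * ∣ a - G ∣)
      ≡⟨ cong (Z *_) (sym (∣*∣ˡ (a - G) (0≤+ 0≤a 0≤G))) ⟩
    Z * ∣ (a + G) * (a - G) ∣
      ≡⟨ sym (∣*∣ˡ ((a + G) * (a - G)) 0≤Z) ⟩
    ∣ Z * ((a + G) * (a - G)) ∣
      ≡⟨ cong ∣_∣ (solve 4 (λ z a g v → z :* ((a :+ g) :* (a :- g))
        := (a :* a :* z :- v) :+ :- (g :* g :* z :- v)) refl Z a G V) ⟩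
    ∣ (a * a * Z - V) + - (G * G * Z - V) ∣
      ≤⟨ ∣+∣≤ ha (ℚ.≤-trans (ℚ.≤-reflexive (ℚ.∣-p∣≡∣p∣ (G * G * Z - V))) hG) ⟩
    η * V + η * V
      ≡⟨ solve 2 (λ e v → e :* v :+ e :* v := e :* (v :+ v)) refl η V ⟩
    η * (V + V)
      ≤⟨ *-monoˡ 0≤η V+V≤ ⟩
    η * (2ℚ * 2ℚ * (G * G * Z))
      ≡⟨ solve 3 (λ e k x → e :* (k :* x) := (e :* k) :* x) refl η (2ℚ * 2ℚ) (G * G * Z) ⟩
    η * (2ℚ * 2ℚ) * (G * G * Z)
      ≤⟨ *-monoʳ (0≤* (0≤* 0≤G 0≤G) 0≤Z) 4η≤ε ⟩
    ε * (G * G * Z)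
      ≡⟨ solve 3 (λ e g z → e :* (g :* g :* z) := z :* (g :* (e :* g))) refl ε G Z ⟩
    Z * (G * (ε * G)) ∎))
    where
    open ℚ.≤-Reasoning
    0≤Z = ℚ.<⇒≤ 0<Z
    0≤V = ℚ.<⇒≤ 0<V
    0≤η : 0ℚ ≤ η
    0≤η = 0≤-cancel 0<V (ℚ.≤-trans (ℚ.0≤∣p∣ (a * a * Z - V)) (ℚ.≤-trans ha (ℚ.≤-reflexive (ℚ.*-comm η V))))
    -- η ≤ ½ keeps G²Z above V/2. This yields both 0 < G and the factor 4 between η and ε.
    ½V≤ : ½ * V ≤ G * G * Z
    ½V≤ = ≤-by ((½ * V - η * V) + ((G * G * Z - V) - - (η * V))) (0≤+ (≤⇒0≤- (*-monoʳ 0≤V η≤½)) (≤⇒0≤- (∣∣-≥ hG)))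
      (solve 3 (λ x v e → x :- con ½ :* v := (con ½ :* v :- e) :+ ((x :- v) :- :- e)) refl (G * G * Z) V (η * V))
    V+V≤ : V + V ≤ 2ℚ * 2ℚ * (G * G * Z)
    V+V≤ = ℚ.≤-trans (ℚ.≤-reflexive (solve 1 (λ v → v :+ v := con 2ℚ :* con 2ℚ :* (con ½ :* v)) refl V))
      (*-monoˡ (ℚ.nonNegative⁻¹ (2ℚ * 2ℚ)) ½V≤)
    0<G : 0ℚ < G
    0<G with ℚ.<-cmp 0ℚ G
    ... | tri< h _ _ = h
    ... | tri≈ _ e _ = ⊥-elim (ℚ.<-irrefl refl (ℚ.<-≤-trans (*-pos 0<½ 0<V) (ℚ.≤-trans ½V≤
      (ℚ.≤-reflexive (trans (cong (λ g → g * g * Z) (sym e)) (ℚ.*-zeroˡ Z))))))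
    ... | tri> _ _ h = ⊥-elim (ℚ.<-irrefl refl (ℚ.<-≤-trans h 0≤G))

  ≃-sym : ∀ {f g} → f ≃ g → g ≃ f
  ≃-sym {f} {g} p .close ε 0<ε = let M , h = close p ε 0<ε in M , λ m le → subst (_≤ ε) (Defs.Lemmas.∣-∣-sym (f m) (g m)) (h m le)

  product² : ∀ {x y : ℝ} {f g} → Cauchy g
    → (λ m → approx x m * approx x m) ≃ f → (λ m → approx y m * approx y m) ≃ g →
             (λ m → approx (x D.* y) m * approx (x D.* y) m) ≃ (λ m → f m * g m)
  product² {x} {y} cg hx hy = ≃-trans
    (≡⇒≃ 0 (λ m _ → solve 2 (λ x y → x :* y :* (x :* y) := x :* x :* (y :* y)) refl (approx x m) (approx y m)))
    (≃-* (cauchy (x D.* x)) cg hx hy)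

  power² : ∀ {x : ℝ} {c} n → (λ m → approx x m * approx x m) ≃ (λ _ → c) →
           (λ m → approx (x D.^ n) m * approx (x D.^ n) m) ≃ (λ _ → c ^ℚ n)
  power² {x} n h = ≃-trans (≡⇒≃ 0 (λ m _ → sym (^-* (approx x m) (approx x m) n))) (≃-^ n (cauchy (x D.* x)) h)

  constant² : ∀ {x : ℝ} {c} → approx x ≃ (λ _ → c) → (λ m → approx x m * approx x m) ≃ (λ _ → c * c)
  constant² {x} {c} h = ≃-* (cauchy x) (const-cauchy c) h h

  -- The reals are kept abstract here, since the approximations of a
  -- concrete square root unfold to large terms.

  module Quotient (u s f t w : ℝ) (n : ℕ) (d+ : Positive (u D.* f D.* t)) {U S F W : ℚ} {T : ℕ → ℚ} (cT : Cauchy T)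
    (u² : (λ m → approx u m * approx u m) ≃ (λ _ → U)) (s² : (λ m → approx s m * approx s m) ≃ (λ _ → S))
    (f² : (λ m → approx f m * approx f m) ≃ (λ _ → F)) (t² : (λ m → approx t m * approx t m) ≃ T)
    (w² : (λ m → approx w m * approx w m) ≃ (λ _ → W)) (0≤s : ∀ m → 0ℚ ≤ approx s m) (0≤w : ∀ m → 0ℚ ≤ approx w m) where

    d g : ℝ
    d = u D.* f D.* t
    g = D._/_ s (u D.* f D.* t) {{d+}} D.* w D.^ n

    Y : ℕ → ℚ
    Y m = U * F * T m

    V : ℚ
    V = S * W ^ℚ n

    d² : (λ m → approx d m * approx d m) ≃ Y
    d² = product² {u D.* f} {t} cT (product² {u} {f} (const-cauchy F) u² f²) t²

    numerator : ℝ
    numerator = s D.* w D.^ n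

    numerator² : (λ m → approx numerator m * approx numerator m) ≃ (λ _ → V)
    numerator² = product² {s} {w D.^ n} (const-cauchy (W ^ℚ n)) s² (power² {w} n w²)

    g*d : ∃[ N ] ∀ m → N ℕ.≤ m → approx g m * approx d m ≡ approx numerator m
    g*d = let δ , 0<δ , N , h = positive d+ in N , λ m le → trans
      (solve 4 (λ s r b d → s :* r :* b :* d
        := s :* b :* (d :* r)) refl (approx s m) (recip (approx d m)) (approx w m ^ℚ n) (approx d m))
      (trans (cong (approx numerator m *_) (recip-inverse (ℚ.<-≤-trans 0<δ (h m le))))
        (ℚ.*-identityʳ (approx numerator m)))

    g² : (λ m → approx g m * approx g m * Y m) ≃ (λ _ → V)
    g² = ≃-trans
      (≃-* {λ m → approx g m * approx g m} {λ m → approx g m * approx g m} {Y} {λ m → approx d m * approx d m}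
        (cauchy (g D.* g)) (cauchy (d D.* d)) (≡⇒≃ 0 (λ _ _ → refl)) (≃-sym d²))
      (≃-trans (≡⇒≃ (proj₁ g*d) (λ m le → trans
          (solve 2 (λ g d → g :* g :* (d :* d) := g :* d :* (g :* d)) refl (approx g m) (approx d m))
          (cong (λ z → z * z) (proj₂ g*d m le))))
        numerator²)

    0≤g : ∃[ N ] ∀ m → N ℕ.≤ m → 0ℚ ≤ approx g m
    0≤g = let δ , 0<δ , N , h = positive d+ in N , λ m le →
      0≤* (0≤* (0≤s m) (ℚ.<⇒≤ (recip-pos (ℚ.<-≤-trans 0<δ (h m le))))) (0≤^ n (0≤w m))

    g-asymptotic : ∀ {a ε} η → (∃[ N ] ∀ m → N ℕ.≤ m → 0ℚ < Y m) → 0ℚ < V → 0ℚ ≤ a → 0ℚ < η → η ≤ ½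
      → η * (2ℚ * 2ℚ) ≤ ε →
      (∃[ M ] ∀ m → M ℕ.≤ m → ∣ a * a * Y m - V ∣ ≤ η * V) → ∃[ M ] ∀ m → M ℕ.≤ m
        → ∣ a - approx g m ∣ ≤ ε * ∣ approx g m ∣
    g-asymptotic {a} {ε} η (M₃ , 0<Z) 0<V 0≤a 0<η η≤½ 4η≤ε (M , ha) =
      let M₁ , hG = close g² (η * V) (*-pos 0<η 0<V) ; M₂ , 0≤G = 0≤g in
      M ℕ.⊔ (M₁ ℕ.⊔ (M₂ ℕ.⊔ M₃)) , λ m le →
        let l₁ = ℕ.m⊔n≤o⇒n≤o M (M₁ ℕ.⊔ (M₂ ℕ.⊔ M₃)) le ; l₂ = ℕ.m⊔n≤o⇒n≤o M₁ (M₂ ℕ.⊔ M₃) l₁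
            0≤Gm = 0≤G m (ℕ.m⊔n≤o⇒m≤o M₂ M₃ l₂)
        in subst (λ z → ∣ a - approx g m ∣ ≤ ε * z) (sym (ℚ.0≤p⇒∣p∣≡p 0≤Gm))
          (compare 0≤a 0≤Gm (0<Z m (ℕ.m⊔n≤o⇒n≤o M₂ M₃ l₂)) 0<V η≤½ 4η≤ε
            (ha m (ℕ.m⊔n≤o⇒m≤o M (M₁ ℕ.⊔ (M₂ ℕ.⊔ M₃)) le)) (hG m (ℕ.m⊔n≤o⇒m≤o M₁ (M₂ ℕ.⊔ M₃) l₁)))

-- Comparison of the count with the claimed equivalent

module ClosedTermAsymptotics where

  open import Data.Nat using (_!; NonZero)
  open import Data.Rational using (ℚ; 0ℚ; ½; _+_; _*_; _-_; -_; ∣_∣; _≤_; _<_)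
  open import Function using (it)
  open import Defs using (ℝ; approx; cauchy; Positive; recip; leibniz; fromℕ; fromℕ-positive; *-positive;
    √-positive; ^-positive; π/4-positive; π)
  open Defs.Lemmas using (*-pos; 0<1; 0<½; recip-inverse; recip-pos; 0≤sqrtApprox; const-cauchy;
    leibniz-positive)
  open import Algebra.Definitions.RawSemiring ℚ.+-*-rawSemiring using () renaming (_^_ to _^ℚ_)
  open ℚ.+-*-Solver using (solve; _:=_; _:*_; _:-_; :-_; con)
  open RationalLemmas
  open Counting using (count; closedCount; closedCount-odd; odd-offset)
  open Wallis
  open GeneratingFunctions hiding (module S)
  open Convolution
  open Limits
  open Reals

  fromℕ≃ : ∀ m → approx (fromℕ m) ≃ (λ _ → fromNat m)
  fromℕ≃ m = ≡⇒≃ 0 (λ _ _ → sym (fromNat≡/1 m))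

  √fromℕ² : ∀ m .{{_ : NonZero m}} → (λ i → approx (D.√ fromℕ m) i * approx (D.√ fromℕ m) i) ≃ (λ _ → fromNat m)
  √fromℕ² m = ≃-trans (√² (fromℕ m) fromℕ-positive) (fromℕ≃ m)

  0≤√ : ∀ x i → 0ℚ ≤ approx (D.√ x) i
  0≤√ x i = 0≤sqrtApprox i (approx x i)

  0<^ : ∀ {x} k → 0ℚ < x → 0ℚ < x ^ℚ k
  0<^ zero    h = 0<1
  0<^ (suc k) h = *-pos h (0<^ k h)

  0<NonZero : ∀ m → .{{_ : NonZero m}} → 0ℚ < fromNat m
  0<NonZero (suc m) = 0<fromNat m

  0<4 : 0ℚ < fromNat 2 * fromNat 2
  0<4 = *-pos (0<fromNat 1) (0<fromNat 1)

  -- rationalV / rationalY tends, as m → ∞, to the square of the claimed equivalent.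

  rationalY : ℕ → ℚ → ℕ → ℕ → ℚ
  rationalY q F n m = (fromNat 2 * fromNat 2) ^ℚ q * F * (fromNat 4 * leibniz 0 m * cube (fromNat n))

  rationalV : ℕ → ℕ → ℚ
  rationalV q n = fromNat 2 * (fromNat 2 * fromNat 2 * fromNat q) ^ℚ n

  module Target (p n : ℕ) .{{_ : NonZero n}} where

    q = suc p

    instance
      p!≢0 : NonZero (p !)
      p!≢0 = p ℕ.!≢0

    base : ℝ
    base = fromℕ 2 D.* D.√ fromℕ q

    base² : (λ i → approx base i * approx base i) ≃ (λ _ → fromNat 2 * fromNat 2 * fromNat q)
    base² = product² {fromℕ 2} {D.√ fromℕ q} (const-cauchy (fromNat q)) (constant² {fromℕ 2} (fromℕ≃ 2)) (√fromℕ² q)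

    0≤base : ∀ i → 0ℚ ≤ approx base i
    0≤base i = 0≤* (subst (0ℚ ≤_) (fromNat≡/1 2) (0≤fromNat 2)) (0≤√ (fromℕ q) i)

    power : (λ i → approx (fromℕ 2 D.^ q) i * approx (fromℕ 2 D.^ q) i) ≃ (λ _ → (fromNat 2 * fromNat 2) ^ℚ q)
    power = power² {fromℕ 2} q (constant² {fromℕ 2} (fromℕ≃ 2))

    d+ : Positive (fromℕ 2 D.^ q D.* D.√ fromℕ (p !) D.* D.√ (π D.* fromℕ n D.^ 3))
    d+ = it

    open Quotient (fromℕ 2 D.^ q) (D.√ fromℕ 2) (D.√ fromℕ (p !)) (D.√ (π D.* fromℕ n D.^ 3)) base n d+
      (cauchy (π D.* fromℕ n D.^ 3)) power (√fromℕ² 2) (√fromℕ² (p !)) (√² (π D.* fromℕ n D.^ 3) it) base²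
      (0≤√ (fromℕ 2)) 0≤base public

    0<V : 0ℚ < V
    0<V = *-pos (0<fromNat 1) (0<^ n (*-pos 0<4 (0<fromNat p)))

    Y≡ : ∀ m → Y m ≡ rationalY q (fromNat (p !)) n m
    Y≡ m = cong₂ (λ c ν → (fromNat 2 * fromNat 2) ^ℚ q * fromNat (p !) * (c * leibniz 0 m * cube ν))
      (sym (fromNat≡/1 4)) (sym (fromNat≡/1 n))

    0<Y : ∃[ N ] ∀ m → N ℕ.≤ m → 0ℚ < Y m
    0<Y = let δ , 0<δ , N , h = leibniz-positive in N , λ m le → subst (0ℚ <_) (sym (Y≡ m))
      (*-pos (*-pos (0<^ q 0<4) (0<NonZero (p !))) (*-pos (*-pos (0<fromNat 3)
        (ℚ.<-≤-trans 0<δ (h m le))) (0<^ 3 (0<NonZero n))))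

    target-asymptotic : ∀ {a ε} η → 0ℚ ≤ a → 0ℚ < η → η ≤ ½ → η * (2ℚ * 2ℚ) ≤ ε →
      (∃[ M ] ∀ m → M ℕ.≤ m → ∣ a * a * rationalY q (fromNat (p !)) n m - rationalV q n ∣ ≤ η * rationalV q n) →
      ∃[ M ] ∀ m → M ℕ.≤ m → ∣ a - approx g m ∣ ≤ ε * ∣ approx g m ∣
    target-asymptotic {a} {ε} η 0≤a 0<η η≤½ 4η≤ε (M , h) = g-asymptotic {a} {ε} η 0<Y 0<V 0≤a 0<η η≤½ 4η≤ε
      (M , λ m le → subst (λ y → ∣ a * a * y - V ∣ ≤ η * V) (sym (Y≡ m)) (h m le))

  power-split : ∀ c x q b → (c * x) ^ℚ (q ℕ.+ suc (2 ℕ.* b)) ≡ c ^ℚ q * x ^ℚ q * (c * x * ((c * x) ^ℚ b * (c * x) ^ℚ b))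
  power-split c x q b = trans (^-+ (c * x) q (suc (2 ℕ.* b))) (cong₂ (λ y z → y * (c * x * z)) (^-* c x q)
    (trans (^-+ (c * x) b (b ℕ.+ 0)) (cong (λ k → (c * x) ^ℚ b * (c * x) ^ℚ k) (ℕ.+-identityʳ b))))

  -- The constants meet here: with c = 4, u = 4^q, x = q^q, P = (4q)^b and f = (q-1)!, the left side
  -- is 2(4q)^n for n = q+1+2b, and r (q-1)! = q · q^q gives the right side.
  scaling : ∀ {t c d u x q P f r} → d ≡ c → t ≡ 2ℚ → r * f ≡ q * x →
    t * (u * x * (c * q * (P * P))) ≡ u * f * d * (P * P) * (2ℚ * r)
  scaling {c = c} {u = u} {x} {q} {P} {f} {r} refl refl h = linear₁ (- (2ℚ * c * u * (P * P))) h
    (solve 7 (λ c u x q P f r → con 2ℚ :* (u :* x :* (c :* q :* (P :* P)))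
      :- u :* f :* c :* (P :* P) :* (con 2ℚ :* r) :=
      :- (con 2ℚ :* c :* u :* (P :* P)) :* (r :* f :- q :* x)) refl c u x q P f r)

  -- Multiplying by κ = U F c P² undoes the scaling of the coefficients and brings in the
  -- denominator of the claimed equivalent; a relative error is unaffected.
  transfer : ∀ {a f P U F c l ν r η Y V} → a ≡ f * P → Y ≡ U * F * (c * l * ν)
    → V ≡ U * F * c * (P * P) * (2ℚ * r) →
    0ℚ ≤ U * F * c → ∣ f * f * ν * l - 2ℚ * r ∣ ≤ η * (2ℚ * r) → ∣ a * a * Y - V ∣ ≤ η * V
  transfer {f = f} {P} {U} {F} {c} {l} {ν} {r} {η} refl refl refl 0≤UFc h = begin
    ∣ f * P * (f * P) * (U * F * (c * l * ν)) - κ * (2ℚ * r) ∣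
      ≡⟨ cong ∣_∣ (solve 8 (λ f p u F c l ν r → f :* p :* (f :* p) :* (u :* F :* (c :* l :* ν))
        :- u :* F :* c :* (p :* p) :* (con 2ℚ :* r) :=
           u :* F :* c :* (p :* p) :* (f :* f :* ν :* l :- con 2ℚ :* r)) refl f P U F c l ν r) ⟩
    ∣ κ * (f * f * ν * l - 2ℚ * r) ∣
      ≡⟨ ∣*∣ˡ (f * f * ν * l - 2ℚ * r) 0≤κ ⟩
    κ * ∣ f * f * ν * l - 2ℚ * r ∣
      ≤⟨ *-monoˡ 0≤κ h ⟩
    κ * (η * (2ℚ * r))
      ≡⟨ solve 3 (λ k e r → k :* (e :* r) := e :* (k :* r)) refl κ η (2ℚ * r) ⟩
    η * (κ * (2ℚ * r)) ∎
    where
    open ℚ.≤-Reasoning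
    κ = U * F * c * (P * P)
    0≤κ = 0≤* 0≤UFc (0≤square P)

  CountClose : ℕ → ℚ → ℚ → Set
  CountClose q F η = ∃[ N ] ∀ b → N ℕ.≤ b → ∀ n → n ≡ q ℕ.+ suc (2 ℕ.* b) → ∃[ M ] ∀ m → M ℕ.≤ m →
    let a = fromNat (count 0 q b) in ∣ a * a * rationalY q F n m - rationalV q n ∣ ≤ η * rationalV q n

  -- For a variable `q`, instead of a successor, `fromNat q` and the powers with exponent `q` do not
  -- unfold. `F` stands for (q-1)!.
  module Asymptotics (q : ℕ) (0<Q : 0ℚ < fromNat q) (F : ℚ) (0≤F : 0ℚ ≤ F) (q! : fromNat (q !) ≡ fromNat q * F) where

    c4 = fromNat 2 * fromNat 2
    0<4Q : 0ℚ < c4 * fromNat q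
    0<4Q = *-pos 0<4 0<Q
    ζ = recip (c4 * fromNat q)

    open Terms q ζ (recip-pos 0<4Q)
      (trans (solve 3 (λ c z q → c :* z :* q := c :* q :* z) refl c4 ζ (fromNat q)) (recip-inverse 0<4Q))
    open Scaled ζ using (terms)

    r = limit q

    r*F : r * F ≡ Q * Q ^ℚ q
    r*F = *-cancelˡ 0<Q (trans (solve 3 (λ q r f → q :* (r :* f) := r :* (q :* f)) refl Q r F)
      (trans (cong (r *_) (sym q!)) (trans (limit-closed q) (ℚ.*-assoc Q Q (Q ^ℚ q)))))

    0<limit : ∀ j → 0ℚ < limit j
    0<limit zero    = *-pos 0<Q 0<Q
    0<limit (suc j) = *-pos (0<limit j) (*-pos 0<Q (recip-pos (0<fromNat j)))

    count≡ : ∀ b → fromNat (count 0 q b) ≡ terms 0 q b * (c4 * Q) ^ℚ b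
    count≡ b = sym (trans (ℚ.*-assoc (fromNat (count 0 q b)) (ζ ^ℚ b) ((c4 * Q) ^ℚ b))
      (trans (cong (fromNat (count 0 q b) *_) (trans (sym (^-* ζ (c4 * Q) b))
        (trans (cong (_^ℚ b) (trans (ℚ.*-comm ζ (c4 * Q)) (recip-inverse 0<4Q))) (1^ b))))
      (ℚ.*-identityʳ (fromNat (count 0 q b)))))

    count-close : ∀ η → 0ℚ < η → CountClose q F η
    count-close η 0<η = proj₁ asym , λ b le n e → proj₁ (proj₂ asym b le) , λ m le′ →
      transfer {fromNat (count 0 q b)} {terms 0 q b} {(c4 * Q) ^ℚ b} {c4 ^ℚ q} {F} {fromNat 4} {leibniz 0 m}
        {cube (fromNat n)} {r} {η} {rationalY q F n m} {rationalV q n} (count≡ b) refl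
        (trans (cong (λ n → fromNat 2 * (c4 * Q) ^ℚ n) e) (trans (cong (fromNat 2 *_) (power-split c4 Q q b))
          (scaling {fromNat 2} {c4} {fromNat 4} {c4 ^ℚ q} {Q ^ℚ q} {Q} {(c4 * Q) ^ℚ b} {F} {r} refl refl r*F)))
        (0≤* (0≤* (0≤^ q (ℚ.<⇒≤ 0<4)) 0≤F) (0≤fromNat 4))
        (subst (λ n → ∣ terms 0 q b * terms 0 q b * cube (fromNat n) * leibniz 0 m - 2ℚ * r ∣ ≤ η * (2ℚ * r))
          (sym e) (proj₂ (proj₂ asym b le) m le′))
      where
      asym = lim-asymptotic q (0<limit q) (lim-terms q 0 refl) η 0<η

  q!≡ : ∀ p → fromNat ((suc p) !) ≡ fromNat (suc p) * fromNat (p !)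
  q!≡ p = fromNat-* (suc p) (p !)

  count-close-suc : ∀ p η → 0ℚ < η → CountClose (suc p) (fromNat (p !)) η
  count-close-suc p = Asymptotics.count-close (suc p) (0<fromNat p) (fromNat (p !)) (0≤fromNat (p !)) (q!≡ p)

  GoodCount : (p : ℕ) → ℚ → ℕ → (n : ℕ) → .{{_ : NonZero n}} → Set
  GoodCount p ε c n = ∃[ M ] ∀ m → M ℕ.≤ m
    → ∣ fromNat c - approx (Target.g p n) m ∣ ≤ ε * ∣ approx (Target.g p n) m ∣

  count⇒closedCount : ∀ p {η ε} → 0ℚ < η → η ≤ ½ → η * (2ℚ * 2ℚ) ≤ ε →
    CountClose (suc p) (fromNat (p !)) η →
    ∃[ N ] ∀ n .{{_ : NonZero n}} → N ℕ.≤ n → n ℕ.% 2 ≢ suc p ℕ.% 2 → GoodCount p ε (closedCount (suc p) n) n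
  count⇒closedCount p {η} {ε} 0<η η≤½ 4η≤ε (N , close) = q ℕ.+ suc (2 ℕ.* N) , λ n le odd →
    bound n le (odd-offset q n (ℕ.≤-trans (ℕ.m≤m+n q (suc (2 ℕ.* N))) le) odd)
    where
    q = suc p
    bound : ∀ n .{{_ : NonZero n}} → q ℕ.+ suc (2 ℕ.* N) ℕ.≤ n → ∃[ b ] n ≡ q ℕ.+ suc (2 ℕ.* b)
      → GoodCount p ε (closedCount q n) n
    bound n le (b , e) = subst (λ c → GoodCount p ε c n) (sym
      (trans (cong (closedCount q) e) (closedCount-odd q b)))
      (Target.target-asymptotic p n {fromNat (count 0 q b)} {ε} η
        (0≤fromNat (count 0 q b)) 0<η η≤½ 4η≤ε (close b N≤b n e))
      where
      N≤b : N ℕ.≤ b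
      N≤b = ℕ.*-cancelˡ-≤ 2 (ℕ.s≤s⁻¹ (ℕ.+-cancelˡ-≤ q (suc (2 ℕ.* N)) (suc (2 ℕ.* b))
        (subst (q ℕ.+ suc (2 ℕ.* N) ℕ.≤_) e le)))

  closedCount-asymptotic : ∀ p ε → 0ℚ < ε → ∃[ N ] ∀ n .{{_ : NonZero n}} → N ℕ.≤ n → n ℕ.% 2 ≢ suc p ℕ.% 2 →
    GoodCount p ε (closedCount (suc p) n) n
  closedCount-asymptotic p ε 0<ε =
    -- η is δ/2: then δ ≤ 1 gives η ≤ ½, and 4η ≤ 4δ ≤ ε.
    let δ , 0<δ , δ≤1 , 4δ≤ε = fraction (ℚ.nonNegative⁻¹ (2ℚ * 2ℚ)) 0<ε
        0<½δ = *-pos 0<½ 0<δ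
    in count⇒closedCount p 0<½δ
         (subst (½ * δ ≤_) (ℚ.*-identityʳ ½) (*-monoˡ (ℚ.<⇒≤ 0<½) δ≤1))
         (ℚ.≤-trans (*-monoʳ (ℚ.nonNegative⁻¹ (2ℚ * 2ℚ))
           (subst (½ * δ ≤_) (Defs.Lemmas.½+½ δ) (p≤p+q (ℚ.<⇒≤ 0<½δ)))) 4δ≤ε)
         (count-close-suc p (½ * δ) 0<½δ)

  closedCount-∼ : ∀ p ε → 0ℚ < ε → ∃[ N ] ∀ n → .{{_ : NonZero n}} → N ℕ.≤ n → n ℕ.% 2 ≢ suc p ℕ.% 2 →
    D.∣ fromℕ (closedCount (suc p) n) D.- Target.g p n ∣ D.≤ D.fromℚ ε D.* D.∣ Target.g p n ∣
  closedCount-∼ p ε 0<ε =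
    let N , h = closedCount-asymptotic p ε 0<ε in N , λ n N≤n odd ε′ 0<ε′ →
      let M , k = h n N≤n odd in M , λ m M≤m → ℚ.≤-trans
        (subst (λ c → ∣ c - approx (Target.g p n) m ∣ ≤ ε * ∣ approx (Target.g p n) m ∣)
          (fromNat≡/1 (closedCount (suc p) n)) (k m M≤m))
        (p≤p+q (ℚ.<⇒≤ 0<ε′))

open import Data.Nat using (_∸_; _%_; _!; _≥_)
open import Data.Nat.Properties using (_!≢0)
open import Defs using (ClosedTerms; HasCardinality; fromℕ; π; √_; _*_; _/_; _^_; _∼[_]_; fromℕ-positive; *-positive; √-positive; ^-positive; π/4-positive)
open Counting using (closedCount; closedTerms-card; closedCount-zero)
open ClosedTermAsymptotics using (closedCount-∼)

proposition4 : (q : ℕ) → q ≥ 1 → Σ[ a ∈ (ℕ → ℕ) ]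
    ((n : ℕ) → HasCardinality (ClosedTerms q n) (a n)) ×
    ((n : ℕ) → n % 2 ≡ q % 2 → a n ≡ 0) ×
    ((λ n → fromℕ (a n)) ∼[ (λ n → n % 2 ≢ q % 2) ]
    (λ n → let instance _ = (q ∸ 1) !≢0 in
    √ fromℕ 2 / (fromℕ 2 ^ q * √ fromℕ ((q ∸ 1) !) * √ (π * fromℕ n ^ 3))
    * (fromℕ 2 * √ fromℕ q) ^ n))
proposition4 (suc p) _ = closedCount (suc p) , closedTerms-card (suc p) , closedCount-zero (suc p) , closedCount-∼ p
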